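{- Let $d\ge 0$ be a real number that is not an odd integer, let $n\geq 2$ be an integer, and let $C=\mathrm{circ}_n(c_0,c_1,\ldots,c_{n-1})$ be a Hermitian circulant matrix such that $c_0=d$, $c_j\in\{1,-1,\mathrm{i},-\mathrm{i}\}$ for all $j=1,\ldots,n-1$, and $CC^*=(d^2+n-1)I$. Then $n=2d+2$. Moreover, $C$ is real and takes the following form: \begin{itemize} \item if $d$ is an even integer, then $C=\mathrm{circ}_{2d+2}(d,-1,-1,\ldots,-1)$ or $C=\mathrm{circ}_{2d+2}(d,1,-1,1,-1,1,\ldots,-1,1)$ (in the latter, the off-diagonal entries alternate, $c_j=(-1)^{j+1}$ for $j=1,\ldots,2d+1$); \item if $d$ is a half-integer, then $C=\mathrm{circ}_{2d+2}(d,-1,-1,\ldots,-1)$. \end{itemize}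
   Context: For complex numbers $c_0,\ldots,c_{n-1}$, $\mathrm{circ}_n(c_0,c_1,\ldots,c_{n-1})$ denotes the $n\times n$ circulant matrix with first row (generator) $(c_0,c_1,\ldots,c_{n-1})$, i.e. with rows and columns indexed by $0,\ldots,n-1$ its $(r,s)$ entry is $c_{(s-r)\bmod n}$. $C^*$ is the conjugate transpose and $I$ the identity matrix. A half-integer is a number $d$ such that $2d$ is an odd integer. -}

module Defs where

open import Algebra.Bundles.Raw using (RawRing)
import Algebra.Definitions.RawMonoid as RawMonoidDefs
import Algebra.Definitions.RawSemiring as RawSemiringDefs
open import Data.Fin.Base using (Fin; zero; suc; toℕ; fromℕ<)
import Data.Fin.Properties as Fin
open import Data.Integer.Base as ℤ using (ℤ; +_; _%ℕ_)
open import Data.Integer.DivMod using (n%ℕd<d)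
open import Data.Nat.Base as ℕ using (ℕ; zero; suc)
import Data.Nat.Properties as ℕ
open import Data.Product.Base using (∃; _×_; _,_)
open import Data.Rational.Base as ℚ
  using (ℚ; 0ℚ; 1ℚ; ½; ∣_∣; _+_; _-_; _*_; -_; _<_; _≤_; Positive; positive; 1/_)
open import Data.Rational.Properties
open import Data.Rational.Solver using (module +-*-Solver)
open import Level using (0ℓ)
open import Relation.Binary.PropositionalEquality
  using (_≡_; refl; sym; trans; cong; cong₂; subst)
open import Relation.Nullary using (yes; no)

-- Cauchy sequences of rationals with pointwise operations, compared by
-- the equivalence _≃_ ("the difference tends to 0") rather than by _≡_.

IsCauchy : (ℕ → ℚ) → Set
IsCauchy x = ∀ ε → 0ℚ < ε →
  ∃ λ N → ∀ m n → N ℕ.≤ m → N ℕ.≤ n → ∣ x m - x n ∣ < ε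

record ℝ : Set where
  constructor mkℝ
  field
    seq    : ℕ → ℚ
    cauchy : IsCauchy seq

open ℝ public

infix 4 _≃_ _≤ᴿ_

_≃_ : ℝ → ℝ → Set
x ≃ y = ∀ ε → 0ℚ < ε → ∃ λ N → ∀ n → N ℕ.≤ n → ∣ seq x n - seq y n ∣ < ε

_≤ᴿ_ : ℝ → ℝ → Set
x ≤ᴿ y = ∀ ε → 0ℚ < ε → ∃ λ N → ∀ n → N ℕ.≤ n → seq x n ≤ seq y n + ε

open +-*-Solver

abstract
  ½*-pos : ∀ {ε} → 0ℚ < ε → 0ℚ < ½ * ε
  ½*-pos {ε} 0<ε = subst (_< ½ * ε) (*-zeroʳ ½) (*-monoʳ-<-pos ½ 0<ε)

  ½*+½* : ∀ ε → ½ * ε + ½ * ε ≡ ε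
  ½*+½* = solve 1 (λ e → con ½ :* e :+ con ½ :* e := e) refl

  +-cauchy : ∀ x y → IsCauchy x → IsCauchy y → IsCauchy (λ n → x n + y n)
  +-cauchy x y cx cy ε 0<ε
    with M , p ← cx (½ * ε) (½*-pos 0<ε)
       | N , q ← cy (½ * ε) (½*-pos 0<ε)
    = M ℕ.⊔ N , λ m n l l′ → begin-strict
        ∣ (x m + y m) - (x n + y n) ∣
          ≡⟨ cong ∣_∣ (rearrange (x m) (y m) (x n) (y n)) ⟩
        ∣ (x m - x n) + (y m - y n) ∣
          ≤⟨ ∣p+q∣≤∣p∣+∣q∣ (x m - x n) (y m - y n) ⟩
        ∣ x m - x n ∣ + ∣ y m - y n ∣
          <⟨ +-mono-< (p m n (ℕ.m⊔n≤o⇒m≤o M N l) (ℕ.m⊔n≤o⇒m≤o M N l′))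
                      (q m n (ℕ.m⊔n≤o⇒n≤o M N l) (ℕ.m⊔n≤o⇒n≤o M N l′)) ⟩
        ½ * ε + ½ * ε
          ≡⟨ ½*+½* ε ⟩
        ε ∎
    where
    open ≤-Reasoning
    rearrange : ∀ a b c d → (a + b) - (c + d) ≡ (a - c) + (b - d)
    rearrange = solve 4 (λ a b c d →
      (a :+ b) :- (c :+ d) := (a :- c) :+ (b :- d)) refl

  -‿cauchy : ∀ x → IsCauchy x → IsCauchy (λ n → - x n)
  -‿cauchy x cx ε 0<ε with N , p ← cx ε 0<ε
    = N , λ m n l l′ → subst (_< ε) (sym (flip-sign (x m) (x n))) (p m n l l′)
    where
    flip-sign : ∀ a b → ∣ (- a) - (- b) ∣ ≡ ∣ a - b ∣
    flip-sign a b = trans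
      (cong ∣_∣ (solve 2 (λ a b → (:- a) :- (:- b) := :- (a :- b)) refl a b))
      (∣-p∣≡∣p∣ (a - b))

  0<1 : 0ℚ < 1ℚ
  0<1 = positive⁻¹ 1ℚ

  eventually-bounded : ∀ {x} → IsCauchy x →
    ∃ λ B → 0ℚ < B × ∃ λ N → ∀ n → N ℕ.≤ n → ∣ x n ∣ ≤ B
  eventually-bounded {x} cx with N , p ← cx 1ℚ 0<1
    = ∣ x N ∣ + 1ℚ , +-mono-≤-< (0≤∣p∣ (x N)) 0<1 , N , λ n l → begin
        ∣ x n ∣                  ≡⟨ cong ∣_∣ (split (x N) (x n)) ⟩
        ∣ x N + (x n - x N) ∣    ≤⟨ ∣p+q∣≤∣p∣+∣q∣ (x N) (x n - x N) ⟩
        ∣ x N ∣ + ∣ x n - x N ∣  ≤⟨ +-monoʳ-≤ ∣ x N ∣ (<⇒≤ (p n N l ℕ.≤-refl)) ⟩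
        ∣ x N ∣ + 1ℚ             ∎
    where
    open ≤-Reasoning
    split : ∀ a b → b ≡ a + (b - a)
    split = solve 2 (λ a b → b := a :+ (b :- a)) refl

  quotient : ∀ {B ε} → 0ℚ < B → 0ℚ < ε → ∃ λ δ → 0ℚ < δ × B * δ ≡ ε
  quotient {B} {ε} 0<B 0<ε = 1/ B * ε , 0<δ , eq
    where
    instance
      B-pos : Positive B
      B-pos = positive 0<B
      B-nonZero : ℚ.NonZero B
      B-nonZero = pos⇒nonZero B
      1/B-pos : Positive (1/ B)
      1/B-pos = 1/pos⇒pos B
    0<δ : 0ℚ < 1/ B * ε
    0<δ = subst (_< 1/ B * ε) (*-zeroʳ (1/ B)) (*-monoʳ-<-pos (1/ B) 0<ε)
    eq : B * (1/ B * ε) ≡ ε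
    eq = trans (sym (*-assoc B (1/ B) ε))
               (trans (cong (_* ε) (*-inverseʳ B)) (*-identityˡ ε))

  *-bound : ∀ a b B δ → 0ℚ < B → ∣ a ∣ ≤ B → ∣ b ∣ < δ → ∣ a * b ∣ < B * δ
  *-bound a b B δ 0<B a≤B b<δ = begin-strict
    ∣ a * b ∣      ≡⟨ ∣p*q∣≡∣p∣*∣q∣ a b ⟩
    ∣ a ∣ * ∣ b ∣  ≤⟨ *-monoʳ-≤-nonNeg ∣ b ∣ a≤B ⟩
    B * ∣ b ∣      <⟨ *-monoʳ-<-pos B b<δ ⟩
    B * δ          ∎
    where
    open ≤-Reasoning
    instance
      B-pos : Positive B
      B-pos = positive 0<B
      ∣b∣-nonNeg : ℚ.NonNegative ∣ b ∣
      ∣b∣-nonNeg = ∣-∣-nonNeg b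

  *-close : ∀ a b c d A B α β ε → 0ℚ < A → 0ℚ < B →
    A * α ≡ ½ * ε → B * β ≡ ½ * ε →
    ∣ a ∣ ≤ A → ∣ d ∣ ≤ B → ∣ b - d ∣ < α → ∣ a - c ∣ < β →
    ∣ a * b - c * d ∣ < ε
  *-close a b c d A B α β ε 0<A 0<B Aα Bβ a≤A d≤B b-d<α a-c<β = begin-strict
    ∣ a * b - c * d ∣
      ≡⟨ cong ∣_∣ (rearrange a b c d) ⟩
    ∣ a * (b - d) + d * (a - c) ∣
      ≤⟨ ∣p+q∣≤∣p∣+∣q∣ (a * (b - d)) (d * (a - c)) ⟩
    ∣ a * (b - d) ∣ + ∣ d * (a - c) ∣
      <⟨ +-mono-< (*-bound a (b - d) A α 0<A a≤A b-d<α)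
                  (*-bound d (a - c) B β 0<B d≤B a-c<β) ⟩
    A * α + B * β
      ≡⟨ cong₂ _+_ Aα Bβ ⟩
    ½ * ε + ½ * ε
      ≡⟨ ½*+½* ε ⟩
    ε ∎
    where
    open ≤-Reasoning
    rearrange : ∀ a b c d → a * b - c * d ≡ a * (b - d) + d * (a - c)
    rearrange = solve 4 (λ a b c d →
      a :* b :- c :* d := a :* (b :- d) :+ d :* (a :- c)) refl

  *-cauchy : ∀ x y → IsCauchy x → IsCauchy y → IsCauchy (λ n → x n * y n)
  *-cauchy x y cx cy ε 0<ε =
    let A , 0<A , K , x≤A = eventually-bounded {x} cx
        B , 0<B , L , y≤B = eventually-bounded {y} cy
        α , 0<α , Aα = quotient {A} {½ * ε} 0<A (½*-pos 0<ε)
        β , 0<β , Bβ = quotient {B} {½ * ε} 0<B (½*-pos 0<ε)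
        M , p = cy α 0<α
        N , q = cx β 0<β
        P = K ℕ.⊔ L
        Q = M ℕ.⊔ N
    in P ℕ.⊔ Q , λ m n l l′ →
      let P≤m = ℕ.m⊔n≤o⇒m≤o P Q l
          P≤n = ℕ.m⊔n≤o⇒m≤o P Q l′
          Q≤m = ℕ.m⊔n≤o⇒n≤o P Q l
          Q≤n = ℕ.m⊔n≤o⇒n≤o P Q l′
      in *-close (x m) (y m) (x n) (y n) A B α β ε 0<A 0<B Aα Bβ
           (x≤A m (ℕ.m⊔n≤o⇒m≤o K L P≤m)) (y≤B n (ℕ.m⊔n≤o⇒n≤o K L P≤n))
           (p m n (ℕ.m⊔n≤o⇒m≤o M N Q≤m) (ℕ.m⊔n≤o⇒m≤o M N Q≤n))
           (q m n (ℕ.m⊔n≤o⇒n≤o M N Q≤m) (ℕ.m⊔n≤o⇒n≤o M N Q≤n))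

infixl 6 _+ᴿ_ _-ᴿ_
infixl 7 _*ᴿ_
infix  8 -ᴿ_

_+ᴿ_ : ℝ → ℝ → ℝ
x +ᴿ y = mkℝ (λ n → seq x n + seq y n) (+-cauchy (seq x) (seq y) (cauchy x) (cauchy y))

-ᴿ_ : ℝ → ℝ
-ᴿ x = mkℝ (λ n → - seq x n) (-‿cauchy (seq x) (cauchy x))

_-ᴿ_ : ℝ → ℝ → ℝ
x -ᴿ y = x +ᴿ (-ᴿ y)

_*ᴿ_ : ℝ → ℝ → ℝ
x *ᴿ y = mkℝ (λ n → seq x n * seq y n) (*-cauchy (seq x) (seq y) (cauchy x) (cauchy y))

fromℚ : ℚ → ℝ
fromℚ q = mkℝ (λ _ → q) λ ε 0<ε →
  0 , λ _ _ _ _ → subst (_< ε) (sym (cong ∣_∣ (+-inverseʳ q))) 0<ε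

fromℤ : ℤ → ℝ
fromℤ i = fromℚ (i ℚ./ 1)

fromℕ : ℕ → ℝ
fromℕ n = fromℤ (+ n)

IsEvenInteger IsOddInteger IsHalfInteger : ℝ → Set
IsEvenInteger x = ∃ λ (k : ℤ) → x ≃ fromℤ (+ 2 ℤ.* k)
IsOddInteger  x = ∃ λ (k : ℤ) → x ≃ fromℤ (+ 2 ℤ.* k ℤ.+ + 1)
IsHalfInteger x = IsOddInteger (fromℕ 2 *ᴿ x)

infix 6 _+i_

record ℂ : Set where
  constructor _+i_
  field
    re : ℝ
    im : ℝ

open ℂ public

infix 4 _≈_
_≈_ : ℂ → ℂ → Set
z ≈ w = re z ≃ re w × im z ≃ im w

infixl 6 _+ᶜ_
infixl 7 _*ᶜ_
infix  8 -ᶜ_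

_+ᶜ_ _*ᶜ_ : ℂ → ℂ → ℂ
z +ᶜ w = (re z +ᴿ re w) +i (im z +ᴿ im w)
z *ᶜ w = (re z *ᴿ re w -ᴿ im z *ᴿ im w) +i (re z *ᴿ im w +ᴿ im z *ᴿ re w)

-ᶜ_ conj : ℂ → ℂ
-ᶜ z   = (-ᴿ re z) +i (-ᴿ im z)
conj z = re z +i (-ᴿ im z)

fromℝ : ℝ → ℂ
fromℝ x = x +i fromℕ 0

0ᶜ 1ᶜ i : ℂ
0ᶜ = fromℝ (fromℕ 0)
1ᶜ = fromℝ (fromℕ 1)
i  = fromℕ 0 +i fromℕ 1

IsReal : ℂ → Set
IsReal z = im z ≃ fromℕ 0

ℂ-rawRing : RawRing 0ℓ 0ℓ
ℂ-rawRing = record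
  { Carrier = ℂ ; _≈_ = _≈_
  ; _+_ = _+ᶜ_ ; _*_ = _*ᶜ_ ; -_ = -ᶜ_
  ; 0# = 0ᶜ ; 1# = 1ᶜ
  }

open RawMonoidDefs (RawRing.+-rawMonoid ℂ-rawRing) public using (sum)
open RawSemiringDefs (RawRing.rawSemiring ℂ-rawRing) public using (_^_)

Matrix : ℕ → Set
Matrix n = Fin n → Fin n → ℂ

infix 4 _≋_
_≋_ : ∀ {n} → Matrix n → Matrix n → Set
A ≋ B = ∀ r s → A r s ≈ B r s

infixl 7 _⊗_
_⊗_ : ∀ {n} → Matrix n → Matrix n → Matrix n
(A ⊗ B) r s = sum λ k → A r k *ᶜ B k s

infix 9 _⋆
_⋆ : ∀ {n} → Matrix n → Matrix n
(A ⋆) r s = conj (A s r)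

I : ∀ {n} → Matrix n
I r s with r Fin.≟ s
... | yes _ = 1ᶜ
... | no  _ = 0ᶜ

infixr 7 _·_
_·_ : ∀ {n} → ℂ → Matrix n → Matrix n
(z · A) r s = z *ᶜ A r s

IsHermitian : ∀ {n} → Matrix n → Set
IsHermitian A = A ⋆ ≋ A

circ : ∀ {n} → (Fin n → ℂ) → Matrix n
circ {n} c r s = c (fromℕ< (n%ℕd<d (+ toℕ s ℤ.- + toℕ r) n))
  where
  instance
    n≢0 : ℕ.NonZero n
    n≢0 = Fin.nonZeroIndex r

-- The generator (z , f 1 , f 2 , … , f (n − 1)).
generator : ∀ {n} → ℂ → (ℕ → ℂ) → Fin n → ℂ
generator z f zero    = z
generator z f (suc j) = f (suc (toℕ j))

{-# OPTIONS --safe #-}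

-- Write c_j = a_j + i b_j off the diagonal. Row 0 against row s of CC* gives, with D = 2d and * the cyclic convolution,
--   D a_s + (a * a − b * b)_s = 0  and  D b_s + 2 (a * b)_s = 0  for s ≠ 0,
-- so D is an integer, and by hypothesis it is odd or divisible by 4. If D is odd, then b takes even values, hence is 0, and
-- the first equation modulo 4 makes a constant. If 4 ∣ D, then modulo 4 the first equation makes a² constant off 0; as the function b is
-- odd and so vanishes at n/2, again b = 0, and n = 2h with h odd.
--
-- In the remaining case d and the a_j are the values of a real f with f * f = N δ, N = d² + 2h − 1. Let p and q be the
-- h-periodic folds f(x) + f(x + h) of f and of (−1)ˣ f(x). Then p * p = q * q = N δ, and off 0 one of p, q is ±2 and the
-- other is 0. This forces h² ∣ N by descent: let l be a prime divisor of h. Modulo l, Frobenius gives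
-- N^((l−1)/2) p = p * ⋯ * p = Σ p(k) δ(x − l k). At x = 1 the right-hand side vanishes, so l ∣ N; then, at multiples of l,
-- it shows that the sums of p and q over the fibres of ℤ/h → ℤ/(h/l) are divisible by l, and the quotients satisfy the
-- same conditions with h/l and N/l². From h² ≤ N we get d ≥ h − 1, and p(0)², q(0)² ≤ Σ p² = N give d ≤ h − 1. So N = h²,
-- one of p, q vanishes off 0, and the sum of the other is ±h, which determines its signs.

module Submission where

-- A fold alone carries no property that survives the descent, since off 0 it may vanish; the pair
-- does. Off 0, p = 2A and q = 2B with |A| + |B| = 1. Over a fibre of odd size l the sums of A and
-- of B have absolute values adding up to at most l, and their total is odd. Being multiples of l,
-- they are l times a pair of the same kind. So h must be known to be odd before the descent starts,
-- and the computation modulo 4 supplies this. For an odd integer d, where D ≡ 2 modulo 4, that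
-- computation says nothing: D a ≡ 2a² cancels the only term in which a² varies with s. Frobenius is
-- applied in the semiring of additive operators on functions modulo l, where convolution with p is
-- a polynomial in the shift; no group ring is built. As d is an arbitrary real, the rows are first
-- kept as polynomials in d with integer coefficients. Since c₁ is a unit, the equation at position
-- 1 shows that 2d is an integer; from then on only integers occur.

-- Sums over a period and cyclic convolution of functions on ℤ.

module PeriodicSums where

  open import Data.Bool.Base using (if_then_else_)
  open import Data.Integer.Base using (ℤ; +_; -[1+_]; 0ℤ; 1ℤ; _+_; _*_; -_; _-_)
  open import Data.Integer.Properties as ℤP using (+-identityʳ; +-identityˡ; +-comm; +-assoc; *-distribˡ-+; *-zeroʳ; *-zeroˡ; *-comm; pos-+; pos-*)
  open import Data.Integer.Divisibility.Signed using (_∣_; divides; _∣?_; ∣⇒∣ᵤ; ∣m∣n⇒∣m+n; ∣m⇒∣-m)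
  open import Data.Integer.Tactic.RingSolver using (solve-∀)
  open import Data.Nat.Base as ℕ using (ℕ; zero; suc; NonZero)
  import Data.Nat.Properties as ℕ
  import Data.Nat.Divisibility as ℕ
  open import Function.Base using (_∘_; case_of_)
  open import Relation.Binary.PropositionalEquality
  open import Relation.Nullary using (¬_; yes; no; does)
  open import Relation.Nullary.Decidable using (dec-true; dec-false)
  open ≡-Reasoning

  Σ : ℕ → (ℤ → ℤ) → ℤ
  Σ zero    f = 0ℤ
  Σ (suc n) f = Σ n f + f (+ n)

  Σ-cong< : ∀ n {f g} → (∀ k → k ℕ.< n → f (+ k) ≡ g (+ k)) → Σ n f ≡ Σ n g
  Σ-cong< zero    e = refl
  Σ-cong< (suc n) e = cong₂ _+_ (Σ-cong< n (λ k k<n → e k (ℕ.m<n⇒m<1+n k<n))) (e n (ℕ.n<1+n n))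

  Σ-cong : ∀ n {f g} → (∀ x → f x ≡ g x) → Σ n f ≡ Σ n g
  Σ-cong n e = Σ-cong< n (λ k _ → e (+ k))

  interchange : ∀ a b c d → (a + b) + (c + d) ≡ (a + c) + (b + d)
  interchange = solve-∀

  Σ-+ : ∀ n f g → Σ n (λ x → f x + g x) ≡ Σ n f + Σ n g
  Σ-+ zero    f g = refl
  Σ-+ (suc n) f g = trans (cong (_+ (f (+ n) + g (+ n))) (Σ-+ n f g))
    (interchange (Σ n f) (Σ n g) (f (+ n)) (g (+ n)))

  Σ-*ˡ : ∀ n c f → Σ n (λ x → c * f x) ≡ c * Σ n f
  Σ-*ˡ zero    c f = sym (*-zeroʳ c)
  Σ-*ˡ (suc n) c f = trans (cong (_+ c * f (+ n)) (Σ-*ˡ n c f)) (sym (*-distribˡ-+ c (Σ n f) (f (+ n))))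

  Σ-*ʳ : ∀ n c f → Σ n (λ x → f x * c) ≡ Σ n f * c
  Σ-*ʳ n c f = trans (Σ-cong n (λ x → *-comm (f x) c)) (trans (Σ-*ˡ n c f) (*-comm c (Σ n f)))

  Σ-0 : ∀ n → Σ n (λ _ → 0ℤ) ≡ 0ℤ
  Σ-0 zero    = refl
  Σ-0 (suc n) = trans (+-identityʳ _) (Σ-0 n)

  Σ-const : ∀ n c → Σ n (λ _ → c) ≡ + n * c
  Σ-const zero    c = sym (*-zeroˡ c)
  Σ-const (suc n) c = trans (cong (_+ c) (Σ-const n c)) (lemma (+ n) c)
    where
    lemma : ∀ m c → m * c + c ≡ (1ℤ + m) * c
    lemma = solve-∀

  Σ-swap : ∀ m n (F : ℤ → ℤ → ℤ) → Σ m (λ x → Σ n (F x)) ≡ Σ n (λ y → Σ m (λ x → F x y))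
  Σ-swap zero    n F = sym (Σ-0 n)
  Σ-swap (suc m) n F = trans (cong (_+ Σ n (F (+ m))) (Σ-swap m n F))
    (sym (Σ-+ n (λ y → Σ m (λ x → F x y)) (F (+ m))))

  Σ-head : ∀ n f → Σ (suc n) f ≡ f 0ℤ + Σ n (λ x → f (x + 1ℤ))
  Σ-head zero    f = +-comm 0ℤ (f 0ℤ)
  Σ-head (suc n) f = begin
    Σ (suc n) f + f (+ suc n)                             ≡⟨ cong₂ _+_ (Σ-head n f) (cong f (+-comm 1ℤ (+ n))) ⟩
    f 0ℤ + Σ n (λ x → f (x + 1ℤ)) + f (+ n + 1ℤ)          ≡⟨ +-assoc (f 0ℤ) _ _ ⟩
    f 0ℤ + (Σ n (λ x → f (x + 1ℤ)) + f (+ n + 1ℤ))        ∎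

  Σ-append : ∀ m n f → Σ (m ℕ.+ n) f ≡ Σ m f + Σ n (λ x → f (x + + m))
  Σ-append m zero    f rewrite ℕ.+-identityʳ m = sym (+-identityʳ _)
  Σ-append m (suc n) f rewrite ℕ.+-suc m n = begin
    Σ (m ℕ.+ n) f + f (+ (m ℕ.+ n))                     ≡⟨ cong₂ _+_ (Σ-append m n f) (cong f (trans (pos-+ m n) (+-comm (+ m) (+ n)))) ⟩
    Σ m f + Σ n (λ x → f (x + + m)) + f (+ n + + m)     ≡⟨ +-assoc (Σ m f) _ _ ⟩
    Σ m f + (Σ n (λ x → f (x + + m)) + f (+ n + + m))   ∎

  Periodic : ℕ → (ℤ → ℤ) → Set
  Periodic n f = ∀ x → f (x + + n) ≡ f x

  periodic-*ℕ : ∀ {n f} → Periodic n f → ∀ k x → f (x + + k * + n) ≡ f x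
  periodic-*ℕ {n} {f} per zero    x = cong f (trans (cong (_+_ x) (*-zeroˡ (+ n))) (+-identityʳ x))
  periodic-*ℕ {n} {f} per (suc k) x = begin
    f (x + + suc k * + n)        ≡⟨ cong f (lemma x (+ k) (+ n)) ⟩
    f ((x + + k * + n) + + n)    ≡⟨ per _ ⟩
    f (x + + k * + n)            ≡⟨ periodic-*ℕ per k x ⟩
    f x                          ∎
    where
    lemma : ∀ x k n → x + (1ℤ + k) * n ≡ (x + k * n) + n
    lemma = solve-∀

  periodic-* : ∀ {n f} → Periodic n f → ∀ k x → f (x + k * + n) ≡ f x
  periodic-* per (+ k) x = periodic-*ℕ per k x
  periodic-* {n} {f} per -[1+ k ] x = sym (trans (cong f (lemma x (+ suc k) (+ n)))
    (periodic-*ℕ per (suc k) (x + -[1+ k ] * + n)))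
    where
    lemma : ∀ x k n → x ≡ (x + (- k) * n) + k * n
    lemma = solve-∀

  periodic-≡ : ∀ {n f} → Periodic n f → ∀ {x y} → + n ∣ x - y → f x ≡ f y
  periodic-≡ {n} {f} per {x} {y} (divides q eq) = trans (cong f (trans (lemma x y) (cong (_+_ y) eq))) (periodic-* per q y)
    where
    lemma : ∀ x y → x ≡ y + (x - y)
    lemma = solve-∀

  +-rightComm : ∀ a b c → (a + b) + c ≡ (a + c) + b
  +-rightComm = solve-∀

  periodic-shift : ∀ {n f} a → Periodic n f → Periodic n (λ x → f (x + a))
  periodic-shift {n} {f} a per x = trans (cong f (+-rightComm x (+ n) a)) (per (x + a))

  +-cancelˡ : ∀ a b c → a + b ≡ a + c → b ≡ c
  +-cancelˡ a b c eq = trans (lemma a b) (trans (cong (_+_ (- a)) eq) (sym (lemma a c)))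
    where
    lemma : ∀ a b → b ≡ - a + (a + b)
    lemma = solve-∀

  Σ-shift1 : ∀ n {f} → Periodic n f → Σ n (λ x → f (x + 1ℤ)) ≡ Σ n f
  Σ-shift1 n {f} per = +-cancelˡ (f 0ℤ) _ _ (begin
    f 0ℤ + Σ n (λ x → f (x + 1ℤ))   ≡⟨ Σ-head n f ⟨
    Σ n f + f (+ n)                 ≡⟨ cong (λ z → Σ n f + f z) (+-identityˡ (+ n)) ⟨
    Σ n f + f (0ℤ + + n)            ≡⟨ cong (_+_ (Σ n f)) (per 0ℤ) ⟩
    Σ n f + f 0ℤ                    ≡⟨ +-comm (Σ n f) (f 0ℤ) ⟩
    f 0ℤ + Σ n f                    ∎)

  Σ-shiftℕ : ∀ n {f} → Periodic n f → ∀ a → Σ n (λ x → f (x + + a)) ≡ Σ n f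
  Σ-shiftℕ n {f} per zero    = Σ-cong n (λ x → cong f (+-identityʳ x))
  Σ-shiftℕ n {f} per (suc a) = trans (Σ-cong n (λ x → cong f (sym (+-assoc x 1ℤ (+ a)))))
    (trans (Σ-shift1 n {λ x → f (x + + a)} (periodic-shift (+ a) per)) (Σ-shiftℕ n per a))

  Σ-shift : ∀ n {f} → Periodic n f → ∀ a → Σ n (λ x → f (x + a)) ≡ Σ n f
  Σ-shift n per (+ a) = Σ-shiftℕ n per a
  Σ-shift n {f} per -[1+ a ] = sym (trans (Σ-cong n (λ x → cong f (lemma x (+ suc a))))
    (Σ-shiftℕ n {λ x → f (x + -[1+ a ])} (periodic-shift -[1+ a ] per) (suc a)))
    where
    lemma : ∀ x k → x ≡ (x + k) + - k
    lemma = solve-∀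

  Σ-reverse : ∀ n f → Σ n (λ x → f (+ n - 1ℤ - x)) ≡ Σ n f
  Σ-reverse zero    f = refl
  Σ-reverse (suc n) f = begin
    Σ n (λ x → f (+ suc n - 1ℤ - x)) + f (+ suc n - 1ℤ - + n)
      ≡⟨ cong₂ _+_ (Σ-cong n (λ x → cong f (lemma (+ n) x))) (cong f (lemma′ (+ n))) ⟩
    Σ n (λ x → f ((+ n - 1ℤ - x) + 1ℤ)) + f 0ℤ
      ≡⟨ cong (_+ f 0ℤ) (Σ-reverse n (λ x → f (x + 1ℤ))) ⟩
    Σ n (λ x → f (x + 1ℤ)) + f 0ℤ
      ≡⟨ +-comm _ (f 0ℤ) ⟩
    f 0ℤ + Σ n (λ x → f (x + 1ℤ))
      ≡⟨ Σ-head n f ⟨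
    Σ (suc n) f ∎
    where
    lemma : ∀ n x → ((1ℤ + n) - 1ℤ) - x ≡ ((n - 1ℤ) - x) + 1ℤ
    lemma = solve-∀
    lemma′ : ∀ n → ((1ℤ + n) - 1ℤ) - n ≡ 0ℤ
    lemma′ = solve-∀

  Σ-reflect : ∀ n {f} → Periodic n f → ∀ a → Σ n (λ x → f (a - x)) ≡ Σ n f
  Σ-reflect n {f} per a = begin
    Σ n (λ x → f (a - x))
      ≡⟨ Σ-cong n (λ x → cong f (lemma a x (+ n - 1ℤ))) ⟩
    Σ n (λ x → f ((+ n - 1ℤ - x) + (a - (+ n - 1ℤ))))
      ≡⟨ Σ-reverse n (λ x → f (x + (a - (+ n - 1ℤ)))) ⟩
    Σ n (λ x → f (x + (a - (+ n - 1ℤ))))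
      ≡⟨ Σ-shift n per (a - (+ n - 1ℤ)) ⟩
    Σ n f ∎
    where
    lemma : ∀ a x c → a - x ≡ (c - x) + (a - c)
    lemma = solve-∀

  -- Pushforward along the quotient map ℤ/lm → ℤ/m.
  fold : ℕ → ℕ → (ℤ → ℤ) → ℤ → ℤ
  fold m l f x = Σ l (λ j → f (x + j * + m))

  Σ-blocks : ∀ l m f → Σ (l ℕ.* m) f ≡ Σ m (fold m l f)
  Σ-blocks zero    m f = sym (Σ-0 m)
  Σ-blocks (suc l) m f = begin
    Σ (m ℕ.+ l ℕ.* m) f                               ≡⟨ cong (λ z → Σ z f) (ℕ.+-comm m (l ℕ.* m)) ⟩
    Σ (l ℕ.* m ℕ.+ m) f                               ≡⟨ Σ-append (l ℕ.* m) m f ⟩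
    Σ (l ℕ.* m) f + Σ m (λ x → f (x + + (l ℕ.* m)))   ≡⟨ cong₂ _+_ (Σ-blocks l m f)
                                                          (Σ-cong m (λ x → cong (λ z → f (x + z)) (pos-* l m))) ⟩
    Σ m (fold m l f) + Σ m (λ x → f (x + + l * + m))  ≡⟨ Σ-+ m (fold m l f) (λ x → f (x + + l * + m)) ⟨
    Σ m (fold m (suc l) f)                            ∎

  fold-periodic : ∀ m l {f} → Periodic (l ℕ.* m) f → Periodic m (fold m l f)
  fold-periodic m l {f} per x = begin
    Σ l (λ j → f ((x + + m) + j * + m))   ≡⟨ Σ-cong l (λ j → cong f (lemma x (+ m) j)) ⟩
    Σ l (λ j → f (x + (j + 1ℤ) * + m))    ≡⟨ Σ-shift1 l {λ j → f (x + j * + m)} per′ ⟩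
    Σ l (λ j → f (x + j * + m))           ∎
    where
    lemma : ∀ x m j → (x + m) + j * m ≡ x + (j + 1ℤ) * m
    lemma = solve-∀
    lemma′ : ∀ x m j l → x + (j + l) * m ≡ (x + j * m) + l * m
    lemma′ = solve-∀
    per′ : Periodic l (λ j → f (x + j * + m))
    per′ j = trans (cong f (trans (lemma′ x (+ m) j (+ l)) (cong (_+_ (x + j * + m)) (sym (pos-* l m))))) (per _)

  conv : ℕ → (ℤ → ℤ) → (ℤ → ℤ) → ℤ → ℤ
  conv n f g x = Σ n (λ k → f k * g (x - k))

  -- Pushforward along a group homomorphism respects convolution. The fold of g is m-periodic, so
  -- the fold of f can be spread out to a sum over the long period; the fold of g is then opened and
  -- the two sums exchanged.
  fold-conv : ∀ m l f {g} → Periodic (l ℕ.* m) g → ∀ x →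
    conv m (fold m l f) (fold m l g) x ≡ fold m l (conv (l ℕ.* m) f g) x
  fold-conv m l f {g} per x = begin
    Σ m (λ k → fold m l f k * G (x - k))
      ≡⟨ Σ-cong m (λ k → Σ-*ʳ l (G (x - k)) (λ j → f (k + j * + m))) ⟨
    Σ m (λ k → Σ l (λ j → f (k + j * + m) * G (x - k)))
      ≡⟨ Σ-cong m (λ k → Σ-cong l (λ j → cong (f (k + j * + m) *_)
           (trans (cong G (lemma x k (j * + m))) (periodic-* {f = G} (fold-periodic m l per) j (x - (k + j * + m)))))) ⟩
    Σ m (fold m l (λ k → f k * G (x - k)))
      ≡⟨ Σ-blocks l m (λ k → f k * G (x - k)) ⟨
    Σ (l ℕ.* m) (λ k → f k * G (x - k))
      ≡⟨ Σ-cong (l ℕ.* m) (λ k → Σ-*ˡ l (f k) (λ j → g ((x - k) + j * + m))) ⟨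
    Σ (l ℕ.* m) (λ k → Σ l (λ j → f k * g ((x - k) + j * + m)))
      ≡⟨ Σ-swap (l ℕ.* m) l (λ k j → f k * g ((x - k) + j * + m)) ⟩
    Σ l (λ j → Σ (l ℕ.* m) (λ k → f k * g ((x - k) + j * + m)))
      ≡⟨ Σ-cong l (λ j → Σ-cong (l ℕ.* m) (λ k → cong (λ z → f k * g z) (+-rightComm x (- k) (j * + m)))) ⟩
    fold m l (conv (l ℕ.* m) f g) x ∎
    where
    G = fold m l g
    lemma : ∀ x k c → x - k ≡ (x - (k + c)) + c
    lemma = solve-∀

  abstract
    -- The unit of convolution on ℤ/n. It is sealed so that goals show `δ n x` and not the
    -- divisibility test.
    δ : ℕ → ℤ → ℤ
    δ n x = if does (+ n ∣? x) then 1ℤ else 0ℤ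

    δ-∣ : ∀ {n x} → + n ∣ x → δ n x ≡ 1ℤ
    δ-∣ {n} {x} n∣x = cong (if_then 1ℤ else 0ℤ) (dec-true (+ n ∣? x) n∣x)

    δ-∤ : ∀ {n x} → ¬ + n ∣ x → δ n x ≡ 0ℤ
    δ-∤ {n} {x} n∤x = cong (if_then 1ℤ else 0ℤ) (dec-false (+ n ∣? x) n∤x)

  δ-cong : ∀ {m n x y} → (+ m ∣ x → + n ∣ y) → (+ n ∣ y → + m ∣ x) → δ m x ≡ δ n y
  δ-cong {m} {n} {x} {y} to from = case + m ∣? x of λ where
    (yes m∣x) → trans (δ-∣ m∣x) (sym (δ-∣ (to m∣x)))
    (no  m∤x) → trans (δ-∤ m∤x) (sym (δ-∤ (m∤x ∘ from)))

  ∣-respʳ : ∀ {m x y} → x ≡ y → m ∣ x → m ∣ y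
  ∣-respʳ refl p = p

  ∣-self* : ∀ n q → n ∣ q * n
  ∣-self* n q = divides q refl

  ∣0 : ∀ n → n ∣ 0ℤ
  ∣0 n = divides 0ℤ (sym (*-zeroˡ n))

  ∣-+-period : ∀ n x → + n ∣ x + + n → + n ∣ x
  ∣-+-period n x p = ∣-respʳ (lemma x (+ n)) (∣m∣n⇒∣m+n p (∣m⇒∣-m (∣-self* (+ n) 1ℤ)))
    where
    lemma : ∀ x n → (x + n) + - (1ℤ * n) ≡ x
    lemma = solve-∀

  ∣-period-+ : ∀ n x → + n ∣ x → + n ∣ x + + n
  ∣-period-+ n x p = ∣m∣n⇒∣m+n p (divides 1ℤ (sym (ℤP.*-identityˡ (+ n))))

  δ-periodic : ∀ n → Periodic n (δ n)
  δ-periodic n x = δ-cong (∣-+-period n x) (∣-period-+ n x)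

  δ0 : ∀ n → δ n 0ℤ ≡ 1ℤ
  δ0 n = δ-∣ (∣0 (+ n))

  <⇒∤ : ∀ {k n} → 0 ℕ.< k → k ℕ.< n → ¬ + n ∣ + k
  <⇒∤ {suc k} _ k<n n∣k = ℕ.<⇒≱ k<n (ℕ.∣⇒≤ (∣⇒∣ᵤ n∣k))

  ∣-neg⁻ : ∀ {n x} → n ∣ - x → n ∣ x
  ∣-neg⁻ {n} {x} p = ∣-respʳ (ℤP.neg-involutive x) (∣m⇒∣-m p)

  Σ-support0 : ∀ n .{{_ : NonZero n}} {f} → (∀ k → 0 ℕ.< k → k ℕ.< n → f (+ k) ≡ 0ℤ) → Σ n f ≡ f 0ℤ
  Σ-support0 (suc n) {f} vanish = begin
    Σ (suc n) f                      ≡⟨ Σ-head n f ⟩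
    f 0ℤ + Σ n (λ x → f (x + 1ℤ))    ≡⟨ cong (_+_ (f 0ℤ)) (trans (Σ-cong< n λ k k<n → trans (cong f (+-comm (+ k) 1ℤ))
                                          (vanish (suc k) (ℕ.s≤s ℕ.z≤n) (ℕ.s≤s k<n))) (Σ-0 n)) ⟩
    f 0ℤ + 0ℤ                        ≡⟨ +-identityʳ _ ⟩
    f 0ℤ                             ∎

  periodic-· : ∀ {n f g} → Periodic n f → Periodic n g → Periodic n (λ x → f x * g x)
  periodic-· pf pg x = cong₂ _*_ (pf x) (pg x)

  periodic-reflect : ∀ {n f} → Periodic n f → ∀ a → Periodic n (λ x → f (a - x))
  periodic-reflect {n} {f} per a = λ x → trans (cong f (lemma a x (+ n))) (periodic-* per (- 1ℤ) (a - x))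
    where
    lemma : ∀ a x n → a - (x + n) ≡ (a - x) + (- 1ℤ) * n
    lemma = solve-∀

  -- The only surviving summand has k ≡ y; shifting the range by y moves it to 0, where `Σ-support0`
  -- applies.
  conv-δ : ∀ n .{{_ : NonZero n}} {g} → Periodic n g → ∀ y → conv n g (δ n) y ≡ g y
  conv-δ n {g} per y = begin
    Σ n (λ k → g k * δ n (y - k))
      ≡⟨ Σ-shift n {λ k → g k * δ n (y - k)} (periodic-· per (periodic-reflect (δ-periodic n) y)) y ⟨
    Σ n (λ k → g (k + y) * δ n (y - (k + y)))
      ≡⟨ Σ-support0 n (λ k 0<k k<n → trans (cong (g (+ k + y) *_)
           (δ-∤ (λ p → <⇒∤ 0<k k<n (∣-neg⁻ (∣-respʳ (lemma y (+ k)) p))))) (*-zeroʳ (g (+ k + y)))) ⟩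
    g (0ℤ + y) * δ n (y - (0ℤ + y))
      ≡⟨ cong₂ _*_ (cong g (+-identityˡ y)) (trans (cong (δ n) (lemma y 0ℤ)) (δ0 n)) ⟩
    g y * 1ℤ
      ≡⟨ ℤP.*-identityʳ (g y) ⟩
    g y ∎
    where
    lemma : ∀ y k → y - (k + y) ≡ - k
    lemma = solve-∀

  conv-comm : ∀ n {f g} → Periodic n f → Periodic n g → ∀ x → conv n f g x ≡ conv n g f x
  conv-comm n {f} {g} pf pg x = begin
    Σ n (λ k → f k * g (x - k))
      ≡⟨ Σ-reflect n {λ k → f k * g (x - k)} (periodic-· pf (periodic-reflect pg x)) x ⟨
    Σ n (λ k → f (x - k) * g (x - (x - k)))
      ≡⟨ Σ-cong n (λ k → trans (cong (λ z → f (x - k) * g z) (lemma x k)) (*-comm (f (x - k)) (g k))) ⟩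
    Σ n (λ k → g k * f (x - k)) ∎
    where
    lemma : ∀ x k → x - (x - k) ≡ k
    lemma = solve-∀

-- The Frobenius identity in a semiring of prime characteristic.

open import Algebra.Bundles using (Semiring)
import Algebra.Properties.Semiring.Mult as Mult
open import Data.Nat.Base as ℕ using (ℕ; zero; suc; NonZero; _!)
open import Data.Nat.Primality using (Prime)

module Frobenius {a ℓ} (S : Semiring a ℓ) where

  open Semiring S hiding (zero)
  open Mult S
  open import Algebra.Properties.Semiring.Exp S
  open import Algebra.Properties.Semiring.Sum S
  import Algebra.Properties.Semiring.Binomial S as Binomial
  open import Data.Empty using (⊥-elim)
  open import Data.Fin.Base using (zero; suc; toℕ; fromℕ; inject₁)
  open import Data.Fin.Properties using (toℕ-inject₁; toℕ-fromℕ; toℕ<n)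
  open import Data.Nat.Combinatorics using (_C_; nCk≡n!/k![n-k]!; k![n∸k]!∣n!; nCn≡1)
  open import Data.Nat.Divisibility using (_∣_; divides; ∣-refl; ∣m⇒∣m*n; ∣⇒≤; ∣1⇒≡1)
  open import Data.Nat.DivMod using (m/n*n≡m)
  open import Data.Nat.Primality using (¬prime[0]; ¬prime[1]; euclidsLemma)
  import Data.Nat.Properties as ℕ
  open import Data.Sum.Base using (inj₁; inj₂; [_,_]′)
  open import Relation.Binary.PropositionalEquality as ≡ using (_≡_)
  open import Relation.Binary.Reasoning.Setoid setoid
  open import Relation.Nullary using (¬_)

  module Characteristic {p : ℕ} (prime : Prime p) (p×1≈0 : p × 1# ≈ 0#) where

    prime∣!⇒≤ : ∀ n → p ∣ n ! → p ℕ.≤ n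
    prime∣!⇒≤ zero    p∣1 = ⊥-elim (¬prime[1] (≡.subst Prime (∣1⇒≡1 p∣1) prime))
    prime∣!⇒≤ (suc n) p∣n! with euclidsLemma (suc n) (n !) prime p∣n!
    ... | inj₁ p∣n = ∣⇒≤ p∣n
    ... | inj₂ p∣! = ℕ.m≤n⇒m≤1+n (prime∣!⇒≤ n p∣!)

    n∣n! : ∀ n .{{_ : NonZero n}} → n ∣ n !
    n∣n! (suc n) = ∣m⇒∣m*n (n !) ∣-refl

    -- p divides p! = (p C k) · k! (p - k)!, but neither factorial on the right, as k and p - k are
    -- below p.
    prime∣nCk : ∀ k → 0 ℕ.< k → k ℕ.< p → p ∣ p C k
    prime∣nCk k 0<k k<p = [ (λ h → h) , (λ h → ⊥-elim (no h)) ]′ (euclidsLemma (p C k) _ prime p∣product)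
      where
      instance
        p≢0 : NonZero p
        p≢0 = ℕ.>-nonZero (ℕ.<-trans 0<k k<p)
        d≢0 : NonZero (k ! ℕ.* (p ℕ.∸ k) !)
        d≢0 = k ℕ.!* (p ℕ.∸ k) !≢0
      p∣product : p ∣ (p C k) ℕ.* (k ! ℕ.* (p ℕ.∸ k) !)
      p∣product = ≡.subst (p ∣_) (≡.trans (≡.sym (m/n*n≡m (k![n∸k]!∣n! (ℕ.<⇒≤ k<p))))
        (≡.cong (ℕ._* (k ! ℕ.* (p ℕ.∸ k) !)) (≡.sym (nCk≡n!/k![n-k]! (ℕ.<⇒≤ k<p))))) (n∣n! p)
      no : ¬ p ∣ k ! ℕ.* (p ℕ.∸ k) !
      no h with euclidsLemma (k !) _ prime h
      ... | inj₁ h₁ = ℕ.<⇒≱ k<p (prime∣!⇒≤ k h₁)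
      ... | inj₂ h₂ = ℕ.<⇒≱ (ℕ.∸-monoʳ-< 0<k (ℕ.<⇒≤ k<p)) (prime∣!⇒≤ (p ℕ.∸ k) h₂)

    ×-zeroʳ : ∀ n → n × 0# ≈ 0#
    ×-zeroʳ zero    = refl
    ×-zeroʳ (suc n) = trans (+-identityˡ _) (×-zeroʳ n)

    p×≈0 : ∀ x → p × x ≈ 0#
    p×≈0 x = begin
      p × x           ≈⟨ ×-congʳ p (*-identityˡ x) ⟨
      p × (1# * x)    ≈⟨ ×-assoc-* p 1# x ⟨
      (p × 1#) * x    ≈⟨ *-congʳ p×1≈0 ⟩
      0# * x          ≈⟨ zeroˡ x ⟩
      0#              ∎

    multiple×≈0 : ∀ {m} x → p ∣ m → m × x ≈ 0#
    multiple×≈0 {m} x (divides q ≡.refl) = begin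
      (q ℕ.* p) × x   ≈⟨ ×-assocˡ x q p ⟨
      q × (p × x)     ≈⟨ ×-congʳ q (p×≈0 x) ⟩
      q × 0#          ≈⟨ ×-zeroʳ q ⟩
      0#              ∎

    -- Writing p as a successor lets the binomial sum be split into its first term, its last term
    -- and the middle ones, which vanish.
    frobenius′ : ∀ q → p ≡ suc q → ∀ {x y} → x * y ≈ y * x → (x + y) ^ p ≈ x ^ p + y ^ p
    frobenius′ q ≡.refl {x} {y} xy≈yx = begin
      (x + y) ^ p                                         ≈⟨ Binomial.theorem x y xy≈yx p ⟩
      t zero + sum (λ j → t (suc j))                      ≈⟨ +-congˡ (sum-init-last (λ j → t (suc j))) ⟩
      t zero + (sum (λ j → t (suc (inject₁ j))) + t (fromℕ p))  ≈⟨ +-cong first (+-cong middle last′) ⟩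
      y ^ p + (0# + x ^ p)                                ≈⟨ +-congˡ (+-identityˡ _) ⟩
      y ^ p + x ^ p                                       ≈⟨ +-comm _ _ ⟩
      x ^ p + y ^ p                                       ∎
      where
      t = Binomial.binomialTerm x y p
      first : t zero ≈ y ^ p
      first = trans (×-homo-1 _) (*-identityˡ _)
      middle : sum (λ j → t (suc (inject₁ j))) ≈ 0#
      middle = trans (sum-cong-≋ {x = λ j → t (suc (inject₁ j))} {y = λ _ → 0#} λ j → multiple×≈0 _ (prime∣nCk _ (ℕ.s≤s ℕ.z≤n)
        (ℕ.s≤s (≡.subst (ℕ._< q) (≡.sym (toℕ-inject₁ j)) (toℕ<n j))))) (sum-replicate-zero q)
      last-term : ∀ k → k ≡ p → (p C k) × (x ^ k * y ^ (p ℕ.∸ k)) ≈ x ^ p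
      last-term k ≡.refl = begin
        (p C p) × (x ^ p * y ^ (p ℕ.∸ p))  ≈⟨ ×-cong (nCn≡1 p) (*-congˡ (^-cong {y} refl (ℕ.n∸n≡0 p))) ⟩
        1 × (x ^ p * 1#)                   ≈⟨ ×-homo-1 _ ⟩
        x ^ p * 1#                         ≈⟨ *-identityʳ _ ⟩
        x ^ p                              ∎
      last′ : t (fromℕ p) ≈ x ^ p
      last′ = last-term (toℕ (fromℕ p)) (toℕ-fromℕ p)

    frobenius : ∀ {x y} → x * y ≈ y * x → (x + y) ^ p ≈ x ^ p + y ^ p
    frobenius {x} {y} = go p ≡.refl
      where
      go : ∀ q → p ≡ q → x * y ≈ y * x → (x + y) ^ p ≈ x ^ p + y ^ p
      go zero    eq = ⊥-elim (¬prime[0] (≡.subst Prime eq prime))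
      go (suc q) eq = frobenius′ q eq

    0^p≈0 : 0# ^ p ≈ 0#
    0^p≈0 = go p ≡.refl
      where
      go : ∀ q → p ≡ q → 0# ^ p ≈ 0#
      go zero    eq     = ⊥-elim (¬prime[0] (≡.subst Prime eq prime))
      go (suc q) ≡.refl = zeroˡ _

    Commute : Carrier → Carrier → Set ℓ
    Commute y x = x * y ≈ y * x

    commute-0 : ∀ y → Commute y 0#
    commute-0 y = trans (zeroˡ y) (sym (zeroʳ y))

    commute-+ : ∀ {y a b} → Commute y a → Commute y b → Commute y (a + b)
    commute-+ {y} {a} {b} ca cb = trans (distribʳ y a b) (trans (+-cong ca cb) (sym (distribˡ y a b)))

    commute-× : ∀ {y a} n → Commute y a → Commute y (n × a)
    commute-× zero    ca = commute-0 _
    commute-× (suc n) ca = commute-+ ca (commute-× n ca)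

    commute-^ : ∀ {y a} n → Commute y a → Commute y (a ^ n)
    commute-^ zero    ca = trans (*-identityˡ _) (sym (*-identityʳ _))
    commute-^ {y} {a} (suc n) ca = begin
      (a * a ^ n) * y   ≈⟨ *-assoc _ _ _ ⟩
      a * (a ^ n * y)   ≈⟨ *-congˡ (commute-^ n ca) ⟩
      a * (y * a ^ n)   ≈⟨ *-assoc _ _ _ ⟨
      (a * y) * a ^ n   ≈⟨ *-congʳ ca ⟩
      (y * a) * a ^ n   ≈⟨ *-assoc _ _ _ ⟩
      y * (a * a ^ n)   ∎

    -- Additivity, applied n times; this contains Fermat's little theorem and lets coefficients pass
    -- through the power unchanged.
    frobenius-× : ∀ n x → (n × x) ^ p ≈ n × (x ^ p)
    frobenius-× zero    x = 0^p≈0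
    frobenius-× (suc n) x = trans (frobenius (sym (commute-× n refl))) (+-congˡ (frobenius-× n x))

    -- The coefficients are natural numbers acting by repeated addition, the only scalars that every
    -- semiring has.
    polynomial : ℕ → (ℕ → ℕ) → Carrier → Carrier
    polynomial zero    c x = 0#
    polynomial (suc n) c x = polynomial n c x + c n × (x ^ n)

    commute-polynomial : ∀ {y x} n c → Commute y x → Commute y (polynomial n c x)
    commute-polynomial zero    c cx = commute-0 _
    commute-polynomial (suc n) c cx = commute-+ (commute-polynomial n c cx) (commute-× (c n) (commute-^ n cx))

    ^-swap : ∀ x m n → (x ^ m) ^ n ≈ (x ^ n) ^ m
    ^-swap x m n = trans (^-assocʳ x m n) (trans (^-congʳ x (ℕ.*-comm m n)) (sym (^-assocʳ x n m)))

    frobenius-polynomial : ∀ n c x → polynomial n c x ^ p ≈ polynomial n c (x ^ p)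
    frobenius-polynomial zero    c x = 0^p≈0
    frobenius-polynomial (suc n) c x = begin
      (polynomial n c x + c n × (x ^ n)) ^ p       ≈⟨ frobenius (commute-polynomial n c (sym (commute-× (c n) (commute-^ n refl)))) ⟩
      polynomial n c x ^ p + (c n × (x ^ n)) ^ p   ≈⟨ +-cong (frobenius-polynomial n c x) (frobenius-× (c n) (x ^ n)) ⟩
      polynomial n c (x ^ p) + c n × ((x ^ n) ^ p) ≈⟨ +-congˡ (×-congʳ (c n) (^-swap x n p)) ⟩
      polynomial n c (x ^ p) + c n × ((x ^ p) ^ n) ∎

-- Convolution modulo l as a polynomial in the shift.

module ShiftOperators where

  open PeriodicSums
  open import Algebra.Bundles using (CommutativeMonoid; Semiring)
  import Algebra.Properties.Semiring.Mult
  import Algebra.Properties.Semiring.Exp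
  open import Data.Integer.Base using (ℤ; +_; 0ℤ; 1ℤ; _+_; _*_; -_; _-_; _%ℕ_; _/ℕ_)
  open import Data.Integer.DivMod using (a≡a%ℕn+[a/ℕn]*n)
  open import Data.Integer.Divisibility.Signed using (_∣_; divides; ∣m∣n⇒∣m+n; ∣m⇒∣-m; ∣n⇒∣m*n)
  open import Data.Integer.Properties as ℤP using (*-zeroˡ; +-identityˡ; +-identityʳ; +-assoc; +-comm)
  open import Data.Integer.Tactic.RingSolver using (solve-∀)
  open import Data.Nat.Base as ℕ using (ℕ; zero; suc; NonZero)
  open import Data.Nat.Primality using (Prime; prime⇒nonZero)
  open import Data.Product.Base using (_,_)
  open import Level using (0ℓ; _⊔_)
  open import Relation.Binary.PropositionalEquality as ≡ using (_≡_; refl; sym; trans; cong)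

  record End {a ℓ} (M : CommutativeMonoid a ℓ) : Set (a ⊔ ℓ) where
    open CommutativeMonoid M
    field
      ap     : Carrier → Carrier
      ap-cong : ∀ {x y} → x ≈ y → ap x ≈ ap y
      ap-∙   : ∀ x y → ap (x ∙ y) ≈ ap x ∙ ap y
      ap-ε   : ap ε ≈ ε

  open End

  -- Composition plays the role of the product of a group ring: its associativity holds by
  -- definition, whereas for convolution it would need a proof.
  endSemiring : ∀ {a ℓ} → CommutativeMonoid a ℓ → Semiring (a ⊔ ℓ) (a ⊔ ℓ)
  endSemiring {a} {ℓ} M = record
    { Carrier = End M
    ; _≈_ = λ f g → ∀ x → ap f x ≈ ap g x
    ; _+_ = λ f g → record
      { ap = λ x → ap f x ∙ ap g x
      ; ap-cong = λ e → ∙-cong (ap-cong f e) (ap-cong g e)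
      ; ap-∙ = λ x y → M.trans (∙-cong (ap-∙ f x y) (ap-∙ g x y)) (interchange′ (ap f x) (ap f y) (ap g x) (ap g y))
      ; ap-ε = M.trans (∙-cong (ap-ε f) (ap-ε g)) (identityˡ ε)
      }
    ; _*_ = λ f g → record
      { ap = λ x → ap f (ap g x)
      ; ap-cong = λ e → ap-cong f (ap-cong g e)
      ; ap-∙ = λ x y → M.trans (ap-cong f (ap-∙ g x y)) (ap-∙ f (ap g x) (ap g y))
      ; ap-ε = M.trans (ap-cong f (ap-ε g)) (ap-ε f)
      }
    ; 0# = record { ap = λ _ → ε ; ap-cong = λ _ → M.refl ; ap-∙ = λ _ _ → M.sym (identityˡ ε) ; ap-ε = M.refl }
    ; 1# = record { ap = λ x → x ; ap-cong = λ e → e ; ap-∙ = λ _ _ → M.refl ; ap-ε = M.refl }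
    ; isSemiring = record
      { isSemiringWithoutAnnihilatingZero = record
        { +-isCommutativeMonoid = record
          { isMonoid = record
            { isSemigroup = record
              { isMagma = record
                { isEquivalence = record
                  { refl = λ _ → M.refl ; sym = λ e x → M.sym (e x) ; trans = λ e e′ x → M.trans (e x) (e′ x) }
                ; ∙-cong = λ e e′ x → ∙-cong (e x) (e′ x)
                }
              ; assoc = λ f g h x → assoc (ap f x) (ap g x) (ap h x)
              }
            ; identity = (λ f x → identityˡ (ap f x)) , (λ f x → identityʳ (ap f x))
            }
          ; comm = λ f g x → comm (ap f x) (ap g x)
          }
        ; *-cong = λ {f} {f′} {g} {g′} e e′ x → M.trans (e (ap g x)) (ap-cong f′ (e′ x))
        ; *-assoc = λ _ _ _ _ → M.refl
        ; *-identity = (λ _ _ → M.refl) , (λ _ _ → M.refl)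
        ; distrib = (λ f g h x → ap-∙ f (ap g x) (ap h x)) , (λ _ _ _ _ → M.refl)
        }
      ; zero = (λ _ _ → M.refl) , (λ f _ → ap-ε f)
      }
    }
    where
    open module M = CommutativeMonoid M using (_≈_; _∙_; ε; ∙-cong; ∙-congˡ; ∙-congʳ; assoc; comm; identityˡ; identityʳ)
    interchange′ : ∀ a b c d → (a ∙ b) ∙ (c ∙ d) ≈ (a ∙ c) ∙ (b ∙ d)
    interchange′ a b c d = M.trans (assoc a b (c ∙ d)) (M.trans (∙-congˡ (M.trans (M.sym (assoc b c d))
      (M.trans (∙-congʳ (comm b c)) (assoc c b d)))) (M.sym (assoc a c (b ∙ d))))

  infix 4 _≡_[_]

  -- A record and not a synonym for divisibility of x - y, so that x and y can be recovered from the
  -- type.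
  record _≡_[_] (x y : ℤ) (l : ℕ) : Set where
    constructor mod
    field divides-difference : + l ∣ x - y

  open _≡_[_] public

  module _ {l : ℕ} where

    ≡⇒mod : ∀ {x y} → x ≡ y → x ≡ y [ l ]
    ≡⇒mod {x} {y} refl = mod (∣-respʳ (sym (ℤP.+-inverseʳ x)) (∣0 (+ l)))

    mod-sym : ∀ {x y} → x ≡ y [ l ] → y ≡ x [ l ]
    mod-sym {x} {y} (mod p) = mod (∣-respʳ (lemma x y) (∣m⇒∣-m p))
      where
      lemma : ∀ x y → - (x - y) ≡ y - x
      lemma = solve-∀

    mod-trans : ∀ {x y z} → x ≡ y [ l ] → y ≡ z [ l ] → x ≡ z [ l ]
    mod-trans {x} {y} {z} (mod p) (mod q) = mod (∣-respʳ (lemma x y z) (∣m∣n⇒∣m+n p q))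
      where
      lemma : ∀ x y z → (x - y) + (y - z) ≡ x - z
      lemma = solve-∀

    mod-+ : ∀ {x y z w} → x ≡ y [ l ] → z ≡ w [ l ] → x + z ≡ y + w [ l ]
    mod-+ {x} {y} {z} {w} (mod p) (mod q) = mod (∣-respʳ (lemma x y z w) (∣m∣n⇒∣m+n p q))
      where
      lemma : ∀ x y z w → (x - y) + (z - w) ≡ (x + z) - (y + w)
      lemma = solve-∀

    mod-*ʳ : ∀ {x y} z → x ≡ y [ l ] → z * x ≡ z * y [ l ]
    mod-*ʳ {x} {y} z (mod p) = mod (∣-respʳ (lemma x y z) (∣n⇒∣m*n z p))
      where
      lemma : ∀ x y z → z * (x - y) ≡ z * x - z * y
      lemma = solve-∀

    mod-*ˡ : ∀ {x y} z → x ≡ y [ l ] → x * z ≡ y * z [ l ]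
    mod-*ˡ {x} {y} z (mod p) = mod (∣-respʳ (lemma x y z) (∣n⇒∣m*n z p))
      where
      lemma : ∀ x y z → z * (x - y) ≡ x * z - y * z
      lemma = solve-∀

    %-mod : ∀ x .{{_ : NonZero l}} → + (x %ℕ l) ≡ x [ l ]
    %-mod x = mod-sym (mod (divides (x /ℕ l) (trans (cong (_- + (x %ℕ l)) (a≡a%ℕn+[a/ℕn]*n x l)) (lemma (+ (x %ℕ l)) ((x /ℕ l) * + l)))))
      where
      lemma : ∀ a b → (a + b) - a ≡ b
      lemma = solve-∀

    mod⇒∣ : ∀ {x} → x ≡ 0ℤ [ l ] → + l ∣ x
    mod⇒∣ {x} (mod p) = ∣-respʳ (+-identityʳ x) p

    ∣⇒mod : ∀ {x} → + l ∣ x → x ≡ 0ℤ [ l ]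
    ∣⇒mod {x} p = mod (∣-respʳ (sym (+-identityʳ x)) p)

  functionsMod : ℕ → CommutativeMonoid 0ℓ 0ℓ
  functionsMod l = record
    { Carrier = ℤ → ℤ
    ; _≈_ = λ u v → ∀ x → u x ≡ v x [ l ]
    ; _∙_ = λ u v x → u x + v x
    ; ε = λ _ → 0ℤ
    ; isCommutativeMonoid = record
      { isMonoid = record
        { isSemigroup = record
          { isMagma = record
            { isEquivalence = record
              { refl = λ _ → ≡⇒mod refl ; sym = λ e x → mod-sym (e x) ; trans = λ e e′ x → mod-trans (e x) (e′ x) }
            ; ∙-cong = λ e e′ x → mod-+ (e x) (e′ x)
            }
          ; assoc = λ u v w x → ≡⇒mod (+-assoc (u x) (v x) (w x))
          }
        ; identity = (λ u x → ≡⇒mod (+-identityˡ (u x))) , (λ u x → ≡⇒mod (+-identityʳ (u x)))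
        }
      ; comm = λ u v x → ≡⇒mod (+-comm (u x) (v x))
      }
    }

  iterate : ∀ {a} {A : Set a} → ℕ → (A → A) → A → A
  iterate zero    F u = u
  iterate (suc k) F u = F (iterate k F u)

  module _ {l : ℕ} (prime : Prime l) where

    private
      instance
        l≢0 : NonZero l
        l≢0 = prime⇒nonZero prime

      Op : Semiring 0ℓ 0ℓ
      Op = endSemiring (functionsMod l)

      module Op = Semiring Op
      open Algebra.Properties.Semiring.Mult Op using (_×_)
      open Algebra.Properties.Semiring.Exp Op using (_^_)

      ap-× : ∀ n a u x → ap (n × a) u x ≡ + n * ap a u x
      ap-× zero    a u x = sym (*-zeroˡ (ap a u x))
      ap-× (suc n) a u x = trans (cong (_+_ (ap a u x)) (ap-× n a u x)) (lemma (+ n) (ap a u x))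
        where
        lemma : ∀ n y → y + n * y ≡ (1ℤ + n) * y
        lemma = solve-∀

      shift : Op.Carrier
      shift = record
        { ap = λ u x → u (x - 1ℤ)
        ; ap-cong = λ e x → e (x - 1ℤ)
        ; ap-∙ = λ _ _ _ → ≡⇒mod refl
        ; ap-ε = λ _ → ≡⇒mod refl
        }

      ap-^ : ∀ s c → (∀ u x → ap s u x ≡ u (x - c)) → ∀ k u x → ap (s ^ k) u x ≡ u (x - + k * c)
      ap-^ s c step zero    u x = cong u (lemma x c)
        where
        lemma : ∀ x c → x ≡ x - 0ℤ * c
        lemma = solve-∀
      ap-^ s c step (suc k) u x = trans (step (ap (s ^ k) u) x) (trans (ap-^ s c step k u (x - c)) (cong u (lemma x (+ k) c)))
        where
        lemma : ∀ x k c → (x - c) - k * c ≡ x - (1ℤ + k) * c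
        lemma = solve-∀

      l×1≈0 : (l × Op.1#) Op.≈ Op.0#
      l×1≈0 u x = mod-trans (≡⇒mod (ap-× l Op.1# u x)) (∣⇒mod (divides (u x) (ℤP.*-comm (+ l) (u x))))

      open Frobenius Op using (module Characteristic)
      open Characteristic prime l×1≈0 using (polynomial; frobenius-polynomial)

      module _ (f : ℤ → ℤ) where

        -- A possibly negative value of f becomes a natural coefficient through its residue, which
        -- is the same modulo l.
        coeff : ℕ → ℕ
        coeff k = f (+ k) %ℕ l

        -- Stated for a translation by any c because two are needed: c = 1 gives convolution with f,
        -- and c = l, the translation `shift ^ l`, gives the right-hand side of Frobenius.
        ap-polynomial : ∀ s c → (∀ u x → ap s u x ≡ u (x - c)) → ∀ n u x →
          ap (polynomial n coeff s) u x ≡ Σ n (λ k → f k * u (x - k * c)) [ l ]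
        ap-polynomial s c step zero    u x = ≡⇒mod refl
        ap-polynomial s c step (suc n) u x = mod-+ (ap-polynomial s c step n u x)
          (mod-trans (≡⇒mod (trans (ap-× (coeff n) (s ^ n) u x) (cong (+ coeff n *_) (ap-^ s c step n u x))))
            (mod-*ˡ (u (x - + n * c)) (%-mod (f (+ n)))))

    private
      Σ-mod : ∀ n {f g : ℤ → ℤ} → (∀ x → f x ≡ g x [ l ]) → Σ n f ≡ Σ n g [ l ]
      Σ-mod zero    e = ≡⇒mod refl
      Σ-mod (suc n) e = mod-+ (Σ-mod n e) (e (+ n))

      iterate-mod : ∀ n (f : ℤ → ℤ) k u x →
        iterate k (conv n f) u x ≡ ap (polynomial n (coeff f) shift ^ k) u x [ l ]
      iterate-mod n f zero    u x = ≡⇒mod refl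
      iterate-mod n f (suc k) u x = mod-trans (Σ-mod n (λ y → mod-*ʳ (f y) (iterate-mod n f k u (x - y))))
        (mod-sym (mod-trans (ap-polynomial f shift 1ℤ (λ _ _ → refl) n (ap (polynomial n (coeff f) shift ^ k) u) x)
          (≡⇒mod (Σ-cong n (λ y → cong (λ z → f y * ap (polynomial n (coeff f) shift ^ k) u (x - z)) (ℤP.*-identityʳ y))))))

    -- Modulo l, convolution with f is P(shift) for the polynomial P with coefficients f, and
    -- P(shift)^l = P(shift^l).
    frobenius-conv : ∀ n f u x → iterate l (conv n f) u x ≡ Σ n (λ k → f k * u (x - k * + l)) [ l ]
    frobenius-conv n f u x = mod-trans (iterate-mod n f l u x)
      (mod-trans (frobenius-polynomial n (coeff f) shift u x)
        (ap-polynomial f (shift ^ l) (+ l) (λ v y → trans (ap-^ shift 1ℤ (λ _ _ → refl) l v y)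
          (cong (λ z → v (y - z)) (ℤP.*-identityʳ (+ l)))) n u x))

-- Descent over the primes of h: the norm is divisible by h².

module Descent where

  open PeriodicSums
  open ShiftOperators
  open import Data.Empty using (⊥-elim)
  open import Data.Integer.Base as ℤ using (ℤ; +_; -[1+_]; 0ℤ; 1ℤ; _+_; _*_; -_; _-_; _^_)
  open import Data.Integer.Divisibility.Signed using (_∣_; divides; _∣?_; ∣m∣n⇒∣m+n; ∣m⇒∣-m; ∣n⇒∣m*n; ∣m⇒∣m*n; ∣ᵤ⇒∣; ∣⇒∣ᵤ; ∣-trans; *-cancelʳ-∣; *-monoˡ-∣)
  open import Data.Integer.Properties as ℤP using (*-zeroʳ; *-identityˡ; *-identityʳ; +-identityʳ; +-assoc; +-comm; *-comm; *-assoc; pos-*)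
  open import Data.Integer.Tactic.RingSolver using (solve-∀)
  open import Data.List.Base using ([]; _∷_)
  open import Data.Nat.ListAction using (product)
  open import Data.List.Relation.Unary.All using (All; []; _∷_)
  open import Data.Nat.Base as ℕ using (ℕ; zero; suc; NonZero; s≤s; z≤n)
  import Data.Nat.Divisibility as ℕ
  open import Data.Nat.DivMod as ℕ using (m≡m%n+[m/n]*n; m%n<n)
  open import Data.Nat.Primality using (Prime; prime⇒nonZero; prime⇒nonTrivial; euclidsLemma; productOfPrimes≢0)
  open import Data.Nat.Primality.Factorisation using (factorise; PrimeFactorisation)
  import Data.Nat.Properties as ℕ
  open import Data.Product.Base using (Σ-syntax; ∃-syntax; _×_; _,_; proj₁; proj₂)
  open import Data.Sum.Base using (_⊎_; inj₁; inj₂; [_,_]′)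
  open import Function.Base using (_∘_; case_of_)
  open import Relation.Binary.PropositionalEquality hiding ([_])
  open import Relation.Nullary using (¬_; Dec; yes; no)
  open ≡-Reasoning

  conv-scaleʳ : ∀ n f c g x → conv n f (λ y → c * g y) x ≡ c * conv n f g x
  conv-scaleʳ n f c g x = trans (Σ-cong n (λ k → lemma (f k) c (g (x - k)))) (Σ-*ˡ n c _)
    where
    lemma : ∀ a c b → a * (c * b) ≡ c * (a * b)
    lemma = solve-∀

  conv-scale² : ∀ n c f x → conv n (λ y → c * f y) (λ y → c * f y) x ≡ c * c * conv n f f x
  conv-scale² n c f x = trans (Σ-cong n (λ k → lemma c (f k) (f (x - k)))) (Σ-*ˡ n (c * c) _)
    where
    lemma : ∀ c a b → c * a * (c * b) ≡ c * c * (a * b)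
    lemma = solve-∀

  conv-congʳ : ∀ n f {g g′} → (∀ x → g x ≡ g′ x) → ∀ x → conv n f g x ≡ conv n f g′ x
  conv-congʳ n f e x = Σ-cong n (λ k → cong (f k *_) (e (x - k)))

  -- Two convolutions with p amount to a factor N, so of an odd number of them one survives next to
  -- a power of N.
  iterate-δ : ∀ {n} .{{_ : NonZero n}} N {p} → Periodic n p →
    (∀ x → conv n p p x ≡ N * δ n x) →
    ∀ j x → iterate (suc (j ℕ.* 2)) (conv n p) (δ n) x ≡ N ^ j * p x
  iterate-δ {n} N {p} per pp zero    x = trans (conv-δ n per x) (sym (*-identityˡ (p x)))
  iterate-δ {n} N {p} per pp (suc j) x = begin
    conv n p (λ y → conv n p (iterate (suc (j ℕ.* 2)) (conv n p) (δ n)) y) x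
      ≡⟨ conv-congʳ n p (conv-congʳ n p (iterate-δ N per pp j)) x ⟩
    conv n p (λ y → conv n p (λ z → N ^ j * p z) y) x
      ≡⟨ conv-congʳ n p (λ y → trans (conv-scaleʳ n p (N ^ j) p y) (trans (cong (N ^ j *_) (pp y)) (lemma (N ^ j) N (δ n y)))) x ⟩
    conv n p (λ y → (N * N ^ j) * δ n y) x
      ≡⟨ conv-scaleʳ n p (N * N ^ j) (δ n) x ⟩
    N * N ^ j * conv n p (δ n) x
      ≡⟨ cong (N * N ^ j *_) (conv-δ n per x) ⟩
    N ^ suc j * p x ∎
    where
    lemma : ∀ a n d → a * (n * d) ≡ (n * a) * d
    lemma = solve-∀

  euclid : ∀ {l} → Prime l → ∀ x y → + l ∣ x * y → + l ∣ x ⊎ + l ∣ y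
  euclid {l} pr x y p = [ inj₁ ∘ ∣ᵤ⇒∣ , inj₂ ∘ ∣ᵤ⇒∣ ]′
    (euclidsLemma ℤ.∣ x ∣ ℤ.∣ y ∣ pr (subst (l ℕ.∣_) (ℤP.abs-* x y) (∣⇒∣ᵤ p)))

  prime∤1 : ∀ {l} → Prime l → ¬ + l ∣ 1ℤ
  prime∤1 {l} pr p = ℕ.<⇒≱ (ℕ.nonTrivial⇒n>1 l {{prime⇒nonTrivial pr}}) (ℕ.∣⇒≤ (∣⇒∣ᵤ p))

  ∣^⇒∣ : ∀ {l} → Prime l → ∀ x j → + l ∣ x ^ j → + l ∣ x
  ∣^⇒∣ pr x zero    p = ⊥-elim (prime∤1 pr p)
  ∣^⇒∣ pr x (suc j) p = [ (λ h → h) , ∣^⇒∣ pr x j ]′ (euclid pr x (x ^ j) p)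

  -- If m ∣ x, the lifts x + jm run through the multiples of m modulo lm, and exactly one of them is
  -- 0; otherwise no lift is.
  fold-δ : ∀ m l .{{_ : NonZero m}} .{{_ : NonZero l}} x → fold m l (δ (l ℕ.* m)) x ≡ δ m x
  fold-δ m l x = go (+ m ∣? x)
    where
    cancel : ∀ x y → (x + y) + - y ≡ x
    cancel = solve-∀
    lemma : ∀ q j m → q * m + j * m ≡ (j + q) * m
    lemma = solve-∀
    to : ∀ q j → + (l ℕ.* m) ∣ q * + m + j * + m → + l ∣ j + q
    to q j p = *-cancelʳ-∣ (+ m) (subst₂ _∣_ (pos-* l m) (lemma q j (+ m)) p)
    from : ∀ q j → + l ∣ j + q → + (l ℕ.* m) ∣ q * + m + j * + m
    from q j p = subst₂ _∣_ (sym (pos-* l m)) (sym (lemma q j (+ m))) (*-monoˡ-∣ (+ m) p)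
    go : Dec (+ m ∣ x) → fold m l (δ (l ℕ.* m)) x ≡ δ m x
    go (yes (divides q refl)) = begin
      Σ l (λ j → δ (l ℕ.* m) (q * + m + j * + m))
        ≡⟨ Σ-cong l (λ j → δ-cong (to q j) (from q j)) ⟩
      Σ l (λ j → δ l (j + q))
        ≡⟨ Σ-shift l (δ-periodic l) q ⟩
      Σ l (δ l)
        ≡⟨ Σ-support0 l (λ k 0<k k<l → δ-∤ (<⇒∤ 0<k k<l)) ⟩
      δ l 0ℤ
        ≡⟨ δ0 l ⟩
      1ℤ
        ≡⟨ δ-∣ (divides q refl) ⟨
      δ m (q * + m) ∎
    go (no m∤x) = begin
      Σ l (λ j → δ (l ℕ.* m) (x + j * + m))
        ≡⟨ Σ-cong l (λ j → δ-∤ (λ p → m∤x (∣-respʳ (cancel x (j * + m))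
             (∣m∣n⇒∣m+n (∣-trans (divides (+ l) (pos-* l m)) p) (∣m⇒∣-m (∣-self* (+ m) j)))))) ⟩
      Σ l (λ _ → 0ℤ)
        ≡⟨ Σ-0 l ⟩
      0ℤ
        ≡⟨ δ-∤ m∤x ⟨
      δ m x ∎

  module _ {l m} (pr : Prime l) .{{_ : NonZero m}} where

    private
      h = l ℕ.* m
      instance
        l≢0 : NonZero l
        l≢0 = prime⇒nonZero pr
        h≢0 : NonZero h
        h≢0 = ℕ.m*n≢0 l m

    private
      +h≡ : + h ≡ + m * + l
      +h≡ = trans (pos-* l m) (*-comm (+ l) (+ m))

      l∣h : + l ∣ + h
      l∣h = divides (+ m) +h≡

    -- No summand survives: as l ∣ h, a multiple of h of the form 1 - kl would give l ∣ 1.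
    frobenius-at-1 : ∀ (p : ℤ → ℤ) → Σ h (λ k → p k * δ h (1ℤ - k * + l)) ≡ 0ℤ
    frobenius-at-1 p = trans (Σ-cong h (λ k → trans (cong (p k *_) (δ-∤ {h} {1ℤ - k * + l} (λ d → prime∤1 pr
      (∣-respʳ (lemma 1ℤ (k * + l)) (∣m∣n⇒∣m+n (∣-trans l∣h d) (∣-self* (+ l) k)))))) (*-zeroʳ (p k)))) (Σ-0 h)
      where
      lemma : ∀ x y → (x - y) + y ≡ x
      lemma = solve-∀

    -- h = lm divides (y - k) l exactly when m divides y - k, so the sum sees k only modulo m and
    -- collects p over the fibres.
    frobenius-at-multiple : ∀ (p : ℤ → ℤ) y → Σ h (λ k → p k * δ h (y * + l - k * + l)) ≡ conv m (fold m l p) (δ m) y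
    frobenius-at-multiple p y = begin
      Σ h (λ k → p k * δ h (y * + l - k * + l))
        ≡⟨ Σ-cong h (λ k → cong (p k *_) (δ-cong (to k) (from k))) ⟩
      Σ h (λ k → p k * δ m (y - k))
        ≡⟨ Σ-blocks l m _ ⟩
      Σ m (λ i → Σ l (λ j → p (i + j * + m) * δ m (y - (i + j * + m))))
        ≡⟨ Σ-cong m (λ i → Σ-cong l (λ j → cong (p (i + j * + m) *_)
             (trans (cong (δ m) (lemma₂ y i j (+ m))) (periodic-* (δ-periodic m) (- j) (y - i))))) ⟩
      Σ m (λ i → Σ l (λ j → p (i + j * + m) * δ m (y - i)))
        ≡⟨ Σ-cong m (λ i → Σ-*ʳ l (δ m (y - i)) (λ j → p (i + j * + m))) ⟩
      conv m (fold m l p) (δ m) y ∎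
      where
      lemma₂ : ∀ y i j m → y - (i + j * m) ≡ (y - i) + (- j) * m
      lemma₂ = solve-∀
      lemma : ∀ y k l → y * l - k * l ≡ (y - k) * l
      lemma = solve-∀
      to : ∀ k → + h ∣ y * + l - k * + l → + m ∣ y - k
      to k d = *-cancelʳ-∣ (+ l) (subst₂ _∣_ +h≡ (lemma y k (+ l)) d)
      from : ∀ k → + m ∣ y - k → + h ∣ y * + l - k * + l
      from k d = subst₂ _∣_ (sym +h≡) (sym (lemma y k (+ l))) (*-monoˡ-∣ (+ l) d)

    module _ (N : ℤ) {p : ℤ → ℤ} (per : Periodic h p) (pp : ∀ x → conv h p p x ≡ N * δ h x)
             (j : ℕ) (l≡ : l ≡ suc (j ℕ.* 2)) where

      private
        -- The l = 2j + 1 convolutions of δ with p, evaluated in two ways.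
        power : ∀ x → N ^ j * p x ≡ Σ h (λ k → p k * δ h (x - k * + l)) [ l ]
        power x = mod-trans (≡⇒mod (sym (trans (cong (λ i → iterate i (conv h p) (δ h) x) l≡) (iterate-δ N per pp j x))))
          (frobenius-conv pr h p (δ h) x)

      prime∣norm : ¬ + l ∣ p 1ℤ → + l ∣ N
      prime∣norm l∤p1 = [ ∣^⇒∣ pr N j , ⊥-elim ∘ l∤p1 ]′
        (euclid pr (N ^ j) (p 1ℤ) (mod⇒∣ (mod-trans (power 1ℤ) (≡⇒mod (frobenius-at-1 p)))))

      prime∣fold : + l ∣ N → ∀ y → + l ∣ fold m l p y
      prime∣fold l∣N y = mod⇒∣ (mod-trans (≡⇒mod (sym (trans (frobenius-at-multiple p y) (conv-δ m (fold-periodic m l per) y))))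
        (mod-trans (mod-sym (power (y * + l))) (∣⇒mod (∣m⇒∣m*n {+ l} {N ^ j} (p (y * + l)) (l∣N^j j l≡)))))
        where
        l∣N^j : ∀ j → l ≡ suc (j ℕ.* 2) → + l ∣ N ^ j
        -- j = 0 would mean l = 1; the power of N must be a genuine one.
        l∣N^j zero    eq = ⊥-elim (prime∤1 pr (divides 1ℤ (sym (cong (λ i → 1ℤ * + i) eq))))
        l∣N^j (suc j) eq = ∣m⇒∣m*n (N ^ j) l∣N

    -- In `norm` the factor l² stays on the left because N is not yet known to be a multiple of it;
    -- the value of p′ * p′ at 0 will be the quotient.
    record Quotient (N : ℤ) (p p′ : ℤ → ℤ) : Set where
      field
        fold≡    : ∀ y → fold m l p y ≡ + l * p′ y
        periodic : Periodic m p′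
        norm     : ∀ x → + l * + l * conv m p′ p′ x ≡ N * δ m x

    quotient : ∀ N {p} → Periodic h p → (∀ x → conv h p p x ≡ N * δ h x) →
      (∀ y → + l ∣ fold m l p y) → ∃[ p′ ] Quotient N p p′
    quotient N {p} per pp l∣ = p′ , record
      { fold≡ = fold≡
      ; periodic = λ x → ℤP.*-cancelˡ-≡ (+ l) _ _ (trans (sym (fold≡ (x + + m))) (trans (fold-periodic m l per x) (fold≡ x)))
      ; norm = λ x → begin
        + l * + l * conv m p′ p′ x
          ≡⟨ conv-scale² m (+ l) p′ x ⟨
        conv m (λ y → + l * p′ y) (λ y → + l * p′ y) x
          ≡⟨ Σ-cong m (λ k → cong₂ _*_ (fold≡ k) (fold≡ (x - k))) ⟨
        conv m (fold m l p) (fold m l p) x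
          ≡⟨ fold-conv m l p per x ⟩
        Σ l (λ j → conv h p p (x + j * + m))
          ≡⟨ Σ-cong l (λ j → pp (x + j * + m)) ⟩
        Σ l (λ j → N * δ h (x + j * + m))
          ≡⟨ Σ-*ˡ l N _ ⟩
        N * fold m l (δ h) x
          ≡⟨ cong (N *_) (fold-δ m l x) ⟩
        N * δ m x ∎
      }
      where
      p′ : ℤ → ℤ
      p′ y = _∣_.quotient (l∣ y)
      fold≡ : ∀ y → fold m l p y ≡ + l * p′ y
      fold≡ y = trans (_∣_.equality (l∣ y)) (*-comm (p′ y) (+ l))

  -- One of a, b is ±1 and the other 0. Absolute values are used because the triangle inequality
  -- then bounds sums of such pairs.
  Signed-unit : ℤ → ℤ → Set
  Signed-unit a b = ℤ.∣ a ∣ ℕ.+ ℤ.∣ b ∣ ≡ 1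

  -- Off the multiples of h, one of the values of p and q is ±2 and the other is 0.
  Paired : ℕ → (ℤ → ℤ) → (ℤ → ℤ) → Set
  Paired h p q = ∀ x → ¬ + h ∣ x → Σ[ a ∈ ℤ ] Σ[ b ∈ ℤ ] (p x ≡ + 2 * a × q x ≡ + 2 * b × Signed-unit a b)

  abs≡-mod2 : ∀ a → + 2 ∣ + ℤ.∣ a ∣ - a
  abs≡-mod2 (+ n)    = divides 0ℤ (ℤP.+-inverseʳ (+ n))
  abs≡-mod2 -[1+ n ] = divides (+ suc n) (lemma (+ suc n))
    where
    lemma : ∀ x → x - - x ≡ x * + 2
    lemma = solve-∀

  signed-unit-odd : ∀ {a b} → Signed-unit a b → + 2 ∣ 1ℤ - (a + b)
  signed-unit-odd {a} {b} u = ∣-respʳ (trans (lemma (+ ℤ.∣ a ∣) (+ ℤ.∣ b ∣) a b)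
    (cong (_- (a + b)) (trans (sym (ℤP.pos-+ ℤ.∣ a ∣ ℤ.∣ b ∣)) (cong +_ u)))) (∣m∣n⇒∣m+n (abs≡-mod2 a) (abs≡-mod2 b))
    where
    lemma : ∀ x y a b → (x - a) + (y - b) ≡ (x + y) - (a + b)
    lemma = solve-∀

  -- What remains of the condition after adding n pairs: an upper bound from the triangle
  -- inequality, and a parity which for odd n forbids that both sums vanish.
  Σ-signed-units : ∀ n {A B : ℤ → ℤ} → (∀ j → Signed-unit (A j) (B j)) →
    ℤ.∣ Σ n A ∣ ℕ.+ ℤ.∣ Σ n B ∣ ℕ.≤ n × + 2 ∣ + n - (Σ n A + Σ n B)
  Σ-signed-units zero    u = z≤n , ∣0 (+ 2)
  Σ-signed-units (suc n) {A} {B} u = bound , ∣-respʳ (lemma (+ n) (Σ n A) (Σ n B) (A (+ n)) (B (+ n)))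
      (∣m∣n⇒∣m+n (proj₂ IH) (signed-unit-odd {A (+ n)} (u (+ n))))
    where
    IH = Σ-signed-units n {A} {B} u
    lemma : ∀ n x y a b → (n - (x + y)) + (1ℤ - (a + b)) ≡ (1ℤ + n) - ((x + a) + (y + b))
    lemma = solve-∀
    swap-middle : ∀ a b c d → (a ℕ.+ b) ℕ.+ (c ℕ.+ d) ≡ (a ℕ.+ c) ℕ.+ (b ℕ.+ d)
    swap-middle a b c d = trans (ℕ.+-assoc a b (c ℕ.+ d)) (trans (cong (a ℕ.+_) (trans (sym (ℕ.+-assoc b c d))
      (trans (cong (ℕ._+ d) (ℕ.+-comm b c)) (ℕ.+-assoc c b d)))) (sym (ℕ.+-assoc a c (b ℕ.+ d))))
    bound : ℤ.∣ Σ n A + A (+ n) ∣ ℕ.+ ℤ.∣ Σ n B + B (+ n) ∣ ℕ.≤ suc n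
    bound = ℕ.≤-trans (ℕ.+-mono-≤ (ℤP.∣i+j∣≤∣i∣+∣j∣ (Σ n A) (A (+ n))) (ℤP.∣i+j∣≤∣i∣+∣j∣ (Σ n B) (B (+ n))))
      (ℕ.≤-trans (ℕ.≤-reflexive (trans (swap-middle ℤ.∣ Σ n A ∣ ℤ.∣ A (+ n) ∣ ℤ.∣ Σ n B ∣ ℤ.∣ B (+ n) ∣)
          (trans (cong (ℤ.∣ Σ n A ∣ ℕ.+ ℤ.∣ Σ n B ∣ ℕ.+_) (u (+ n))) (ℕ.+-comm _ 1))))
        (s≤s (proj₁ IH)))

  ≤1⇒unit : ∀ n → n ℕ.≤ 1 → n ≢ 0 → n ≡ 1
  ≤1⇒unit zero          _ n≢0 = ⊥-elim (n≢0 refl)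
  ≤1⇒unit (suc zero)    _ _   = refl
  ≤1⇒unit (suc (suc n)) (s≤s ()) _

  odd-form : ∀ n → ¬ 2 ℕ.∣ n → n ≡ suc (n ℕ./ 2 ℕ.* 2)
  odd-form n n-odd = trans (m≡m%n+[m/n]*n n 2) (cong (ℕ._+ n ℕ./ 2 ℕ.* 2)
    (≤1⇒unit (n ℕ.% 2) (ℕ.s≤s⁻¹ (m%n<n n 2)) (λ e → n-odd (ℕ.m%n≡0⇒n∣m n 2 e))))

  odd-prime∤2 : ∀ {l} → Prime l → ¬ 2 ℕ.∣ l → ¬ + l ∣ + 2
  odd-prime∤2 {l} pr l-odd d with ℕ.m≤n⇒m<n∨m≡n (ℕ.∣⇒≤ (∣⇒∣ᵤ d))
  ... | inj₁ (s≤s l≤1) = ℕ.<⇒≱ (ℕ.nonTrivial⇒n>1 l {{prime⇒nonTrivial pr}}) l≤1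
  ... | inj₂ refl      = l-odd ℕ.∣-refl

  odd-prime∤2*unit : ∀ {l} → Prime l → ¬ 2 ℕ.∣ l → ∀ a → ℤ.∣ a ∣ ≡ 1 → ¬ + l ∣ + 2 * a
  odd-prime∤2*unit pr l-odd a a-unit d = [ odd-prime∤2 pr l-odd , (λ d′ → prime∤1 pr (∣ᵤ⇒∣ (subst (_ ℕ.∣_) a-unit (∣⇒∣ᵤ d′)))) ]′
    (euclid pr (+ 2) a d)

  signed-unit-cases : ∀ {a b} → Signed-unit a b → ℤ.∣ a ∣ ≡ 1 ⊎ ℤ.∣ b ∣ ≡ 1
  signed-unit-cases {a} {b} u with ℤ.∣ a ∣ | u
  ... | zero     | e = inj₂ e
  ... | suc zero | e = inj₁ refl
  ... | suc (suc _) | ()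

  record Pair (h : ℕ) (N : ℤ) (p q : ℤ → ℤ) : Set where
    field
      p-periodic : Periodic h p
      q-periodic : Periodic h q
      p-norm     : ∀ x → conv h p p x ≡ N * δ h x
      q-norm     : ∀ x → conv h q q x ≡ N * δ h x
      paired     : Paired h p q

  open Pair

  module _ {l m} (pr : Prime l) (l-odd : ¬ 2 ℕ.∣ l) .{{_ : NonZero m}} {N p q} (P : Pair (l ℕ.* m) N p q) where

    private
      h = l ℕ.* m
      j = l ℕ./ 2
      l≡ = odd-form l l-odd
      instance
        l≢0 : NonZero l
        l≢0 = prime⇒nonZero pr

      l∣N : + l ∣ N
      l∣N with paired P 1ℤ (λ d → prime∤1 pr (∣-trans (divides (+ m) (trans (pos-* l m) (*-comm (+ l) (+ m)))) d))
      ... | a , b , pa , qb , u = [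
        (λ a-unit → prime∣norm pr N (p-periodic P) (p-norm P) j l≡ (λ d → odd-prime∤2*unit pr l-odd a a-unit (∣-respʳ pa d))) ,
        (λ b-unit → prime∣norm pr N (q-periodic P) (q-norm P) j l≡ (λ d → odd-prime∤2*unit pr l-odd b b-unit (∣-respʳ qb d))) ]′
        (signed-unit-cases {a} {b} u)

      quotient-p : ∃[ p′ ] Quotient {l} {m} pr N p p′
      quotient-p = quotient pr N (p-periodic P) (p-norm P) (prime∣fold pr N (p-periodic P) (p-norm P) j l≡ l∣N)

      quotient-q : ∃[ q′ ] Quotient {l} {m} pr N q q′
      quotient-q = quotient pr N (q-periodic P) (q-norm P) (prime∣fold pr N (q-periodic P) (q-norm P) j l≡ l∣N)

      p′ = proj₁ quotient-p
      q′ = proj₁ quotient-q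
      module QP = Quotient (proj₂ quotient-p)
      module QQ = Quotient (proj₂ quotient-q)

      -- The quotient N / l² is read off from p; the equation for q then follows by cancelling l²,
      -- since both have the same N.
      N′ = conv m p′ p′ 0ℤ

      N≡ : + l * + l * N′ ≡ N
      N≡ = trans (QP.norm 0ℤ) (trans (cong (N *_) (δ0 m)) (*-identityʳ N))

      -- Over the fibre, l · f′ y = 2 · Σ A. The prime l is odd, so it divides Σ A, and the quotient
      -- is half of f′ y.
      half : ∀ {f f′ : ℤ → ℤ} → (∀ y → fold m l f y ≡ + l * f′ y) → ∀ y (A : ℤ → ℤ) →
        (∀ j → f (y + j * + m) ≡ + 2 * A j) → ∃[ a ] (f′ y ≡ + 2 * a × Σ l A ≡ a * + l)
      half {f} {f′} fold≡ y A fA = case [ (λ d → ⊥-elim (odd-prime∤2 pr l-odd d)) , (λ d → d) ]′ (euclid pr (+ 2) (Σ l A)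
          (divides (f′ y) (trans (sym eq) (*-comm (+ l) (f′ y))))) of λ
        { (divides a ΣA≡) → a , ℤP.*-cancelˡ-≡ (+ l) _ _ (trans eq (trans (cong (+ 2 *_) ΣA≡) (lemma a (+ l)))) , ΣA≡ }
        where
        lemma : ∀ a l → + 2 * (a * l) ≡ l * (+ 2 * a)
        lemma = solve-∀
        eq : + l * f′ y ≡ + 2 * Σ l A
        eq = trans (sym (fold≡ y)) (trans (Σ-cong l fA) (Σ-*ˡ l (+ 2) A))

      -- (|a| + |b|) l = |Σ A| + |Σ B| ≤ l gives |a| + |b| ≤ 1. If both were 0, so would be Σ A + Σ
      -- B, which has the parity of l.
      paired′ : Paired m p′ q′
      paired′ y m∤y = a , b , proj₁ (proj₂ ha) , proj₁ (proj₂ hb) , ≤1⇒unit _ bound nonzero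
        where
        h∤ : ∀ j → ¬ + h ∣ y + j * + m
        h∤ j d = m∤y (∣-respʳ (cancel y (j * + m)) (∣m∣n⇒∣m+n (∣-trans (divides (+ l) (pos-* l m)) d) (∣m⇒∣-m (∣-self* (+ m) j))))
          where
          cancel : ∀ x y → (x + y) + - y ≡ x
          cancel = solve-∀
        A B : ℤ → ℤ
        A j = proj₁ (paired P (y + j * + m) (h∤ j))
        B j = proj₁ (proj₂ (paired P (y + j * + m) (h∤ j)))
        units : ∀ j → Signed-unit (A j) (B j)
        units j = proj₂ (proj₂ (proj₂ (proj₂ (paired P (y + j * + m) (h∤ j)))))
        ha = half {p} {p′} QP.fold≡ y A (λ j → proj₁ (proj₂ (proj₂ (paired P (y + j * + m) (h∤ j)))))
        hb = half {q} {q′} QQ.fold≡ y B (λ j → proj₁ (proj₂ (proj₂ (proj₂ (paired P (y + j * + m) (h∤ j))))))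
        a = proj₁ ha
        b = proj₁ hb
        sums = Σ-signed-units l {A} {B} units
        scaled : (ℤ.∣ a ∣ ℕ.+ ℤ.∣ b ∣) ℕ.* l ≡ ℤ.∣ Σ l A ∣ ℕ.+ ℤ.∣ Σ l B ∣
        scaled = trans (ℕ.*-distribʳ-+ l ℤ.∣ a ∣ ℤ.∣ b ∣) (sym (cong₂ ℕ._+_
          (trans (cong ℤ.∣_∣ (proj₂ (proj₂ ha))) (ℤP.abs-* a (+ l)))
          (trans (cong ℤ.∣_∣ (proj₂ (proj₂ hb))) (ℤP.abs-* b (+ l)))))
        bound : ℤ.∣ a ∣ ℕ.+ ℤ.∣ b ∣ ℕ.≤ 1
        bound = ℕ.*-cancelʳ-≤ _ 1 l (subst (ℕ._≤ 1 ℕ.* l) (sym scaled) (ℕ.≤-trans (proj₁ sums) (ℕ.≤-reflexive (sym (ℕ.*-identityˡ l)))))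
        nonzero : ℤ.∣ a ∣ ℕ.+ ℤ.∣ b ∣ ≢ 0
        nonzero e = l-odd (∣⇒∣ᵤ (∣-respʳ (trans (cong (λ z → + l - z) (cong₂ _+_ (vanish A eA) (vanish B eB))) (+-identityʳ (+ l))) (proj₂ sums)))
          where
          e′ : ℤ.∣ Σ l A ∣ ℕ.+ ℤ.∣ Σ l B ∣ ≡ 0
          e′ = trans (sym scaled) (cong (ℕ._* l) e)
          eA = ℕ.m+n≡0⇒m≡0 ℤ.∣ Σ l A ∣ e′
          eB = ℕ.m+n≡0⇒n≡0 ℤ.∣ Σ l A ∣ e′
          vanish : ∀ (A : ℤ → ℤ) → ℤ.∣ Σ l A ∣ ≡ 0 → Σ l A ≡ 0ℤ
          vanish A = ℤP.∣i∣≡0⇒i≡0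

    descend : Σ[ N′ ∈ ℤ ] Σ[ p′ ∈ (ℤ → ℤ) ] Σ[ q′ ∈ (ℤ → ℤ) ] (+ l * + l * N′ ≡ N × Pair m N′ p′ q′)
    descend = N′ , p′ , q′ , N≡ , record
      { p-periodic = QP.periodic
      ; q-periodic = QQ.periodic
      ; p-norm = λ x → cancel-l² (trans (QP.norm x) (N≡′ x))
      ; q-norm = λ x → cancel-l² (trans (QQ.norm x) (N≡′ x))
      ; paired = paired′
      }
      where
      cancel-l² : ∀ {x y} → + l * + l * x ≡ + l * + l * y → x ≡ y
      cancel-l² {x} {y} e = ℤP.*-cancelˡ-≡ (+ l) x y (ℤP.*-cancelˡ-≡ (+ l) _ _
        (trans (sym (*-assoc (+ l) (+ l) x)) (trans e (*-assoc (+ l) (+ l) y))))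
      N≡′ : ∀ x → N * δ m x ≡ + l * + l * (N′ * δ m x)
      N≡′ x = trans (cong (_* δ m x) (sym N≡)) (*-assoc (+ l * + l) N′ (δ m x))

  -- Each prime of the list, counted with multiplicity, splits one l² off N; at order 1 nothing is
  -- left to prove.
  square-divides-norm′ : ∀ ps → All Prime ps → ¬ 2 ℕ.∣ product ps → ∀ {N p q} → Pair (product ps) N p q →
    + product ps * + product ps ∣ N
  square-divides-norm′ []       []         h-odd {N} P = divides N (sym (*-identityʳ N))
  square-divides-norm′ (l ∷ ps) (pr ∷ prs) h-odd {N} P = case descend pr (λ d → h-odd (ℕ.∣m⇒∣m*n (product ps) d)) {{productOfPrimes≢0 prs}} P of λ
    { (N′ , _ , _ , N≡ , P′) → case square-divides-norm′ ps prs (λ d → h-odd (ℕ.∣n⇒∣m*n l d)) P′ of λ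
      { (divides r N′≡) → divides r (trans (sym N≡) (trans (cong (+ l * + l *_) N′≡)
        (trans (lemma r (+ l) (+ product ps)) (cong (λ z → r * (z * z)) (sym (pos-* l (product ps))))))) } }
    where
    lemma : ∀ r l m → l * l * (r * (m * m)) ≡ r * ((l * m) * (l * m))
    lemma = solve-∀

  square-divides-norm : ∀ h .{{_ : NonZero h}} → ¬ 2 ℕ.∣ h → ∀ {N p q} → Pair h N p q → + h * + h ∣ N
  square-divides-norm h h-odd {N} {p} {q} P = subst (λ h → + h * + h ∣ N) (sym h≡) (square-divides-norm′ (factors F) (factorsPrime F)
    (subst (λ h → ¬ 2 ℕ.∣ h) h≡ h-odd) (subst (λ h → Pair h N p q) h≡ P))
    where
    open PrimeFactorisation
    F = factorise h
    h≡ = isFactorisation F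

-- Real circulants of order 2h with h odd.

module RealCase where

  open PeriodicSums
  open Descent
  open import Data.Empty using (⊥-elim)
  open import Data.Integer.Base as ℤ using (ℤ; +_; -[1+_]; 0ℤ; 1ℤ; -1ℤ; _+_; _*_; -_; _-_; _≤_; +≤+; _%ℕ_; _/ℕ_)
  open import Data.Integer.DivMod using (a≡a%ℕn+[a/ℕn]*n; n%ℕd<d)
  open import Data.Integer.Divisibility.Signed using (_∣_; divides; _∣?_; ∣m∣n⇒∣m+n; ∣m⇒∣-m; ∣⇒∣ᵤ; ∣-trans; *-cancelʳ-∣)
  open import Data.Integer.Properties as ℤP using (*-zeroʳ; *-identityˡ; *-identityʳ; +-identityˡ; +-identityʳ; +-comm; *-comm; pos-*)
  open import Data.Integer.Tactic.RingSolver using (solve-∀)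
  open import Data.Nat.Base as ℕ using (ℕ; zero; suc; NonZero; s≤s; z≤n)
  import Data.Nat.Divisibility as ℕ
  import Data.Nat.Properties as ℕ
  import Data.Nat.Tactic.RingSolver as ℕ-Solver
  open import Data.Product.Base using (Σ-syntax; ∃-syntax; _×_; _,_)
  open import Data.Sum.Base using (_⊎_; inj₁; inj₂; [_,_]′)
  open import Function.Base using (_∘_)
  open import Relation.Binary.PropositionalEquality hiding ([_])
  open import Relation.Nullary using (¬_; Dec; yes; no)
  open ≡-Reasoning

  member≤Σ : ∀ n {g} → (∀ x → 0ℤ ≤ g x) → ∀ k → k ℕ.< n → g (+ k) ≤ Σ n g
  0≤Σ : ∀ n {g} → (∀ x → 0ℤ ≤ g x) → 0ℤ ≤ Σ n g
  0≤Σ zero    g≥0 = ℤP.≤-refl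
  0≤Σ (suc n) g≥0 = ℤP.+-mono-≤ (0≤Σ n g≥0) (g≥0 (+ n))
  member≤Σ (suc n) {g} g≥0 k (s≤s k≤n) with ℕ.m≤n⇒m<n∨m≡n k≤n
  ... | inj₁ k<n  = subst (_≤ Σ n g + g (+ n)) (+-identityʳ (g (+ k))) (ℤP.+-mono-≤ (member≤Σ n g≥0 k k<n) (g≥0 (+ n)))
  ... | inj₂ refl = subst (_≤ Σ n g + g (+ n)) (+-identityˡ (g (+ n))) (ℤP.+-monoˡ-≤ (g (+ n)) (0≤Σ n g≥0))

  two-members≤Σ : ∀ n {g} → (∀ x → 0ℤ ≤ g x) → ∀ k → 0 ℕ.< k → k ℕ.< n → g 0ℤ + g (+ k) ≤ Σ n g
  two-members≤Σ (suc n) {g} g≥0 (suc k) _ (s≤s k<n) = subst₂ _≤_ (cong (λ z → g 0ℤ + g z) (+-comm (+ k) 1ℤ)) (sym (Σ-head n g))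
    (ℤP.+-monoʳ-≤ (g 0ℤ) (member≤Σ n {λ x → g (x + 1ℤ)} (λ x → g≥0 (x + 1ℤ)) k k<n))

  vanishing-members : ∀ n {g} → (∀ x → 0ℤ ≤ g x) → Σ n g ≡ g 0ℤ → ∀ k → 0 ℕ.< k → k ℕ.< n → g (+ k) ≡ 0ℤ
  vanishing-members n {g} g≥0 eq k 0<k k<n = ℤP.≤-antisym
    (subst₂ _≤_ (lemma (g 0ℤ) (g (+ k))) (ℤP.+-inverseˡ (g 0ℤ))
      (ℤP.+-monoʳ-≤ (- g 0ℤ) (subst (g 0ℤ + g (+ k) ≤_) eq (two-members≤Σ n g≥0 k 0<k k<n))))
    (g≥0 (+ k))
    where
    lemma : ∀ a b → - a + (a + b) ≡ b
    lemma = solve-∀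

  square≥0 : ∀ i → 0ℤ ≤ i * i
  square≥0 (+ n)    = subst (0ℤ ≤_) (pos-* n n) (+≤+ z≤n)
  square≥0 -[1+ n ] = +≤+ z≤n

  Σ-∣ : ∀ m n {g} → (∀ k → k ℕ.< n → m ∣ g (+ k)) → m ∣ Σ n g
  Σ-∣ m zero    d = ∣0 m
  Σ-∣ m (suc n) d = ∣m∣n⇒∣m+n (Σ-∣ m n (λ k k<n → d k (ℕ.m<n⇒m<1+n k<n))) (d n (ℕ.n<1+n n))

  -- Summation over a period is the trivial character, hence multiplicative.
  Σ-conv : ∀ n {f g} → Periodic n g → Σ n (conv n f g) ≡ Σ n f * Σ n g
  Σ-conv n {f} {g} per = begin
    Σ n (λ x → Σ n (λ k → f k * g (x - k)))
      ≡⟨ Σ-swap n n (λ x k → f k * g (x - k)) ⟩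
    Σ n (λ k → Σ n (λ x → f k * g (x - k)))
      ≡⟨ Σ-cong n (λ k → trans (Σ-*ˡ n (f k) (λ x → g (x - k))) (cong (f k *_) (Σ-shift n per (- k)))) ⟩
    Σ n (λ k → f k * Σ n g)
      ≡⟨ Σ-*ʳ n (Σ n g) f ⟩
    Σ n f * Σ n g ∎

  Even Odd : ℤ → Set
  Even x = ∃[ q ] x ≡ + 2 * q
  Odd  x = ∃[ q ] x ≡ 1ℤ + + 2 * q

  even⊎odd : ∀ x → Even x ⊎ Odd x
  even⊎odd x = go (x %ℕ 2) (n%ℕd<d x 2) (a≡a%ℕn+[a/ℕn]*n x 2)
    where
    go : ∀ r → r ℕ.< 2 → x ≡ + r + (x /ℕ 2) * + 2 → Even x ⊎ Odd x
    go zero          _ e = inj₁ (x /ℕ 2 , trans e (trans (+-identityˡ _) (*-comm (x /ℕ 2) (+ 2))))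
    go (suc zero)    _ e = inj₂ (x /ℕ 2 , trans e (cong (_+_ 1ℤ) (*-comm (x /ℕ 2) (+ 2))))
    go (suc (suc r)) (s≤s (s≤s ())) e

  even⇒∣ : ∀ {x} → Even x → + 2 ∣ x
  even⇒∣ (q , e) = divides q (trans e (*-comm (+ 2) q))

  odd⇒∤ : ∀ {x} → Odd x → ¬ + 2 ∣ x
  odd⇒∤ {x} (q , e) d = <⇒∤ {1} {2} (s≤s z≤n) (s≤s (s≤s z≤n)) (∣-respʳ (trans (cong (_- q * + 2) e) (lemma q))
    (∣m∣n⇒∣m+n d (∣m⇒∣-m (∣-self* (+ 2) q))))
    where
    lemma : ∀ q → (1ℤ + + 2 * q) - q * + 2 ≡ 1ℤ
    lemma = solve-∀

  -- (-1)ˣ for an integer x, as 2δ - 1.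
  sgn : ℤ → ℤ
  sgn x = + 2 * δ 2 x - 1ℤ

  sgn-∣ : ∀ {x} → + 2 ∣ x → sgn x ≡ 1ℤ
  sgn-∣ d = cong (λ z → + 2 * z - 1ℤ) (δ-∣ d)

  sgn-∤ : ∀ {x} → ¬ + 2 ∣ x → sgn x ≡ -1ℤ
  sgn-∤ d = cong (λ z → + 2 * z - 1ℤ) (δ-∤ d)

  sgn-even : ∀ {x} → Even x → sgn x ≡ 1ℤ
  sgn-even = sgn-∣ ∘ even⇒∣

  sgn-odd : ∀ {x} → Odd x → sgn x ≡ -1ℤ
  sgn-odd = sgn-∤ ∘ odd⇒∤

  sgn-+ : ∀ x y → sgn (x + y) ≡ sgn x * sgn y
  sgn-+ x y = go (even⊎odd x) (even⊎odd y)
    where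
    lemma₀ : ∀ p q → + 2 * p + + 2 * q ≡ + 2 * (p + q)
    lemma₀ = solve-∀
    lemma₁ : ∀ p q → + 2 * p + (1ℤ + + 2 * q) ≡ 1ℤ + + 2 * (p + q)
    lemma₁ = solve-∀
    lemma₂ : ∀ p q → (1ℤ + + 2 * p) + + 2 * q ≡ 1ℤ + + 2 * (p + q)
    lemma₂ = solve-∀
    lemma₃ : ∀ p q → (1ℤ + + 2 * p) + (1ℤ + + 2 * q) ≡ + 2 * (1ℤ + p + q)
    lemma₃ = solve-∀
    go : Even x ⊎ Odd x → Even y ⊎ Odd y → sgn (x + y) ≡ sgn x * sgn y
    go (inj₁ (p , e)) (inj₁ (q , e′)) = trans (sgn-even (p + q , trans (cong₂ _+_ e e′) (lemma₀ p q)))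
      (sym (cong₂ _*_ (sgn-even (p , e)) (sgn-even (q , e′))))
    go (inj₁ (p , e)) (inj₂ (q , e′)) = trans (sgn-odd (p + q , trans (cong₂ _+_ e e′) (lemma₁ p q)))
      (sym (cong₂ _*_ (sgn-even (p , e)) (sgn-odd (q , e′))))
    go (inj₂ (p , e)) (inj₁ (q , e′)) = trans (sgn-odd (p + q , trans (cong₂ _+_ e e′) (lemma₂ p q)))
      (sym (cong₂ _*_ (sgn-odd (p , e)) (sgn-even (q , e′))))
    go (inj₂ (p , e)) (inj₂ (q , e′)) = trans (sgn-even (1ℤ + p + q , trans (cong₂ _+_ e e′) (lemma₃ p q)))
      (sym (cong₂ _*_ (sgn-odd (p , e)) (sgn-odd (q , e′))))

  IsUnit : ℤ → Set
  IsUnit x = x ≡ 1ℤ ⊎ x ≡ -1ℤ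

  sgn-unit : ∀ x → IsUnit (sgn x)
  sgn-unit x = [ inj₁ ∘ sgn-even , inj₂ ∘ sgn-odd ]′ (even⊎odd x)

  unit-* : ∀ {x y} → IsUnit x → IsUnit y → IsUnit (x * y)
  unit-* (inj₁ refl) (inj₁ refl) = inj₁ refl
  unit-* (inj₁ refl) (inj₂ refl) = inj₂ refl
  unit-* (inj₂ refl) (inj₁ refl) = inj₂ refl
  unit-* (inj₂ refl) (inj₂ refl) = inj₁ refl

  unit² : ∀ {x} → IsUnit x → x * x ≡ 1ℤ
  unit² (inj₁ refl) = refl
  unit² (inj₂ refl) = refl

  sgn-neg : ∀ x → sgn (- x) ≡ sgn x
  sgn-neg x = go (even⊎odd x)
    where
    lemma₀ : ∀ p → - (+ 2 * p) ≡ + 2 * (- p)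
    lemma₀ = solve-∀
    lemma₁ : ∀ p → - (1ℤ + + 2 * p) ≡ 1ℤ + + 2 * (- p - 1ℤ)
    lemma₁ = solve-∀
    go : Even x ⊎ Odd x → sgn (- x) ≡ sgn x
    go (inj₁ (p , e)) = trans (sgn-even (- p , trans (cong -_ e) (lemma₀ p))) (sym (sgn-even (p , e)))
    go (inj₂ (p , e)) = trans (sgn-odd (- p - 1ℤ , trans (cong -_ e) (lemma₁ p))) (sym (sgn-odd (p , e)))

  fold-2 : ∀ m f x → fold m 2 f x ≡ f x + f (x + + m)
  fold-2 m f x = cong₂ _+_ (trans (+-identityˡ _) (cong f (lemma₀ x (+ m)))) (cong f (lemma₁ x (+ m)))
    where
    lemma₀ : ∀ x m → x + 0ℤ * m ≡ x
    lemma₀ = solve-∀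
    lemma₁ : ∀ x m → x + 1ℤ * m ≡ x + m
    lemma₁ = solve-∀

  %ℕ-difference : ∀ h .{{_ : NonZero h}} x → + h ∣ x - + (x %ℕ h)
  %ℕ-difference h x = divides (x /ℕ h) (trans (cong (_- + (x %ℕ h)) (a≡a%ℕn+[a/ℕn]*n x h)) (lemma (+ (x %ℕ h)) ((x /ℕ h) * + h)))
    where
    lemma : ∀ a b → (a + b) - a ≡ b
    lemma = solve-∀

  ∤⇒0<% : ∀ h .{{_ : NonZero h}} x → ¬ + h ∣ x → 0 ℕ.< x %ℕ h
  ∤⇒0<% h x h∤x = ℕ.n≢0⇒n>0 (λ e → h∤x (∣-respʳ (trans (cong (λ r → x - + r) e) (+-identityʳ x)) (%ℕ-difference h x)))

  from-representatives : ∀ h .{{_ : NonZero h}} {f} → Periodic h f → (P : ℤ → Set) →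
    (∀ k → 0 ℕ.< k → k ℕ.< h → P (f (+ k))) → ∀ x → ¬ + h ∣ x → P (f x)
  from-representatives h per P hyp x h∤x = subst P (sym (periodic-≡ per (%ℕ-difference h x))) (hyp (x %ℕ h) (∤⇒0<% h x h∤x) (n%ℕd<d x h))

  -- On the range of summation g - 1 is supported at 0.
  Σ-ones-off-0 : ∀ n .{{_ : NonZero n}} {g} → (∀ k → 0 ℕ.< k → k ℕ.< n → g (+ k) ≡ 1ℤ) → Σ n g ≡ (g 0ℤ - 1ℤ) + + n
  Σ-ones-off-0 n {g} ones = begin
    Σ n g                                       ≡⟨ Σ-cong n (λ x → lemma (g x)) ⟩
    Σ n (λ x → (g x - 1ℤ) + 1ℤ)                 ≡⟨ Σ-+ n (λ x → g x - 1ℤ) (λ _ → 1ℤ) ⟩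
    Σ n (λ x → g x - 1ℤ) + Σ n (λ _ → 1ℤ)       ≡⟨ cong₂ _+_ (Σ-support0 n (λ k 0<k k<n → cong (_- 1ℤ) (ones k 0<k k<n)))
                                                     (trans (Σ-const n 1ℤ) (*-identityʳ (+ n))) ⟩
    (g 0ℤ - 1ℤ) + + n                           ∎
    where
    lemma : ∀ x → x ≡ (x - 1ℤ) + 1ℤ
    lemma = solve-∀

  conv-periodic : ∀ n f {g} → Periodic n g → Periodic n (conv n f g)
  conv-periodic n f {g} per x = Σ-cong n (λ k → cong (f k *_) (trans (cong g (+-rightComm x (+ n) (- k))) (per (x - k))))

  -- The real circulants of order 2h: diagonal entry D, signs off the diagonal, orthogonal rows.
  record Profile (h D : ℕ) (f : ℤ → ℤ) : Set where
    field
      periodic : Periodic (2 ℕ.* h) f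
      at-0     : f 0ℤ ≡ + D
      unit     : ∀ x → ¬ + (2 ℕ.* h) ∣ x → IsUnit (f x)
      even     : ∀ x → f (- x) ≡ f x
      orth     : ∀ x → ¬ + (2 ℕ.* h) ∣ x → conv (2 ℕ.* h) f f x ≡ 0ℤ

  open Profile

  twist : (ℤ → ℤ) → ℤ → ℤ
  twist f x = sgn x * f x

  sgn-2h : ∀ h → sgn (+ (2 ℕ.* h)) ≡ 1ℤ
  sgn-2h h = sgn-even (+ h , pos-* 2 h)

  sgn-h : ∀ {h} → ¬ 2 ℕ.∣ h → sgn (+ h) ≡ -1ℤ
  sgn-h h-odd = sgn-∤ (h-odd ∘ ∣⇒∣ᵤ)

  -- `sgn` is a character of ℤ/2h: the factors sgn k and sgn (x - k) combine to sgn x, which leaves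
  -- the convolution sum.
  twist-profile : ∀ {h D f} → Profile h D f → Profile h D (twist f)
  twist-profile {h} {D} {f} F = record
    { periodic = λ x → cong₂ _*_ (trans (sgn-+ x (+ (2 ℕ.* h))) (trans (cong (sgn x *_) (sgn-2h h)) (*-identityʳ (sgn x)))) (periodic F x)
    ; at-0 = trans (cong₂ _*_ (sgn-∣ (∣0 (+ 2))) (at-0 F)) (*-identityˡ (+ D))
    ; unit = λ x d → unit-* (sgn-unit x) (unit F x d)
    ; even = λ x → cong₂ _*_ (sgn-neg x) (even F x)
    ; orth = λ x d → trans (Σ-cong (2 ℕ.* h) (λ k → trans (lemma (sgn k) (f k) (sgn (x - k)) (f (x - k)))
        (cong (_* (f k * f (x - k))) (trans (sym (sgn-+ k (x - k))) (cong sgn (lemma′ x k))))))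
        (trans (Σ-*ˡ (2 ℕ.* h) (sgn x) _) (trans (cong (sgn x *_) (orth F x d)) (*-zeroʳ (sgn x))))
    }
    where
    lemma : ∀ s f t g → s * f * (t * g) ≡ s * t * (f * g)
    lemma = solve-∀
    lemma′ : ∀ x k → k + (x - k) ≡ x
    lemma′ = solve-∀

  -- d² + n - 1 for n = 2(k + 1). It is written in this form because (k + 1)² = k² + (2k + 1), so
  -- that comparisons of squares reduce to cancelling a summand.
  norm : ℕ → ℕ → ℤ
  norm k D = + (D ℕ.* D ℕ.+ suc (k ℕ.+ k))

  module _ {k D f} (F : Profile (suc k) D f) where

    private
      h = suc k
      n = 2 ℕ.* h

    conv-at-0 : conv n f f 0ℤ ≡ norm k D
    conv-at-0 = begin
      Σ n (λ i → f i * f (0ℤ - i))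
        ≡⟨ Σ-cong n (λ i → cong (f i *_) (trans (cong f (+-identityˡ (- i))) (even F i))) ⟩
      Σ n (λ i → f i * f i)
        ≡⟨ Σ-ones-off-0 n (λ i 0<i i<n → unit² (unit F (+ i) (<⇒∤ 0<i i<n))) ⟩
      (f 0ℤ * f 0ℤ - 1ℤ) + + n
        ≡⟨ cong₂ (λ a b → (a * a - 1ℤ) + b) (at-0 F) (pos-* 2 h) ⟩
      (+ D * + D - 1ℤ) + + 2 * (1ℤ + + k)
        ≡⟨ lemma (+ D * + D) (+ k) ⟩
      + D * + D + (1ℤ + (+ k + + k))
        ≡⟨ cong (_+ (1ℤ + (+ k + + k))) (pos-* D D) ⟨
      norm k D ∎
      where
      lemma : ∀ a k → (a - 1ℤ) + + 2 * (1ℤ + k) ≡ a + (1ℤ + (k + k))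
      lemma = solve-∀

    conv-norm : ∀ x → conv n f f x ≡ norm k D * δ n x
    conv-norm x = go (+ n ∣? x)
      where
      go : Dec (+ n ∣ x) → conv n f f x ≡ norm k D * δ n x
      go (yes d) = trans (periodic-≡ {f = conv n f f} (conv-periodic n f (periodic F)) {x} {0ℤ} (∣-respʳ (sym (+-identityʳ x)) d))
        (trans conv-at-0 (sym (trans (cong (norm k D *_) (δ-∣ d)) (*-identityʳ (norm k D)))))
      go (no d)  = trans (orth F x d) (sym (trans (cong (norm k D *_) (δ-∤ d)) (*-zeroʳ (norm k D))))

    fold-norm : ∀ x → conv h (fold h 2 f) (fold h 2 f) x ≡ norm k D * δ h x
    fold-norm x = begin
      conv h (fold h 2 f) (fold h 2 f) x
        ≡⟨ fold-conv h 2 f (periodic F) x ⟩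
      fold h 2 (conv n f f) x
        ≡⟨ Σ-cong 2 (λ j → conv-norm (x + j * + h)) ⟩
      Σ 2 (λ j → norm k D * δ n (x + j * + h))
        ≡⟨ Σ-*ˡ 2 (norm k D) (λ j → δ n (x + j * + h)) ⟩
      norm k D * fold h 2 (δ n) x
        ≡⟨ cong (norm k D *_) (fold-δ h 2 x) ⟩
      norm k D * δ h x ∎

    fold-even : ∀ x → fold h 2 f (- x) ≡ fold h 2 f x
    fold-even x = begin
      fold h 2 f (- x)          ≡⟨ fold-2 h f (- x) ⟩
      f (- x) + f (- x + + h)   ≡⟨ cong₂ _+_ (even F x) (trans (sym (even F (- x + + h))) (cong f (lemma x (+ h)))) ⟩
      f x + f (x - + h)         ≡⟨ cong (_+_ (f x)) (trans (sym (periodic F (x - + h))) (cong f (trans (cong (_+_ (x - + h)) (pos-* 2 h)) (lemma₂ x (+ h))))) ⟩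
      f x + f (x + + h)         ≡⟨ fold-2 h f x ⟨
      fold h 2 f x              ∎
      where
      lemma : ∀ x h → - (- x + h) ≡ x - h
      lemma = solve-∀
      lemma₂ : ∀ x h → (x - h) + + 2 * h ≡ x + h
      lemma₂ = solve-∀

    -- The fold is an even function, so its convolution square at 0 is the sum of its squares.
    Σ-squares : Σ h (λ x → fold h 2 f x * fold h 2 f x) ≡ norm k D
    Σ-squares = trans (Σ-cong h (λ x → cong (fold h 2 f x *_) (sym (trans (cong (fold h 2 f) (+-identityˡ (- x))) (fold-even x)))))
      (trans (fold-norm 0ℤ) (trans (cong (norm k D *_) (δ0 h)) (*-identityʳ (norm k D))))

    Σ-fold² : Σ h (fold h 2 f) * Σ h (fold h 2 f) ≡ norm k D
    Σ-fold² = begin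
      Σ h (fold h 2 f) * Σ h (fold h 2 f)
        ≡⟨ Σ-conv h (fold-periodic h 2 (periodic F)) ⟨
      Σ h (conv h (fold h 2 f) (fold h 2 f))
        ≡⟨ Σ-cong h fold-norm ⟩
      Σ h (λ x → norm k D * δ h x)
        ≡⟨ Σ-*ˡ h (norm k D) (δ h) ⟩
      norm k D * Σ h (δ h)
        ≡⟨ cong (norm k D *_) (trans (Σ-support0 h (λ i 0<i i<h → δ-∤ (<⇒∤ 0<i i<h))) (δ0 h)) ⟩
      norm k D * 1ℤ
        ≡⟨ *-identityʳ (norm k D) ⟩
      norm k D ∎

  -- For signs u, v, s, the numbers (u + v)/2 and s(u − v)/2.
  halves : ∀ {u v s} → IsUnit u → IsUnit v → IsUnit s →
    Σ[ a ∈ ℤ ] Σ[ b ∈ ℤ ] (u + v ≡ + 2 * a × s * u + s * -1ℤ * v ≡ + 2 * b × Signed-unit a b)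
  halves (inj₁ refl) (inj₁ refl) (inj₁ refl) = 1ℤ  , 0ℤ  , refl , refl , refl
  halves (inj₁ refl) (inj₁ refl) (inj₂ refl) = 1ℤ  , 0ℤ  , refl , refl , refl
  halves (inj₁ refl) (inj₂ refl) (inj₁ refl) = 0ℤ  , 1ℤ  , refl , refl , refl
  halves (inj₁ refl) (inj₂ refl) (inj₂ refl) = 0ℤ  , -1ℤ , refl , refl , refl
  halves (inj₂ refl) (inj₁ refl) (inj₁ refl) = 0ℤ  , -1ℤ , refl , refl , refl
  halves (inj₂ refl) (inj₁ refl) (inj₂ refl) = 0ℤ  , 1ℤ  , refl , refl , refl
  halves (inj₂ refl) (inj₂ refl) (inj₁ refl) = -1ℤ , 0ℤ  , refl , refl , refl
  halves (inj₂ refl) (inj₂ refl) (inj₂ refl) = -1ℤ , 0ℤ  , refl , refl , refl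

  suc² : ∀ m → suc m ℕ.* suc m ≡ m ℕ.* m ℕ.+ suc (m ℕ.+ m)
  suc² = ℕ-Solver.solve-∀

  square-reflects-≤ : ∀ {m n} → m ℕ.* m ℕ.≤ n ℕ.* n → m ℕ.≤ n
  square-reflects-≤ {m} {n} le = ℕ.≮⇒≥ (λ n<m → ℕ.<⇒≱ (ℕ.*-mono-< n<m n<m) le)

  double-reflects-≤ : ∀ {m n} → m ℕ.+ m ℕ.≤ n ℕ.+ n → m ℕ.≤ n
  double-reflects-≤ {m} {n} le = ℕ.≮⇒≥ (λ n<m → ℕ.<⇒≱ (ℕ.+-mono-< n<m n<m) le)

  square-roots : ∀ x m → x * x ≡ + m * + m → x ≡ + m ⊎ x ≡ - + m
  square-roots x m e = [ (λ z → inj₁ (lemma₁ z)) , (λ z → inj₂ (lemma₂ z)) ]′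
    (ℤP.i*j≡0⇒i≡0∨j≡0 (x - + m) (trans (factor x (+ m)) (trans (cong (_- + m * + m) e) (ℤP.+-inverseʳ (+ m * + m)))))
    where
    factor : ∀ x m → (x - m) * (x + m) ≡ x * x - m * m
    factor = solve-∀
    l₁ : ∀ x m → x ≡ (x - m) + m
    l₁ = solve-∀
    l₂ : ∀ x m → x ≡ (x + m) - m
    l₂ = solve-∀
    lemma₁ : x - + m ≡ 0ℤ → x ≡ + m
    lemma₁ z = trans (l₁ x (+ m)) (trans (cong (_+ + m) z) (+-identityˡ (+ m)))
    lemma₂ : x + + m ≡ 0ℤ → x ≡ - + m
    lemma₂ z = trans (l₂ x (+ m)) (trans (cong (_- + m) z) (+-identityˡ (- + m)))

  -- The signs of f when f h = -1.

  module _ {k D f} (h-odd : ¬ 2 ℕ.∣ suc k) (F : Profile (suc k) D f) (f-h : f (+ suc k) ≡ -1ℤ) where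

    private
      h = suc k
      n = 2 ℕ.* h
      p q : ℤ → ℤ
      p = fold h 2 f
      q = fold h 2 (twist f)

      pair : Pair h (norm k D) p q
      pair = record
        { p-periodic = fold-periodic h 2 (periodic F)
        ; q-periodic = fold-periodic h 2 (periodic (twist-profile F))
        ; p-norm = fold-norm F
        ; q-norm = fold-norm (twist-profile F)
        ; paired = λ x h∤x → let a , b , ea , eb , u = halves (unit F x (n∤ x h∤x)) (unit F (x + + h) (n∤+h x h∤x)) (sgn-unit x) in
            a , b , trans (fold-2 h f x) ea ,
            trans (fold-2 h (twist f) x) (trans (cong (λ z → sgn x * f x + z * f (x + + h))
              (trans (sgn-+ x (+ h)) (cong (sgn x *_) (sgn-h h-odd)))) eb) , u
        }
        where
        h∣n : + h ∣ + n
        h∣n = divides (+ 2) (pos-* 2 h)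
        n∤ : ∀ x → ¬ + h ∣ x → ¬ + n ∣ x
        n∤ x h∤x d = h∤x (∣-trans h∣n d)
        n∤+h : ∀ x → ¬ + h ∣ x → ¬ + n ∣ x + + h
        n∤+h x h∤x d = h∤x (∣-+-period h x (∣-trans h∣n d))

      -- h² divides the positive number N, so (k + 1)² ≤ D² + (2k + 1), and 2k + 1 cancels.
      k≤D : k ℕ.≤ D
      k≤D = square-reflects-≤ (ℕ.+-cancelʳ-≤ (suc (k ℕ.+ k)) _ _ (subst (ℕ._≤ D ℕ.* D ℕ.+ suc (k ℕ.+ k)) (suc² k)
        (ℕ.∣⇒≤ {{ℕ.>-nonZero (ℕ.≤-trans (s≤s z≤n) (ℕ.m≤n+m _ (D ℕ.* D)))}}
          (subst (λ z → ℤ.∣ z ∣ ℕ.∣ ℤ.∣ norm k D ∣) (sym (pos-* h h)) (∣⇒∣ᵤ (square-divides-norm h h-odd pair))))))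

      p-0 : p 0ℤ ≡ + D + -1ℤ
      p-0 = trans (fold-2 h f 0ℤ) (cong₂ _+_ (at-0 F) (trans (cong f (+-identityˡ (+ h))) f-h))

      q-0 : q 0ℤ ≡ + suc D
      q-0 = trans (fold-2 h (twist f) 0ℤ) (trans (cong₂ _+_ (at-0 (twist-profile F))
        (trans (cong (twist f) (+-identityˡ (+ h))) (cong₂ _*_ (sgn-h h-odd) f-h))) (+-comm (+ D) 1ℤ))

      q² : ℤ → ℤ
      q² x = q x * q x

      q²≥0 : ∀ x → 0ℤ ≤ q² x
      q²≥0 x = square≥0 (q x)

      q²-0 : q² 0ℤ ≡ + (suc D ℕ.* suc D)
      q²-0 = trans (cong₂ _*_ q-0 q-0) (sym (pos-* (suc D) (suc D)))

      -- f h = -1 and h odd make q 0 = D + 1; hence (D + 1)² ≤ Σ q² = D² + (2k + 1).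
      D≤k : D ℕ.≤ k
      D≤k = double-reflects-≤ (ℕ.s≤s⁻¹ (ℕ.+-cancelˡ-≤ (D ℕ.* D) _ _ (subst (ℕ._≤ D ℕ.* D ℕ.+ suc (k ℕ.+ k)) (suc² D)
        (ℤP.drop‿+≤+ (subst₂ _≤_ q²-0 (Σ-squares (twist-profile F)) (member≤Σ h {q²} q²≥0 0 (s≤s z≤n)))))))

    diagonal≡ : D ≡ k
    diagonal≡ = ℕ.≤-antisym D≤k k≤D

    private
      norm≡ : norm k D ≡ + (suc D ℕ.* suc D)
      norm≡ = cong +_ (trans (cong (λ j → D ℕ.* D ℕ.+ suc (j ℕ.+ j)) (sym diagonal≡)) (sym (suc² D)))

      -- With D = k the sum of squares N = (D + 1)² is already exhausted by the term at 0.
      q-vanishes : ∀ x → ¬ + h ∣ x → q x ≡ 0ℤ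
      q-vanishes = from-representatives h {q} (fold-periodic h 2 (periodic (twist-profile F))) (_≡ 0ℤ)
        (λ i 0<i i<h → [ (λ e → e) , (λ e → e) ]′ (ℤP.i*j≡0⇒i≡0∨j≡0 (q (+ i))
          (vanishing-members h {q²} q²≥0 (trans (Σ-squares (twist-profile F)) (trans norm≡ (sym q²-0))) i 0<i i<h)))

      -- Where q vanishes p is ±2, so off the multiples of h this is 0 or 4: a multiple of 4, which
      -- excludes one sign of Σ p, and nonnegative, which settles the other.
      p+2 : ℤ → ℤ
      p+2 x = p x + + 2

      p+2-cases : ∀ x → ¬ + h ∣ x → p+2 x ≡ 0ℤ ⊎ p+2 x ≡ + 4
      p+2-cases x h∤x = let a , b , ea , eb , u = Pair.paired pair x h∤x in
        go a (b≡0 b (trans (sym eb) (q-vanishes x h∤x))) u ea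
        where
        b≡0 : ∀ b → + 2 * b ≡ 0ℤ → b ≡ 0ℤ
        b≡0 b e = [ (λ ()) , (λ z → z) ]′ (ℤP.i*j≡0⇒i≡0∨j≡0 (+ 2) e)
        go : ∀ a {b} → b ≡ 0ℤ → Signed-unit a b → p x ≡ + 2 * a → p+2 x ≡ 0ℤ ⊎ p+2 x ≡ + 4
        go (+ 0)            refl ()
        go (+ 1)            refl _ e = inj₂ (cong (_+ + 2) e)
        go (+ suc (suc _))  refl ()
        go -[1+ 0 ]         refl _ e = inj₁ (cong (_+ + 2) e)
        go -[1+ suc _ ]     refl ()

      p+2-0 : p+2 0ℤ ≡ + h
      p+2-0 = trans (cong (_+ + 2) p-0) (trans (lemma (+ D)) (cong (λ j → + suc j) diagonal≡))
        where
        lemma : ∀ d → (d + -1ℤ) + + 2 ≡ 1ℤ + d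
        lemma = solve-∀

      Σp+2 : Σ h p+2 ≡ Σ h p + + 2 * + h
      Σp+2 = trans (Σ-+ h p (λ _ → + 2)) (cong (_+_ (Σ h p)) (trans (Σ-const h (+ 2)) (*-comm (+ h) (+ 2))))

      -- Modulo 4 only the term at 0 survives, which excludes Σ p = + h.
      Σp≢h : Σ h p ≢ + h
      Σp≢h e = h-odd (∣⇒∣ᵤ (*-cancelʳ-∣ (+ 2) {+ 2} {+ h} (∣-respʳ eq (Σ-∣ (+ 4) k
        (λ i i<k → subst (λ z → + 4 ∣ p+2 z) (+-comm 1ℤ (+ i)) (4∣ (p+2-cases (+ suc i) (<⇒∤ (s≤s z≤n) (s≤s i<k)))))))))
        where
        4∣ : ∀ {z} → z ≡ 0ℤ ⊎ z ≡ + 4 → + 4 ∣ z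
        4∣ (inj₁ refl) = ∣0 (+ 4)
        4∣ (inj₂ refl) = divides 1ℤ refl
        lemma : ∀ s t → s ≡ t + s - t
        lemma = solve-∀
        lemma′ : ∀ h → (h + + 2 * h) - h ≡ h * + 2
        lemma′ = solve-∀
        -- The terms off 0 would add up to 3h - h = 2h, and 4 ∣ 2h contradicts h odd.
        eq : Σ k (λ x → p+2 (x + 1ℤ)) ≡ + h * + 2
        eq = begin
          Σ k (λ x → p+2 (x + 1ℤ))                    ≡⟨ lemma _ (p+2 0ℤ) ⟩
          p+2 0ℤ + Σ k (λ x → p+2 (x + 1ℤ)) - p+2 0ℤ  ≡⟨ cong₂ _-_ (trans (sym (Σ-head k p+2)) (trans Σp+2 (cong (_+ + 2 * + h) e))) p+2-0 ⟩
          (+ h + + 2 * + h) - + h                     ≡⟨ lemma′ (+ h) ⟩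
          + h * + 2                                   ∎

      Σp≡-h : Σ h p ≡ - + h
      Σp≡-h = [ (λ e → ⊥-elim (Σp≢h e)) , (λ e → e) ]′ (square-roots (Σ h p) h
        (trans (Σ-fold² F) (trans norm≡ (trans (cong (λ j → + (suc j ℕ.* suc j)) diagonal≡) (pos-* h h)))))

      -- The total -h + 2h = h equals the term at 0, so the remaining terms, none of them negative,
      -- add up to 0.
      p+2-off-0 : ∀ i → 0 ℕ.< i → i ℕ.< h → p+2 (+ i) ≡ 0ℤ
      p+2-off-0 i 0<i i<h = trans (sym (abs≡ i i<h)) (vanishing-members h {λ x → + ℤ.∣ p+2 x ∣} nonneg Σ≡ i 0<i i<h)
        where
        -- p + 2 is only known to be nonnegative off the multiples of h, so it is replaced there by a function that is so everywhere.
        nonneg : ∀ x → 0ℤ ≤ + ℤ.∣ p+2 x ∣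
        nonneg x = +≤+ z≤n
        abs≡ : ∀ j → j ℕ.< h → + ℤ.∣ p+2 (+ j) ∣ ≡ p+2 (+ j)
        abs≡ zero    _   = trans (cong (λ z → + ℤ.∣ z ∣) p+2-0) (sym p+2-0)
        abs≡ (suc j) j<h = go (p+2-cases (+ suc j) (<⇒∤ (s≤s z≤n) j<h))
          where
          go : ∀ {z} → z ≡ 0ℤ ⊎ z ≡ + 4 → + ℤ.∣ z ∣ ≡ z
          go (inj₁ refl) = refl
          go (inj₂ refl) = refl
        lemma : ∀ h → - h + + 2 * h ≡ h
        lemma = solve-∀
        Σ≡ : Σ h (λ x → + ℤ.∣ p+2 x ∣) ≡ + ℤ.∣ p+2 0ℤ ∣
        Σ≡ = trans (Σ-cong< h abs≡) (trans Σp+2 (trans (cong (_+ + 2 * + h) Σp≡-h) (trans (lemma (+ h)) (sym (cong (λ z → + ℤ.∣ z ∣) p+2-0)))))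

      units-sum : ∀ {u v} → IsUnit u → IsUnit v → (u + v) + + 2 ≡ 0ℤ → u ≡ -1ℤ
      units-sum (inj₁ refl) (inj₁ refl) ()
      units-sum (inj₁ refl) (inj₂ refl) ()
      units-sum (inj₂ refl) _ _ = refl

    -- An odd multiple of h is congruent to h modulo 2h; off the multiples of h, f x + f (x + h) =
    -- -2 forces both signs.
    off-diagonal : ∀ x → ¬ + n ∣ x → f x ≡ -1ℤ
    off-diagonal x n∤x = go (+ h ∣? x)
      where
      h∣n : + h ∣ + n
      h∣n = divides (+ 2) (pos-* 2 h)
      lemma₀ : ∀ q h → + 2 * q * h ≡ q * (+ 2 * h)
      lemma₀ = solve-∀
      lemma₁ : ∀ q h → (1ℤ + + 2 * q) * h - h ≡ q * (+ 2 * h)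
      lemma₁ = solve-∀
      multiple : ∀ q → x ≡ q * + h → Even q ⊎ Odd q → f x ≡ -1ℤ
      multiple q e (inj₁ (r , e′)) = ⊥-elim (n∤x (divides r (trans e (trans (cong (_* + h) e′)
        (trans (lemma₀ r (+ h)) (cong (r *_) (sym (pos-* 2 h))))))))
      multiple q e (inj₂ (r , e′)) = trans (periodic-≡ (periodic F) (divides r (trans (cong (_- + h) (trans e (cong (_* + h) e′)))
        (trans (lemma₁ r (+ h)) (cong (r *_) (sym (pos-* 2 h))))))) f-h
      go : Dec (+ h ∣ x) → f x ≡ -1ℤ
      go (yes (divides q e)) = multiple q e (even⊎odd q)
      go (no h∤x) = units-sum (unit F x n∤x) (unit F (x + + h) (λ d → h∤x (∣-+-period h x (∣-trans h∣n d))))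
        (trans (cong (_+ + 2) (sym (fold-2 h f x)))
          (from-representatives h {p} (fold-periodic h 2 (periodic F)) (λ z → z + + 2 ≡ 0ℤ) p+2-off-0 x h∤x))

  -- Since h is odd, twisting reverses the sign of f h; so f h = -1 may be assumed for one of f and
  -- `twist f`.
  real-classification : ∀ {k D f} → ¬ 2 ℕ.∣ suc k → Profile (suc k) D f →
    D ≡ k × ((∀ x → ¬ + (2 ℕ.* suc k) ∣ x → f x ≡ -1ℤ) ⊎ (∀ x → ¬ + (2 ℕ.* suc k) ∣ x → twist f x ≡ -1ℤ))
  real-classification {k} {D} {f} h-odd F = [ plus , minus ]′ (unit F (+ suc k) (<⇒∤ (s≤s z≤n) (ℕ.m<m+n (suc k) (s≤s z≤n))))
    where
    Result = D ≡ k × ((∀ x → ¬ + (2 ℕ.* suc k) ∣ x → f x ≡ -1ℤ) ⊎ (∀ x → ¬ + (2 ℕ.* suc k) ∣ x → twist f x ≡ -1ℤ))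
    plus : f (+ suc k) ≡ 1ℤ → Result
    plus e = diagonal≡ h-odd (twist-profile F) e′ , inj₂ (off-diagonal h-odd (twist-profile F) e′)
      where
      e′ = cong₂ _*_ (sgn-h h-odd) e
    minus : f (+ suc k) ≡ -1ℤ → Result
    minus e = diagonal≡ h-odd F e , inj₁ (off-diagonal h-odd F e)

-- The integer equations modulo 4.

module ModFour where

  open PeriodicSums
  open ShiftOperators
  open RealCase
  open import Data.Empty using (⊥-elim)
  open import Data.Integer.Base as ℤ using (ℤ; +_; -[1+_]; 0ℤ; 1ℤ; -1ℤ; _+_; _*_; -_; _-_)
  open import Data.Integer.Divisibility.Signed using (_∣_; divides; _∣?_; ∣m∣n⇒∣m+n; ∣m⇒∣-m; ∣⇒∣ᵤ; ∣ᵤ⇒∣; ∣-trans; *-cancelˡ-∣)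
  open import Data.Integer.Properties as ℤP using (*-zeroˡ; *-zeroʳ; *-identityˡ; *-identityʳ; +-identityˡ; +-identityʳ; +-comm; *-comm; pos-*)
  open import Data.Integer.Tactic.RingSolver using (solve-∀)
  open import Data.Nat.Base as ℕ using (ℕ; zero; suc; NonZero; s≤s; z≤n)
  import Data.Nat.Divisibility as ℕ
  open import Data.Nat.Primality using (prime[2])
  open Descent using (euclid)
  import Data.Nat.Properties as ℕ
  open import Data.Product.Base using (∃-syntax; _×_; _,_; proj₁; proj₂)
  open import Data.Sum.Base using (_⊎_; inj₁; inj₂; [_,_]′)
  open import Function.Base using (_∘_)
  open import Relation.Binary.PropositionalEquality hiding ([_])
  open import Relation.Nullary using (¬_; Dec; yes; no)
  open ≡-Reasoning

  Trit : ℤ → Set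
  Trit x = x ≡ 0ℤ ⊎ IsUnit x

  -- x = x² − 2 · negative x for x ∈ {0, 1, −1}.
  negative : ℤ → ℤ
  negative (+ _)    = 0ℤ
  negative -[1+ _ ] = 1ℤ

  trit≡ : ∀ {x} → Trit x → x ≡ x * x - + 2 * negative x
  trit≡ (inj₁ refl)        = refl
  trit≡ (inj₂ (inj₁ refl)) = refl
  trit≡ (inj₂ (inj₂ refl)) = refl

  conv-cong : ∀ n {f f′ g g′} → (∀ x → f x ≡ f′ x) → (∀ x → g x ≡ g′ x) → ∀ x → conv n f g x ≡ conv n f′ g′ x
  conv-cong n e e′ x = Σ-cong n (λ k → cong₂ _*_ (e k) (e′ (x - k)))

  Σ-linear₃ : ∀ n a b c f g h → Σ n (λ k → (a * f k + b * g k) + c * h k) ≡ (a * Σ n f + b * Σ n g) + c * Σ n h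
  Σ-linear₃ n a b c f g h = trans (Σ-+ n (λ k → a * f k + b * g k) (λ k → c * h k)) (cong₂ _+_
    (trans (Σ-+ n (λ k → a * f k) (λ k → b * g k)) (cong₂ _+_ (Σ-*ˡ n a f) (Σ-*ˡ n b g))) (Σ-*ˡ n c h))

  conv-binomial : ∀ n {f g} → Periodic n f → Periodic n g → ∀ c x →
    conv n (λ k → f k + c * g k) (λ k → f k + c * g k) x ≡ (conv n f f x + (+ 2 * c) * conv n f g x) + (c * c) * conv n g g x
  conv-binomial n {f} {g} pf pg c x = begin
    Σ n (λ k → (f k + c * g k) * (f (x - k) + c * g (x - k)))
      ≡⟨ Σ-cong n (λ k → lemma (f k) (g k) (f (x - k)) (g (x - k)) c) ⟩
    Σ n (λ k → (1ℤ * (f k * f (x - k)) + c * (f k * g (x - k) + g k * f (x - k))) + c * c * (g k * g (x - k)))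
      ≡⟨ Σ-linear₃ n 1ℤ c (c * c) (λ k → f k * f (x - k)) (λ k → f k * g (x - k) + g k * f (x - k)) (λ k → g k * g (x - k)) ⟩
    (1ℤ * conv n f f x + c * Σ n (λ k → f k * g (x - k) + g k * f (x - k))) + c * c * conv n g g x
      ≡⟨ cong (λ z → (1ℤ * conv n f f x + c * z) + c * c * conv n g g x)
           (trans (Σ-+ n (λ k → f k * g (x - k)) (λ k → g k * f (x - k))) (cong (_+_ (conv n f g x)) (conv-comm n pg pf x))) ⟩
    (1ℤ * conv n f f x + c * (conv n f g x + conv n f g x)) + c * c * conv n g g x
      ≡⟨ lemma′ (conv n f f x) (conv n f g x) (conv n g g x) c ⟩
    (conv n f f x + (+ 2 * c) * conv n f g x) + (c * c) * conv n g g x ∎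
    where
    lemma : ∀ f g f′ g′ c → (f + c * g) * (f′ + c * g′) ≡ (1ℤ * (f * f′) + c * (f * g′ + g * f′)) + c * c * (g * g′)
    lemma = solve-∀
    lemma′ : ∀ a b d c → (1ℤ * a + c * (b + b)) + c * c * d ≡ (a + (+ 2 * c) * b) + c * c * d
    lemma′ = solve-∀

  sq : (ℤ → ℤ) → ℤ → ℤ
  sq a x = a x * a x

  -- For a = t - 2w with t = a², a * a = t * t - 4 t * w + 4 w * w. Thus modulo 4 only the support
  -- of a matters, not its signs.
  conv-trits-mod4 : ∀ n {a} → Periodic n a → (∀ x → Trit (a x)) → ∀ x → conv n a a x ≡ conv n (sq a) (sq a) x [ 4 ]
  conv-trits-mod4 n {a} per trits x = mod (divides (w*w - t*w) (begin
    conv n a a x - t*t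
      ≡⟨ cong (_- t*t) (conv-cong n a≡ a≡ x) ⟩
    conv n (λ k → sq a k + (- + 2) * negative (a k)) (λ k → sq a k + (- + 2) * negative (a k)) x - t*t
      ≡⟨ cong (_- t*t) (conv-binomial n (λ y → cong₂ _*_ (per y) (per y)) (λ y → cong negative (per y)) (- + 2) x) ⟩
    ((t*t + (+ 2 * - + 2) * t*w) + (- + 2 * - + 2) * w*w) - t*t
      ≡⟨ lemma t*t t*w w*w ⟩
    (w*w - t*w) * + 4 ∎))
    where
    t*t = conv n (sq a) (sq a) x
    t*w = conv n (sq a) (λ k → negative (a k)) x
    w*w = conv n (λ k → negative (a k)) (λ k → negative (a k)) x
    sub : ∀ u v → u - + 2 * v ≡ u + (- + 2) * v
    sub = solve-∀
    a≡ : ∀ y → a y ≡ sq a y + (- + 2) * negative (a y)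
    a≡ y = trans (trit≡ (trits y)) (sub (sq a y) (negative (a y)))
    lemma : ∀ p q r → ((p + (+ 2 * - + 2) * q) + (- + 2 * - + 2) * r) - p ≡ (r - q) * + 4
    lemma = solve-∀

  ones : ℤ → ℤ
  ones _ = 1ℤ

  conv-ones : ∀ n {f} → Periodic n f → ∀ x → conv n ones f x ≡ Σ n f
  conv-ones n {f} per x = trans (Σ-cong n (λ k → *-identityˡ (f (x - k)))) (Σ-reflect n per x)

  conv-negˡ : ∀ n f g x → conv n (λ k → - f k) g x ≡ - conv n f g x
  conv-negˡ n f g x = trans (Σ-cong n (λ k → lemma (f k) (g (x - k)))) (trans (Σ-*ˡ n -1ℤ (λ k → f k * g (x - k))) (ℤP.-1*i≡-i _))
    where
    lemma : ∀ a b → - a * b ≡ -1ℤ * (a * b)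
    lemma = solve-∀

  conv-+ˡ : ∀ n f g h x → conv n (λ k → f k + g k) h x ≡ conv n f h x + conv n g h x
  conv-+ˡ n f g h x = trans (Σ-cong n (λ k → ℤP.*-distribʳ-+ (h (x - k)) (f k) (g k))) (Σ-+ n (λ k → f k * h (x - k)) (λ k → g k * h (x - k)))

  module _ (n : ℕ) .{{_ : NonZero n}} where

    ε : ℤ → ℤ
    ε x = 1ℤ - δ n x

    ε-periodic : Periodic n ε
    ε-periodic x = cong (_-_ 1ℤ) (δ-periodic n x)

    ε-∣ : ∀ {x} → + n ∣ x → ε x ≡ 0ℤ
    ε-∣ d = cong (_-_ 1ℤ) (δ-∣ d)

    ε-∤ : ∀ {x} → ¬ + n ∣ x → ε x ≡ 1ℤ
    ε-∤ d = cong (_-_ 1ℤ) (δ-∤ d)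

    conv-ε : ∀ {f} → Periodic n f → ∀ x → conv n ε f x ≡ Σ n f - f x
    conv-ε {f} per x = trans (conv-+ˡ n ones (λ k → - δ n k) f x) (cong₂ _+_ (conv-ones n per x)
      (trans (conv-negˡ n (δ n) f x) (cong -_ (trans (conv-comm n (δ-periodic n) per x) (conv-δ n per x)))))

    Σ-ε : Σ n ε ≡ + n - 1ℤ
    Σ-ε = trans (Σ-ones-off-0 n (λ k 0<k k<n → ε-∤ (<⇒∤ 0<k k<n))) (trans (cong (λ z → (z - 1ℤ) + + n) (ε-∣ (∣0 (+ n)))) (lemma (+ n)))
      where
      lemma : ∀ n → (0ℤ - 1ℤ) + n ≡ n - 1ℤ
      lemma = solve-∀

    -- This counts the residues other than 0 and x.
    conv-ε-ε : ∀ x → ¬ + n ∣ x → conv n ε ε x ≡ + n - + 2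
    conv-ε-ε x d = trans (conv-ε ε-periodic x) (trans (cong₂ _-_ Σ-ε (ε-∤ d)) (lemma (+ n)))
      where
      lemma : ∀ n → (n - 1ℤ) - 1ℤ ≡ n - + 2
      lemma = solve-∀

  -- The generator of C is D/2 at 0 and a + i b elsewhere; D = 2d.
  record Solution (n D : ℕ) (a b : ℤ → ℤ) : Set where
    field
      a-periodic : Periodic n a
      b-periodic : Periodic n b
      a-even     : ∀ x → a (- x) ≡ a x
      b-odd      : ∀ x → b (- x) ≡ - b x
      diagonal   : ∀ x → + n ∣ x → a x ≡ 0ℤ × b x ≡ 0ℤ
      units      : ∀ x → ¬ + n ∣ x → (IsUnit (a x) × b x ≡ 0ℤ) ⊎ (a x ≡ 0ℤ × IsUnit (b x))
      real-part  : ∀ x → ¬ + n ∣ x → + D * a x + (conv n a a x - conv n b b x) ≡ 0ℤ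
      imag-part  : ∀ x → ¬ + n ∣ x → + D * b x + + 2 * conv n a b x ≡ 0ℤ

  -- The alternating form is recorded together with 2 ∣ D, which is what rules it out for
  -- half-integral d.
  Conclusion : ℕ → ℕ → (ℤ → ℤ) → (ℤ → ℤ) → Set
  Conclusion n D a b = n ≡ 2 ℕ.+ D × (∀ x → b x ≡ 0ℤ) ×
    ((∀ x → ¬ + n ∣ x → a x ≡ -1ℤ) ⊎ (2 ℕ.∣ D × (∀ x → ¬ + n ∣ x → twist a x ≡ -1ℤ)))

  unit-∤2 : ∀ {x} → IsUnit x → ¬ + 2 ∣ x
  unit-∤2 (inj₁ refl) = <⇒∤ {1} {2} (s≤s z≤n) (s≤s (s≤s z≤n))
  unit-∤2 (inj₂ refl) d = <⇒∤ {1} {2} (s≤s z≤n) (s≤s (s≤s z≤n)) (∣m⇒∣-m d)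

  unit-difference : ∀ {x y} → IsUnit x → IsUnit y → ∃[ z ] (x - y ≡ + 2 * z × (z ≡ 0ℤ → x ≡ y) × (z ≡ 0ℤ ⊎ IsUnit z))
  unit-difference (inj₁ refl) (inj₁ refl) = 0ℤ , refl , (λ _ → refl) , inj₁ refl
  unit-difference (inj₁ refl) (inj₂ refl) = 1ℤ , refl , (λ ()) , inj₂ (inj₁ refl)
  unit-difference (inj₂ refl) (inj₁ refl) = -1ℤ , refl , (λ ()) , inj₂ (inj₂ refl)
  unit-difference (inj₂ refl) (inj₂ refl) = 0ℤ , refl , (λ _ → refl) , inj₁ refl

  module _ {n D a b} .{{_ : NonZero n}} (2≤n : 2 ℕ.≤ n) (S : Solution n D a b) where

    open Solution S

    private
      trits : ∀ x → Trit (a x) × Trit (b x)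
      trits x = go (+ n ∣? x)
        where
        off : (IsUnit (a x) × b x ≡ 0ℤ) ⊎ (a x ≡ 0ℤ × IsUnit (b x)) → Trit (a x) × Trit (b x)
        off (inj₁ (ua , b0)) = inj₂ ua , inj₁ b0
        off (inj₂ (a0 , ub)) = inj₁ a0 , inj₂ ub
        go : Dec (+ n ∣ x) → Trit (a x) × Trit (b x)
        go (yes d) = inj₁ (proj₁ (diagonal x d)) , inj₁ (proj₂ (diagonal x d))
        go (no d)  = off (units x d)

      n∤1 : ¬ + n ∣ 1ℤ
      n∤1 = <⇒∤ (s≤s z≤n) 2≤n

      conv-0 : ∀ {f} → (∀ x → f x ≡ 0ℤ) → ∀ x → conv n f f x ≡ 0ℤ
      conv-0 {f} f0 x = trans (Σ-cong n (λ k → trans (cong (_* f (x - k)) (f0 k)) (*-zeroˡ (f (x - k))))) (Σ-0 n)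

    odd-case : ¬ 2 ℕ.∣ D → Conclusion n D a b
    odd-case D-odd = conclude (a-unit 1ℤ n∤1)
      where
      2∤D : ¬ + 2 ∣ + D
      2∤D = D-odd ∘ ∣⇒∣ᵤ
      2∣Dz⇒ : ∀ z → + 2 ∣ + D * z → + 2 ∣ z
      2∣Dz⇒ z d = [ (λ d′ → ⊥-elim (2∤D d′)) , (λ d′ → d′) ]′ (euclid prime[2] (+ D) z d)
      b-vanishes : ∀ x → b x ≡ 0ℤ
      b-vanishes x = go (+ n ∣? x)
        where
        lemma : ∀ u v → u + + 2 * v ≡ 0ℤ → u ≡ (- v) * + 2
        lemma u v e = trans (l u v) (trans (cong (_+ (- v) * + 2) e) (+-identityˡ _))
          where
          l : ∀ u v → u ≡ (u + + 2 * v) + (- v) * + 2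
          l = solve-∀
        go : Dec (+ n ∣ x) → b x ≡ 0ℤ
        go (yes d) = proj₂ (diagonal x d)
        go (no d)  = [ (λ e → e) , (λ u → ⊥-elim (unit-∤2 u (2∣Dz⇒ (b x) (divides (- conv n a b x) (lemma _ _ (imag-part x d)))))) ]′ (proj₂ (trits x))
      a-unit : ∀ x → ¬ + n ∣ x → IsUnit (a x)
      a-unit x d = [ proj₁ , (λ (_ , u) → ⊥-elim (unit-∤2 u (∣-respʳ (sym (b-vanishes x)) (∣0 (+ 2))))) ]′ (units x d)
      sq≡ε : ∀ x → sq a x ≡ ε n x
      sq≡ε x = go (+ n ∣? x)
        where
        go : Dec (+ n ∣ x) → sq a x ≡ ε n x
        go (yes d) = trans (cong (λ z → z * z) (proj₁ (diagonal x d))) (sym (ε-∣ n d))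
        go (no d)  = trans (unit² (a-unit x d)) (sym (ε-∤ n d))
      real-part′ : ∀ x → ¬ + n ∣ x → + D * a x + conv n a a x ≡ 0ℤ
      real-part′ x d = trans (cong (_+_ (+ D * a x)) (trans (sym (+-identityʳ _)) (cong (λ z → conv n a a x - z) (sym (conv-0 b-vanishes x))))) (real-part x d)
      -- As b = 0 and a² = ε, modulo 4 the convolution a * a may be replaced by ε * ε.
      mod4 : ∀ x → ¬ + n ∣ x → + 4 ∣ + D * a x + (+ n - + 2)
      mod4 x d = mod⇒∣ (mod-trans (mod-+ {x = + D * a x} {y = + D * a x} (≡⇒mod refl) (mod-sym (mod-trans (conv-trits-mod4 n a-periodic (proj₁ ∘ trits) x)
        (≡⇒mod (trans (conv-cong n sq≡ε sq≡ε x) (conv-ε-ε n x d)))))) (≡⇒mod (real-part′ x d)))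
      -- With a x - a 1 = 2z, subtracting two instances of `mod4` gives 4 ∣ 2Dz; D is odd and z is 0
      -- or ±1, so z = 0.
      constant : ∀ x → ¬ + n ∣ x → a x ≡ a 1ℤ
      constant x d with unit-difference (a-unit x d) (a-unit 1ℤ n∤1)
      ... | z , e , z0 , z-cases = z0 ([ (λ e → e) , (λ u → ⊥-elim (unit-∤2 u (2∣Dz⇒ z (*-cancelˡ-∣ (+ 2) {+ 2} {+ D * z}
          (∣-respʳ (trans (lemma (+ D) (a x) (a 1ℤ) (+ n - + 2)) (trans (cong (+ D *_) e) (lemma′ (+ D) z)))
            (∣m∣n⇒∣m+n (mod4 x d) (∣m⇒∣-m (mod4 1ℤ n∤1)))))))) ]′ z-cases)
        where
        lemma : ∀ D x y c → (D * x + c) + - (D * y + c) ≡ D * (x - y)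
        lemma = solve-∀
        lemma′ : ∀ D z → D * (+ 2 * z) ≡ + 2 * (D * z)
        lemma′ = solve-∀
      a≡ : ∀ x → a x ≡ a 1ℤ * ε n x
      a≡ x = go (+ n ∣? x)
        where
        go : Dec (+ n ∣ x) → a x ≡ a 1ℤ * ε n x
        go (yes d) = trans (proj₁ (diagonal x d)) (sym (trans (cong (a 1ℤ *_) (ε-∣ n d)) (*-zeroʳ (a 1ℤ))))
        go (no d)  = trans (constant x d) (sym (trans (cong (a 1ℤ *_) (ε-∤ n d)) (*-identityʳ (a 1ℤ))))
      -- Now a = ±ε exactly, so the congruence turns into an equation in ℤ, which fixes n.
      conv≡ : conv n a a 1ℤ ≡ + n - + 2
      conv≡ = begin
        conv n a a 1ℤ
          ≡⟨ conv-cong n a≡ a≡ 1ℤ ⟩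
        Σ n (λ k → a 1ℤ * ε n k * (a 1ℤ * ε n (1ℤ - k)))
          ≡⟨ Σ-cong n (λ k → lemma (a 1ℤ) (ε n k) (ε n (1ℤ - k))) ⟩
        Σ n (λ k → a 1ℤ * a 1ℤ * (ε n k * ε n (1ℤ - k)))
          ≡⟨ Σ-cong n (λ k → trans (cong (_* (ε n k * ε n (1ℤ - k))) (unit² (a-unit 1ℤ n∤1))) (*-identityˡ (ε n k * ε n (1ℤ - k)))) ⟩
        conv n (ε n) (ε n) 1ℤ
          ≡⟨ conv-ε-ε n 1ℤ n∤1 ⟩
        + n - + 2 ∎
        where
        lemma : ∀ c u v → c * u * (c * v) ≡ c * c * (u * v)
        lemma = solve-∀
      relation : + D * a 1ℤ + (+ n - + 2) ≡ 0ℤ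
      relation = trans (cong (_+_ (+ D * a 1ℤ)) (sym conv≡)) (real-part′ 1ℤ n∤1)
      conclude : IsUnit (a 1ℤ) → Conclusion n D a b
      -- Here D + n = 2, and n ≥ 2 leaves D = 0, which is even.
      conclude (inj₁ a1) = ⊥-elim (D-odd (subst (2 ℕ.∣_) (sym D≡0) (2 ℕ.∣0)))
        where
        lemma : ∀ D n → (D * 1ℤ + (n - + 2)) + + 2 ≡ D + n
        lemma = solve-∀
        D+n≡2 : D ℕ.+ n ≡ 2
        D+n≡2 = ℤP.+-injective (trans (sym (lemma (+ D) (+ n))) (cong (_+ + 2) (subst (λ z → + D * z + (+ n - + 2) ≡ 0ℤ) a1 relation)))
        D≡0 : D ≡ 0
        D≡0 = ℕ.n≤0⇒n≡0 (ℕ.+-cancelʳ-≤ 2 D 0 (ℕ.≤-trans (ℕ.+-monoʳ-≤ D 2≤n) (ℕ.≤-reflexive D+n≡2)))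
      conclude (inj₂ a1) = ℤP.+-injective (trans (lemma (+ D) (+ n)) (trans (cong (λ z → (+ 2 + + D) + z) (subst (λ z → + D * z + (+ n - + 2) ≡ 0ℤ) a1 relation))
          (+-identityʳ _))) , b-vanishes , inj₁ (λ x d → trans (constant x d) a1)
        where
        lemma : ∀ D n → n ≡ (+ 2 + D) + (D * -1ℤ + (n - + 2))
        lemma = solve-∀

    -- In this case the letter d stands for D / 4; the diagonal entry is 2d, later called `E`.
    module _ (d : ℕ) (D≡ : D ≡ 2 ℕ.* (2 ℕ.* d)) where

      private
        -- The residue of (a * a - b * b)(x) modulo 4. Replace a and b by their squares and put b² =
        -- ε - a²: the terms a² * a² cancel, and 2 ε * a² - ε * ε is left.
        ψ : ℤ → ℤ
        ψ x = + 2 * Σ n (sq a) - + 2 * sq a x - (+ n - + 2)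

        sq-periodic : Periodic n (sq a)
        sq-periodic y = cong₂ _*_ (a-periodic y) (a-periodic y)

        sq-b : ∀ x → sq b x ≡ ε n x + -1ℤ * sq a x
        sq-b x = go (+ n ∣? x)
          where
          off : (IsUnit (a x) × b x ≡ 0ℤ) ⊎ (a x ≡ 0ℤ × IsUnit (b x)) → b x * b x ≡ 1ℤ + -1ℤ * (a x * a x)
          off (inj₁ (ua , b0)) = trans (cong (λ z → z * z) b0) (sym (cong (λ z → 1ℤ + -1ℤ * z) (unit² ua)))
          off (inj₂ (a0 , ub)) = trans (unit² ub) (sym (cong (λ z → 1ℤ + -1ℤ * (z * z)) a0))
          go : Dec (+ n ∣ x) → sq b x ≡ ε n x + -1ℤ * sq a x
          go (yes d) = trans (cong (λ z → z * z) (proj₂ (diagonal x d)))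
            (sym (cong₂ (λ y z → y + -1ℤ * (z * z)) (ε-∣ n d) (proj₁ (diagonal x d))))
          go (no d) = trans (off (units x d)) (cong (_+ -1ℤ * sq a x) (sym (ε-∤ n d)))

        conv-sq-b : ∀ x → ¬ + n ∣ x → conv n (sq b) (sq b) x ≡ ((+ n - + 2) + - + 2 * (Σ n (sq a) - sq a x)) + conv n (sq a) (sq a) x
        conv-sq-b x n∤x = trans (conv-cong n sq-b sq-b x) (trans (conv-binomial n (ε-periodic n) sq-periodic -1ℤ x)
          (cong₂ _+_ (cong₂ (λ y z → y + - + 2 * z) (conv-ε-ε n x n∤x) (conv-ε n sq-periodic x)) (*-identityˡ _)))

        -- D a(x) is a multiple of 4, so by the real equation (a * a - b * b)(x) is one too.
        4∣ψ : ∀ x → ¬ + n ∣ x → + 4 ∣ ψ x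
        4∣ψ x n∤x = mod⇒∣ (mod-trans (mod-sym difference≡) (∣⇒mod 4∣difference))
          where
          difference≡ : conv n a a x + -1ℤ * conv n b b x ≡ ψ x [ 4 ]
          difference≡ = mod-trans (mod-+ (conv-trits-mod4 n a-periodic (proj₁ ∘ trits) x)
              (mod-*ʳ -1ℤ (conv-trits-mod4 n b-periodic (proj₂ ∘ trits) x)))
            (≡⇒mod (trans (cong (λ z → conv n (sq a) (sq a) x + -1ℤ * z) (conv-sq-b x n∤x))
              (lemma (conv n (sq a) (sq a) x) (+ n - + 2) (Σ n (sq a)) (sq a x))))
            where
            lemma : ∀ T c s t → T + -1ℤ * ((c + - + 2 * (s - t)) + T) ≡ + 2 * s - + 2 * t - c
            lemma = solve-∀
          4∣difference : + 4 ∣ conv n a a x + -1ℤ * conv n b b x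
          4∣difference = divides (- (+ d * a x)) (begin
            conv n a a x + -1ℤ * conv n b b x
              ≡⟨ lemma (conv n a a x) (conv n b b x) (+ D * a x) ⟩
            - (+ D * a x) + (+ D * a x + (conv n a a x - conv n b b x))
              ≡⟨ cong₂ (λ y z → - (y * a x) + z) (trans (cong +_ D≡) (trans (pos-* 2 (2 ℕ.* d)) (cong (+ 2 *_) (pos-* 2 d)))) (real-part x n∤x) ⟩
            - (+ 2 * (+ 2 * + d) * a x) + 0ℤ
              ≡⟨ lemma′ (+ d) (a x) ⟩
            - (+ d * a x) * + 4 ∎)
            where
            lemma : ∀ p q r → p + -1ℤ * q ≡ - r + (r + (p - q))
            lemma = solve-∀
            lemma′ : ∀ d y → - (+ 2 * (+ 2 * d) * y) + 0ℤ ≡ - (d * y) * + 4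
            lemma′ = solve-∀

        -- Every summand of ψ 1 other than n is even.
        2∣n : + 2 ∣ + n
        2∣n = ∣-respʳ (lemma (Σ n (sq a)) (sq a 1ℤ) (+ n)) (∣m∣n⇒∣m+n (∣m⇒∣-m (∣-trans (divides (+ 2) refl) (4∣ψ 1ℤ n∤1)))
          (divides (Σ n (sq a) - sq a 1ℤ + 1ℤ) refl))
          where
          lemma : ∀ s t n → - (+ 2 * s - + 2 * t - (n - + 2)) + (s - t + 1ℤ) * + 2 ≡ n
          lemma = solve-∀

        sq-trit : ∀ {x} → Trit x → sq (λ y → y) x ≡ 0ℤ ⊎ sq (λ y → y) x ≡ 1ℤ
        sq-trit (inj₁ refl) = inj₁ refl
        sq-trit (inj₂ u)    = inj₂ (unit² u)

        half-case : ∀ k → n ≡ 2 ℕ.* suc k → Conclusion n D a b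
        half-case k refl = result
          where
          h = suc k
          n∤h : ¬ + n ∣ + h
          n∤h = <⇒∤ (s≤s z≤n) (ℕ.m<m+n h (s≤s z≤n))
          sq-h : sq a (+ h) ≡ 1ℤ
          sq-h = [ (unit² ∘ proj₁) , (λ (_ , u) → ⊥-elim (unit-∤2 u (∣-respʳ (sym b-h) (∣0 (+ 2))))) ]′ (units (+ h) n∤h)
            where
            self-negative : ∀ x → x ≡ - x → x ≡ 0ℤ
            self-negative (+ zero)  _ = refl
            self-negative (+ suc _) ()
            self-negative -[1+ _ ]  ()
            lemma : ∀ h → h - - h ≡ 1ℤ * (+ 2 * h)
            lemma = solve-∀
            b-h : b (+ h) ≡ 0ℤ
            b-h = self-negative (b (+ h)) (trans (periodic-≡ b-periodic (divides 1ℤ (trans (lemma (+ h)) (cong (1ℤ *_) (sym (pos-* 2 h)))))) (b-odd (+ h)))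
          -- ψ x - ψ h is twice the difference of the squares at h and at x. That difference is
          -- therefore even, and the square at h is 1.
          sq≡1 : ∀ x → ¬ + n ∣ x → sq a x ≡ 1ℤ
          sq≡1 x n∤x = [ (λ e → ⊥-elim (no-zero e)) , (λ e → e) ]′ (sq-trit (proj₁ (trits x)))
            where
            lemma : ∀ s t u c → (+ 2 * s - + 2 * t - c) + - (+ 2 * s - + 2 * u - c) ≡ + 2 * (u - t)
            lemma = solve-∀
            2∣ : + 2 ∣ sq a (+ h) - sq a x
            2∣ = *-cancelˡ-∣ (+ 2) {+ 2} {sq a (+ h) - sq a x} (∣-respʳ (lemma (Σ n (sq a)) (sq a x) (sq a (+ h)) (+ n - + 2))
              (∣m∣n⇒∣m+n (4∣ψ x n∤x) (∣m⇒∣-m (4∣ψ (+ h) n∤h))))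
            no-zero : sq a x ≢ 0ℤ
            no-zero e = unit-∤2 (inj₁ refl) (∣-respʳ (cong₂ _-_ sq-h e) 2∣)
          not-zero : ∀ x → ¬ + n ∣ x → a x ≢ 0ℤ
          not-zero x n∤x e = 1≢0 (trans (sym (sq≡1 x n∤x)) (cong (λ z → z * z) e))
            where
            1≢0 : 1ℤ ≢ 0ℤ
            1≢0 ()
          a-unit : ∀ x → ¬ + n ∣ x → IsUnit (a x)
          a-unit x n∤x = [ proj₁ , (λ (a0 , _) → ⊥-elim (not-zero x n∤x a0)) ]′ (units x n∤x)
          b-vanishes : ∀ x → b x ≡ 0ℤ
          b-vanishes x = go (+ n ∣? x)
            where
            go : Dec (+ n ∣ x) → b x ≡ 0ℤ
            go (yes d)  = proj₂ (diagonal x d)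
            go (no n∤x) = [ proj₂ , (λ (a0 , _) → ⊥-elim (not-zero x n∤x a0)) ]′ (units x n∤x)
          Σ-sq : Σ n (sq a) ≡ + n - 1ℤ
          Σ-sq = trans (Σ-ones-off-0 n (λ i 0<i i<n → sq≡1 (+ i) (<⇒∤ 0<i i<n)))
            (trans (cong (λ z → (z * z - 1ℤ) + + n) (proj₁ (diagonal 0ℤ (∣0 (+ n))))) (lemma (+ n)))
            where
            lemma : ∀ n → (0ℤ - 1ℤ) + n ≡ n - 1ℤ
            lemma = solve-∀
          -- Once Σ a² = n - 1 is known, ψ 1 = n - 2 = 2 (h - 1), a multiple of 4.
          h-odd : ¬ 2 ℕ.∣ h
          h-odd 2∣h = unit-∤2 (inj₁ refl) (∣-respʳ (lemma (+ h)) (∣m∣n⇒∣m+n (∣ᵤ⇒∣ {+ 2} {+ h} 2∣h) (∣m⇒∣-m 2∣h-1)))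
            where
            lemma : ∀ h → h + - (h - 1ℤ) ≡ 1ℤ
            lemma = solve-∀
            lemma′ : ∀ h → + 2 * (+ 2 * h - 1ℤ) - + 2 * 1ℤ - (+ 2 * h - + 2) ≡ + 2 * (h - 1ℤ)
            lemma′ = solve-∀
            2∣h-1 : + 2 ∣ + h - 1ℤ
            2∣h-1 = *-cancelˡ-∣ (+ 2) {+ 2} {+ h - 1ℤ} (∣-respʳ (trans
              (cong₂ (λ s t → + 2 * s - + 2 * t - (+ n - + 2)) Σ-sq (sq≡1 1ℤ n∤1))
              (trans (cong (λ z → + 2 * (z - 1ℤ) - + 2 * 1ℤ - (z - + 2)) (pos-* 2 h)) (lemma′ (+ h)))) (4∣ψ 1ℤ n∤1))
          -- The diagonal is put back into a. Off 0, f * f = a * a + 2E a, and this is the left side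
          -- of the real equation, as D = 2E and b = 0.
          E = 2 ℕ.* d
          f : ℤ → ℤ
          f x = a x + + E * δ n x
          f-off : ∀ x → ¬ + n ∣ x → f x ≡ a x
          f-off x n∤x = trans (cong (λ z → a x + + E * z) (δ-∤ n∤x)) (lemma (a x) (+ E))
            where
            lemma : ∀ x e → x + e * 0ℤ ≡ x
            lemma = solve-∀
          profile : Profile h E f
          profile = record
            { periodic = λ x → cong₂ (λ y z → y + + E * z) (a-periodic x) (δ-periodic n x)
            ; at-0 = trans (cong₂ (λ y z → y + + E * z) (proj₁ (diagonal 0ℤ (∣0 (+ n)))) (δ0 n)) (lemma₀ (+ E))
            ; unit = λ x n∤x → subst IsUnit (sym (f-off x n∤x)) (a-unit x n∤x)
            ; even = λ x → cong₂ (λ y z → y + + E * z) (a-even x) (δ-cong ∣-neg⁻ ∣m⇒∣-m)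
            ; orth = λ x n∤x → begin
                conv n f f x
                  ≡⟨ conv-binomial n a-periodic (δ-periodic n) (+ E) x ⟩
                (conv n a a x + (+ 2 * + E) * conv n a (δ n) x) + (+ E * + E) * conv n (δ n) (δ n) x
                  ≡⟨ cong₂ (λ y z → (conv n a a x + (+ 2 * + E) * y) + (+ E * + E) * z) (conv-δ n a-periodic x)
                       (trans (conv-δ n (δ-periodic n) x) (δ-∤ n∤x)) ⟩
                (conv n a a x + (+ 2 * + E) * a x) + (+ E * + E) * 0ℤ
                  ≡⟨ lemma₁ (conv n a a x) (+ E) (a x) ⟩
                (+ 2 * + E) * a x + (conv n a a x - 0ℤ)
                  ≡⟨ cong₂ (λ y z → y * a x + (conv n a a x - z)) (sym (trans (cong +_ D≡) (pos-* 2 E))) (sym (conv-0 b-vanishes x)) ⟩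
                + D * a x + (conv n a a x - conv n b b x)
                  ≡⟨ real-part x n∤x ⟩
                0ℤ ∎
            }
            where
            lemma₀ : ∀ e → 0ℤ + e * 1ℤ ≡ e
            lemma₀ = solve-∀
            lemma₁ : ∀ p e y → (p + (+ 2 * e) * y) + (e * e) * 0ℤ ≡ (+ 2 * e) * y + (p - 0ℤ)
            lemma₁ = solve-∀
          result : Conclusion n D a b
          result = let E≡k , signs = real-classification h-odd profile in
            trans (cong (λ z → 2 ℕ.* suc z) (sym E≡k)) (trans (ℕ.*-suc 2 E) (cong (2 ℕ.+_) (sym D≡))) ,
            b-vanishes ,
            [ (λ s → inj₁ (λ x n∤x → trans (sym (f-off x n∤x)) (s x n∤x))) ,
              (λ s → inj₂ (ℕ.divides E (trans D≡ (ℕ.*-comm 2 E)) , (λ x n∤x → trans (cong (sgn x *_) (sym (f-off x n∤x))) (s x n∤x)))) ]′ signs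

      even-case : Conclusion n D a b
      even-case = go (∣⇒∣ᵤ 2∣n)
        where
        go : 2 ℕ.∣ n → Conclusion n D a b
        go (ℕ.divides zero    e) = ⊥-elim (ℕ.<⇒≱ 2≤n (subst (ℕ._≤ 1) (sym e) z≤n))
        go (ℕ.divides (suc k) e) = half-case k (trans e (ℕ.*-comm (suc k) 2))

    classification : (∀ j → D ≢ 2 ℕ.* suc (2 ℕ.* j)) → Conclusion n D a b
    classification D≢ = go (halve D)
      where
      halve : ∀ m → (∃[ q ] m ≡ 2 ℕ.* q) ⊎ (¬ 2 ℕ.∣ m × ∃[ q ] m ≡ suc (2 ℕ.* q))
      halve zero    = inj₁ (0 , refl)
      halve (suc m) = [ (λ (q , e) → inj₂ (odd q e , q , cong suc e)) ,
                        (λ (_ , q , e) → inj₁ (suc q , trans (cong suc e) (sym (ℕ.*-suc 2 q)))) ]′ (halve m)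
        where
        odd : ∀ q → m ≡ 2 ℕ.* q → ¬ 2 ℕ.∣ suc m
        odd q e d with ℕ.∣1⇒≡1 (ℕ.∣m+n∣m⇒∣n (subst (2 ℕ.∣_) (ℕ.+-comm 1 m) d) (ℕ.divides q (trans e (ℕ.*-comm 2 q))))
        ... | ()
      go : (∃[ q ] D ≡ 2 ℕ.* q) ⊎ (¬ 2 ℕ.∣ D × ∃[ q ] D ≡ suc (2 ℕ.* q)) → Conclusion n D a b
      go (inj₂ (D-odd , _)) = odd-case D-odd
      go (inj₁ (q , e)) = [ (λ (d , e′) → even-case d (trans e (cong (2 ℕ.*_) e′))) ,
                            (λ (_ , j , e′) → ⊥-elim (D≢ j (trans e (cong (2 ℕ.*_) e′)))) ]′ (halve q)

-- Arithmetic of Cauchy reals and the integers among them.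

module CauchyReals where

  open import Defs hiding (i; quotient)
  open import Data.Integer.Base as ℤ using (ℤ; +_; -[1+_]; 0ℤ; -1ℤ)
  open import Data.Integer.Tactic.RingSolver using (solve-∀)
  import Data.Integer.Properties as ℤ
  open import Data.Nat.Base as ℕ using (ℕ; zero; suc; s≤s; z≤n)
  import Data.Nat.Properties as ℕ
  open import Data.Product.Base using (∃-syntax; _,_; proj₁; proj₂)
  open import Data.Rational.Base as ℚ using (ℚ; 0ℚ; 1ℚ; ½; ∣_∣; _+_; _-_; _*_; -_; _<_; _≤_; *≤*)
  import Data.Rational.Literals as Literals
  import Data.Rational.Properties as ℚ
  open import Data.Rational.Solver using (module +-*-Solver)
  open import Relation.Binary.PropositionalEquality
  open import Algebra.Properties.Group ℚ.+-0-group using () renaming (∙-cancelˡ to +-cancelˡ-ℚ)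
  open +-*-Solver

  ι : ℤ → ℚ
  ι k = k ℚ./ 1

  -- `k / 1` is normalised through a gcd and does not reduce for a variable k; the literal is its
  -- explicit normal form, on which sums and products compute.
  ι-literal : ∀ k → ι k ≡ Literals.fromℤ k
  ι-literal k = ℚ.↥p/↧p≡p (Literals.fromℤ k)

  ι-+ : ∀ j k → ι (j ℤ.+ k) ≡ ι j + ι k
  ι-+ j k = sym (trans (cong₂ _+_ (ι-literal j) (ι-literal k)) (cong ι (lemma j k)))
    where
    lemma : ∀ j k → j ℤ.* + 1 ℤ.+ k ℤ.* + 1 ≡ j ℤ.+ k
    lemma = solve-∀

  ι-* : ∀ j k → ι (j ℤ.* k) ≡ ι j * ι k
  ι-* j k = sym (cong₂ _*_ (ι-literal j) (ι-literal k))

  ι-neg : ∀ k → ι (ℤ.- k) ≡ - ι k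
  ι-neg k = +-cancelˡ-ℚ (ι k) (ι (ℤ.- k)) (- ι k) (trans (sym (ι-+ k (ℤ.- k))) (trans (cong ι (ℤ.+-inverseʳ k)) (sym (ℚ.+-inverseʳ (ι k)))))

  ι-<1 : ∀ k → ∣ ι k ∣ < 1ℚ → k ≡ 0ℤ
  ι-<1 k lt = go k (ℚ.drop-*<* (subst (λ q → ∣ q ∣ < 1ℚ) (ι-literal k) lt))
    where
    go : ∀ k → ℚ.↥ ∣ Literals.fromℤ k ∣ ℤ.* + 1 ℤ.< + 1 → k ≡ 0ℤ
    go (+ zero)  _ = refl
    go (+ suc n) (ℤ.+<+ (s≤s ()))
    go -[1+ n ]  (ℤ.+<+ (s≤s ()))

  infix 4 _≅_

  -- Unlike x ≃ y, the type x ≅ y determines x and y, so that these can be left implicit.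
  record _≅_ (x y : ℝ) : Set where
    constructor near
    field distance : x ≃ y

  open _≅_ public

  pointwise : ∀ {x y} → (∀ n → seq x n ≡ seq y n) → x ≅ y
  pointwise {x} {y} eq = near λ ε 0<ε → 0 , λ n _ → subst (_< ε) (sym (cong ∣_∣ (trans (cong (_- seq y n) (eq n)) (ℚ.+-inverseʳ (seq y n))))) 0<ε

  ≅-refl : ∀ {x} → x ≅ x
  ≅-refl = pointwise λ _ → refl

  ≅-reflexive : ∀ {x y} → x ≡ y → x ≅ y
  ≅-reflexive refl = ≅-refl

  ∣-∣-sym : ∀ p q → ∣ p - q ∣ ≡ ∣ q - p ∣
  ∣-∣-sym p q = trans (cong ∣_∣ (lemma p q)) (ℚ.∣-p∣≡∣p∣ (q - p))
    where
    lemma : ∀ p q → p - q ≡ - (q - p)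
    lemma = solve 2 (λ p q → p :- q := :- (q :- p)) refl

  ≅-sym : ∀ {x y} → x ≅ y → y ≅ x
  ≅-sym {x} {y} (near e) = near λ ε 0<ε → let N , p = e ε 0<ε in
    N , λ n l → subst (_< ε) (∣-∣-sym (seq x n) (seq y n)) (p n l)

  within : ∀ {p q r : ℚ} ε → p ≡ q + r → ∣ q ∣ < ½ * ε → ∣ r ∣ < ½ * ε → ∣ p ∣ < ε
  within {p} {q} {r} ε e q<ε r<ε = subst₂ _<_ (cong ∣_∣ (sym e)) (½*+½* ε)
    (ℚ.≤-<-trans (ℚ.∣p+q∣≤∣p∣+∣q∣ q r) (ℚ.+-mono-< q<ε r<ε))

  ≅-trans : ∀ {x y z} → x ≅ y → y ≅ z → x ≅ z
  ≅-trans {x} {y} {z} (near e) (near e′) = near λ ε 0<ε →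
    let M , p = e (½ * ε) (½*-pos 0<ε) ; N , q = e′ (½ * ε) (½*-pos 0<ε) in
    M ℕ.⊔ N , λ n l → within ε (lemma (seq x n) (seq y n) (seq z n)) (p n (ℕ.m⊔n≤o⇒m≤o M N l)) (q n (ℕ.m⊔n≤o⇒n≤o M N l))
    where
    lemma : ∀ p q r → p - r ≡ (p - q) + (q - r)
    lemma = solve 3 (λ p q r → p :- r := (p :- q) :+ (q :- r)) refl

  +-cong : ∀ {x x′ y y′} → x ≅ x′ → y ≅ y′ → x +ᴿ y ≅ x′ +ᴿ y′
  +-cong {x} {x′} {y} {y′} (near e) (near e′) = near λ ε 0<ε →
    let M , p = e (½ * ε) (½*-pos 0<ε) ; N , q = e′ (½ * ε) (½*-pos 0<ε) in
    M ℕ.⊔ N , λ n l → within ε (lemma (seq x n) (seq x′ n) (seq y n) (seq y′ n)) (p n (ℕ.m⊔n≤o⇒m≤o M N l)) (q n (ℕ.m⊔n≤o⇒n≤o M N l))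
    where
    lemma : ∀ p p′ q q′ → (p + q) - (p′ + q′) ≡ (p - p′) + (q - q′)
    lemma = solve 4 (λ p p′ q q′ → (p :+ q) :- (p′ :+ q′) := (p :- p′) :+ (q :- q′)) refl

  -‿cong : ∀ {x y} → x ≅ y → -ᴿ x ≅ -ᴿ y
  -‿cong {x} {y} (near e) = near λ ε 0<ε → let N , p = e ε 0<ε in
    N , λ n l → subst (_< ε) (trans (∣-∣-sym (seq x n) (seq y n)) (cong ∣_∣ (lemma (seq x n) (seq y n)))) (p n l)
    where
    lemma : ∀ p q → q - p ≡ (- p) - (- q)
    lemma = solve 2 (λ p q → q :- p := (:- p) :- (:- q)) refl

  *-cong : ∀ {x x′ y y′} → x ≅ x′ → y ≅ y′ → x *ᴿ y ≅ x′ *ᴿ y′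
  *-cong {x} {x′} {y} {y′} (near e) (near e′) = near λ ε 0<ε →
    let A , 0<A , K , x≤A = eventually-bounded {seq x} (cauchy x)
        B , 0<B , L , y′≤B = eventually-bounded {seq y′} (cauchy y′)
        α , 0<α , Aα = Defs.quotient {A} {½ * ε} 0<A (½*-pos 0<ε)
        β , 0<β , Bβ = Defs.quotient {B} {½ * ε} 0<B (½*-pos 0<ε)
        M , p = e′ α 0<α
        N , q = e β 0<β
        P = K ℕ.⊔ L
        Q = M ℕ.⊔ N
    in P ℕ.⊔ Q , λ n l →
      let P≤n = ℕ.m⊔n≤o⇒m≤o P Q l
          Q≤n = ℕ.m⊔n≤o⇒n≤o P Q l
      in *-close (seq x n) (seq y n) (seq x′ n) (seq y′ n) A B α β ε 0<A 0<B Aα Bβ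
           (x≤A n (ℕ.m⊔n≤o⇒m≤o K L P≤n)) (y′≤B n (ℕ.m⊔n≤o⇒n≤o K L P≤n))
           (p n (ℕ.m⊔n≤o⇒m≤o M N Q≤n)) (q n (ℕ.m⊔n≤o⇒n≤o M N Q≤n))

  -- Both sequences are constant, so ε = 1 suffices: integers at distance less than 1 coincide.
  fromℤ-injective : ∀ {j k} → fromℤ j ≅ fromℤ k → j ≡ k
  fromℤ-injective {j} {k} (near e) = let N , p = e 1ℚ 0<1 in
    ℤ.i-j≡0⇒i≡j j k (ι-<1 (j ℤ.- k) (subst (λ q → ∣ q ∣ < 1ℚ) (sym (trans (ι-+ j (ℤ.- k)) (cong (_+_ (ι j)) (ι-neg k)))) (p N ℕ.≤-refl)))

  -- If fromℤ k ≅ 2x with 0 ≤ x and k ≤ -1, then for large n both x n ≥ -1/4 and 2 · x n < k + 1/2 ≤ -1/2.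
  double-nonneg : ∀ {x} k → fromℕ 0 ≤ᴿ x → fromℕ 2 *ᴿ x ≅ fromℤ k → ∃[ m ] k ≡ + m
  double-nonneg (+ m) _ _ = m , refl
  double-nonneg {x} -[1+ m ] x≥0 (near e) = contradiction
    where
    open import Relation.Nullary.Decidable using (from-yes)
    open import Data.Empty using (⊥-elim)
    ¼ = ½ * ½
    M = proj₁ (x≥0 ¼ (from-yes (0ℚ ℚ.<? ¼)))
    N = proj₁ (e ½ (from-yes (0ℚ ℚ.<? ½)))
    n = M ℕ.⊔ N
    y = seq x n
    lower : 0ℚ ≤ y + ¼
    lower = proj₂ (x≥0 ¼ (from-yes (0ℚ ℚ.<? ¼))) n (ℕ.m≤m⊔n M N)
    near-k : ∣ ι (+ 2) * y - ι -[1+ m ] ∣ < ½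
    near-k = proj₂ (e ½ (from-yes (0ℚ ℚ.<? ½))) n (ℕ.m≤n⊔m M N)
    k≤-1 : ι -[1+ m ] ≤ ι -1ℤ
    k≤-1 = subst₂ _≤_ (sym (ι-literal -[1+ m ])) (sym (ι-literal -1ℤ)) (*≤* (subst₂ ℤ._≤_ (sym (ℤ.*-identityʳ -[1+ m ])) (sym (ℤ.*-identityʳ -1ℤ)) (ℤ.-≤- z≤n)))
    bound : ½ ≤ ι (+ 2) * y - ι -[1+ m ]
    bound = subst₂ _≤_ (lemma₀ y) (lemma₁ y (ι -[1+ m ])) (ℚ.+-mono-≤ (ℚ.+-mono-≤ lower lower) (ℚ.+-monoʳ-≤ (½ - ι -[1+ m ]) k≤-1))
      where
      lemma₀ : ∀ y → (0ℚ + 0ℚ) + ((½ - ι -[1+ m ]) + ι -[1+ m ]) ≡ ½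
      lemma₀ y = solve 1 (λ k → (con 0ℚ :+ con 0ℚ) :+ ((con ½ :- k) :+ k) := con ½) refl (ι -[1+ m ])
      lemma₁ : ∀ y k → ((y + ¼) + (y + ¼)) + ((½ - k) + ι -1ℤ) ≡ ι (+ 2) * y - k
      lemma₁ = solve 2 (λ y k → ((y :+ con ¼) :+ (y :+ con ¼)) :+ ((con ½ :- k) :+ con (ι -1ℤ)) := con (ι (+ 2)) :* y :- k) refl
    contradiction : ∃[ m′ ] -[1+ m ] ≡ + m′
    contradiction = ⊥-elim (ℚ.<-irrefl refl (ℚ.<-≤-trans near-k
      (subst (½ ≤_) (sym (ℚ.0≤p⇒∣p∣≡p (ℚ.≤-trans (from-yes (0ℚ ℚ.≤? ½)) bound))) bound)))

-- From the matrix equation to integer convolutions.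

module Circulants where

  open PeriodicSums
  open RealCase using (IsUnit; from-representatives; %ℕ-difference; conv-periodic; unit²)
  open ModFour using (Solution)
  open CauchyReals
  open import Defs hiding (i; quotient)
  open import Data.Empty using (⊥-elim)
  open import Data.Fin.Base using (Fin; zero; suc; toℕ; fromℕ<)
  open import Data.Fin.Properties using (toℕ-injective; toℕ-fromℕ<; toℕ<n)
  open import Data.Integer.Base as ℤ using (ℤ; +_; 0ℤ; 1ℤ; -1ℤ; _%ℕ_)
  open import Data.Integer.DivMod using (n%ℕd<d)
  open import Data.Integer.Divisibility.Signed using (_∣_; divides; _∣?_; ∣m∣n⇒∣m+n; ∣m⇒∣-m)
  open import Data.Integer.Tactic.RingSolver using (solve-∀)
  import Data.Integer.Properties as ℤ
  open import Data.Nat.Base as ℕ using (ℕ; zero; suc; NonZero; s≤s; z≤n)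
  open import Data.Nat.DivMod using (m<n⇒m%n≡m)
  import Data.Nat.Properties as ℕ
  open import Data.Product.Base using (∃-syntax; _×_; _,_; proj₁; proj₂)
  open import Data.Rational.Base as ℚ using (ℚ; 0ℚ; 1ℚ; ½; _+_; _-_; _*_; -_)
  import Data.Rational.Properties as ℚ
  open import Data.Rational.Solver using (module +-*-Solver)
  open import Data.Sum.Base using (_⊎_; inj₁; inj₂; [_,_]′)
  open import Relation.Binary.Definitions using (tri<; tri≈; tri>)
  open import Relation.Binary.PropositionalEquality hiding ([_])
  open import Relation.Nullary using (¬_; Dec; yes; no)
  open +-*-Solver

  remainder-unique : ∀ n {j k} → j ℕ.< n → k ℕ.< n → + n ∣ + j ℤ.- + k → j ≡ k
  remainder-unique n {j} {k} j<n k<n d with ℕ.<-cmp j k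
  ... | tri≈ _ e _ = e
  ... | tri< j<k _ _ = ⊥-elim (no-multiple j k j<k k<n (∣-respʳ (lemma (+ j) (+ k)) (∣m⇒∣-m d)))
    where
    lemma : ∀ j k → ℤ.- (j ℤ.- k) ≡ k ℤ.- j
    lemma = solve-∀
    no-multiple : ∀ j k → j ℕ.< k → k ℕ.< n → ¬ + n ∣ + k ℤ.- + j
    no-multiple j k j<k k<n p = <⇒∤ (ℕ.m<n⇒0<n∸m j<k) (ℕ.≤-<-trans (ℕ.m∸n≤m k j) k<n)
      (∣-respʳ (trans (ℤ.m-n≡m⊖n k j) (ℤ.⊖-≥ (ℕ.<⇒≤ j<k))) p)
  ... | tri> _ _ k<j = ⊥-elim (<⇒∤ (ℕ.m<n⇒0<n∸m k<j) (ℕ.≤-<-trans (ℕ.m∸n≤m j k) j<n)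
      (∣-respʳ (trans (ℤ.m-n≡m⊖n j k) (ℤ.⊖-≥ (ℕ.<⇒≤ k<j))) d))

  module _ (n : ℕ) .{{_ : NonZero n}} where

    -- The same term as in `circ`, so that `circ c r s` is by definition c at the index of s - r.
    index : ℤ → Fin n
    index x = fromℕ< (n%ℕd<d x n)

    toℕ-index : ∀ x → toℕ (index x) ≡ x %ℕ n
    toℕ-index x = toℕ-fromℕ< (n%ℕd<d x n)

    index-difference : ∀ x → + n ∣ x ℤ.- + toℕ (index x)
    index-difference x = subst (λ r → + n ∣ x ℤ.- + r) (sym (toℕ-index x)) (%ℕ-difference n x)

    index-cong : ∀ {x y} → + n ∣ x ℤ.- y → index x ≡ index y
    index-cong {x} {y} d = toℕ-injective (remainder-unique n (toℕ<n (index x)) (toℕ<n (index y))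
      (∣-respʳ (lemma x y (+ toℕ (index x)) (+ toℕ (index y)))
        (∣m∣n⇒∣m+n (∣m∣n⇒∣m+n (∣m⇒∣-m (index-difference x)) d) (index-difference y))))
      where
      lemma : ∀ x y r s → (ℤ.- (x ℤ.- r) ℤ.+ (x ℤ.- y)) ℤ.+ (y ℤ.- s) ≡ r ℤ.- s
      lemma = solve-∀

    index-toℕ : ∀ j → index (+ toℕ j) ≡ j
    index-toℕ j = toℕ-injective (trans (toℕ-index (+ toℕ j)) (m<n⇒m%n≡m (toℕ<n j)))

    index-periodic : ∀ x → index (x ℤ.+ + n) ≡ index x
    index-periodic x = index-cong {x ℤ.+ + n} {x} (divides 1ℤ (lemma x (+ n)))
      where
      lemma : ∀ x n → x ℤ.+ n ℤ.- x ≡ 1ℤ ℤ.* n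
      lemma = solve-∀

    index-∣ : ∀ {x} → + n ∣ x → toℕ (index x) ≡ 0
    index-∣ {x} d = remainder-unique n (toℕ<n (index x)) (ℕ.≤-<-trans z≤n (toℕ<n (index x)))
      (∣-respʳ (lemma x (+ toℕ (index x))) (∣m∣n⇒∣m+n d (∣m⇒∣-m (index-difference x))))
      where
      lemma : ∀ x r → x ℤ.+ ℤ.- (x ℤ.- r) ≡ r ℤ.- + 0
      lemma = solve-∀

    index-∤ : ∀ {x} → ¬ + n ∣ x → toℕ (index x) ≢ 0
    index-∤ {x} n∤x e = n∤x (∣-respʳ (trans (cong (λ r → x ℤ.- + r) e) (ℤ.+-identityʳ x)) (index-difference x))

  module Quadratic (d : ℝ) where

    lin : ℤ → ℤ → ℝ
    lin u v = fromℤ u +ᴿ fromℤ v *ᴿ d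

    -- An entry is linear in d, a product of two entries quadratic. With d an unknown real, only the
    -- integer coefficients are summed.
    quad : ℤ → ℤ → ℤ → ℝ
    quad u v w = fromℤ u +ᴿ fromℤ v *ᴿ d +ᴿ fromℤ w *ᴿ (d *ᴿ d)

    quad-+ : ∀ u v w u′ v′ w′ → quad u v w +ᴿ quad u′ v′ w′ ≅ quad (u ℤ.+ u′) (v ℤ.+ v′) (w ℤ.+ w′)
    quad-+ u v w u′ v′ w′ = pointwise λ k → let q = seq d k in trans (lemma (ι u) (ι v) (ι w) (ι u′) (ι v′) (ι w′) q)
      (sym (cong₂ _+_ (cong₂ (λ y z → y + z * q) (ι-+ u u′) (ι-+ v v′)) (cong (_* (q * q)) (ι-+ w w′))))
      where
      lemma : ∀ u v w u′ v′ w′ q → (u + v * q + w * (q * q)) + (u′ + v′ * q + w′ * (q * q)) ≡ (u + u′) + (v + v′) * q + (w + w′) * (q * q)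
      lemma = solve 7 (λ u v w u′ v′ w′ q → (u :+ v :* q :+ w :* (q :* q)) :+ (u′ :+ v′ :* q :+ w′ :* (q :* q)) := (u :+ u′) :+ (v :+ v′) :* q :+ (w :+ w′) :* (q :* q)) refl

    re-product : ∀ a α b a′ α′ b′ →
      lin a α *ᴿ lin a′ α′ -ᴿ fromℤ b *ᴿ fromℤ b′ ≅ quad (a ℤ.* a′ ℤ.- b ℤ.* b′) (a ℤ.* α′ ℤ.+ α ℤ.* a′) (α ℤ.* α′)
    re-product a α b a′ α′ b′ = pointwise λ k → let q = seq d k in trans (lemma (ι a) (ι α) (ι b) (ι a′) (ι α′) (ι b′) q)
      (sym (cong₂ _+_ (cong₂ (λ y z → y + z * q)
          (trans (ι-+ (a ℤ.* a′) (ℤ.- (b ℤ.* b′))) (cong₂ _+_ (ι-* a a′) (trans (ι-neg (b ℤ.* b′)) (cong -_ (ι-* b b′)))))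
          (trans (ι-+ (a ℤ.* α′) (α ℤ.* a′)) (cong₂ _+_ (ι-* a α′) (ι-* α a′))))
        (cong (_* (q * q)) (ι-* α α′))))
      where
      lemma : ∀ a α b a′ α′ b′ q → (a + α * q) * (a′ + α′ * q) - b * b′ ≡ (a * a′ - b * b′) + (a * α′ + α * a′) * q + (α * α′) * (q * q)
      lemma = solve 7 (λ a α b a′ α′ b′ q → (a :+ α :* q) :* (a′ :+ α′ :* q) :- b :* b′ := (a :* a′ :- b :* b′) :+ (a :* α′ :+ α :* a′) :* q :+ (α :* α′) :* (q :* q)) refl

    im-product : ∀ a α b a′ α′ b′ →
      lin a α *ᴿ fromℤ b′ +ᴿ fromℤ b *ᴿ lin a′ α′ ≅ quad (a ℤ.* b′ ℤ.+ b ℤ.* a′) (α ℤ.* b′ ℤ.+ b ℤ.* α′) 0ℤ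
    im-product a α b a′ α′ b′ = pointwise λ k → let q = seq d k in trans (lemma (ι a) (ι α) (ι b) (ι a′) (ι α′) (ι b′) q)
      (sym (cong (_+ 0ℚ * (q * q)) (cong₂ (λ y z → y + z * q)
          (trans (ι-+ (a ℤ.* b′) (b ℤ.* a′)) (cong₂ _+_ (ι-* a b′) (ι-* b a′)))
          (trans (ι-+ (α ℤ.* b′) (b ℤ.* α′)) (cong₂ _+_ (ι-* α b′) (ι-* b α′))))))
      where
      lemma : ∀ a α b a′ α′ b′ q → (a + α * q) * b′ + b * (a′ + α′ * q) ≡ (a * b′ + b * a′) + (α * b′ + b * α′) * q + 0ℚ * (q * q)
      lemma = solve 7 (λ a α b a′ α′ b′ q → (a :+ α :* q) :* b′ :+ b :* (a′ :+ α′ :* q) := (a :* b′ :+ b :* a′) :+ (α :* b′ :+ b :* α′) :* q :+ con 0ℚ :* (q :* q)) refl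

    quad-0 : quad 0ℤ 0ℤ 0ℤ ≅ fromℤ 0ℤ
    quad-0 = pointwise λ k → solve 1 (λ q → con 0ℚ :+ con 0ℚ :* q :+ con 0ℚ :* (q :* q) := con 0ℚ) refl (seq d k)

    lin-injective : ∀ {u u′} v → lin u v ≅ lin u′ v → u ≡ u′
    lin-injective {u} {u′} v e = fromℤ-injective (≅-trans (≅-sym (drop u)) (≅-trans (+-cong e ≅-refl) (drop u′)))
      where
      drop : ∀ u → lin u v -ᴿ fromℤ v *ᴿ d ≅ fromℤ u
      drop u = pointwise λ k → solve 3 (λ u v q → (u :+ v :* q) :- v :* q := u) refl (ι u) (ι v) (seq d k)

    -- Multiply U + 2zd = 0 by the sign z and use z² = 1.
    double≅ : ∀ U z → IsUnit z → quad U (+ 2 ℤ.* z) 0ℤ ≅ fromℤ 0ℤ → fromℕ 2 *ᴿ d ≅ fromℤ (ℤ.- (z ℤ.* U))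
    double≅ U z z-unit e = ≅-trans (pointwise λ k → first k)
      (≅-trans (+-cong (*-cong (≅-refl {fromℤ z}) e) (≅-refl {fromℤ (ℤ.- (z ℤ.* U))})) (pointwise λ k → last))
      where
      z² : ι z * ι z ≡ 1ℚ
      z² = trans (sym (ι-* z z)) (cong ι (unit² z-unit))
      lemma : ∀ U z q → z * (U + ι (+ 2) * z * q + 0ℚ * (q * q)) + - (z * U) ≡ ι (+ 2) * (z * z) * q
      lemma = solve 3 (λ U z q → z :* (U :+ con (ι (+ 2)) :* z :* q :+ con 0ℚ :* (q :* q)) :+ :- (z :* U) := con (ι (+ 2)) :* (z :* z) :* q) refl
      ι-zU : ι (ℤ.- (z ℤ.* U)) ≡ - (ι z * ι U)
      ι-zU = trans (ι-neg (z ℤ.* U)) (cong -_ (ι-* z U))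
      first : ∀ k → ι (+ 2) * seq d k ≡ ι z * (ι U + ι (+ 2 ℤ.* z) * seq d k + 0ℚ * (seq d k * seq d k)) + ι (ℤ.- (z ℤ.* U))
      first k = sym (trans (cong₂ (λ y w → ι z * (ι U + y * seq d k + 0ℚ * (seq d k * seq d k)) + w) (ι-* (+ 2) z) ι-zU)
        (trans (lemma (ι U) (ι z) (seq d k)) (cong (λ y → ι (+ 2) * y * seq d k) z²)))
      last : ι z * ι 0ℤ + ι (ℤ.- (z ℤ.* U)) ≡ ι (ℤ.- (z ℤ.* U))
      last = trans (cong (_+ ι (ℤ.- (z ℤ.* U))) (ℚ.*-zeroʳ (ι z))) (ℚ.+-identityˡ _)

    integer-equation : ∀ {D} → fromℕ 2 *ᴿ d ≅ fromℤ D → ∀ U z → quad U (+ 2 ℤ.* z) 0ℤ ≅ fromℤ 0ℤ → D ℤ.* z ℤ.+ U ≡ 0ℤ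
    integer-equation {D} 2d U z e = fromℤ-injective (≅-trans (pointwise λ k → first)
      (≅-trans (+-cong (*-cong (≅-sym 2d) (≅-refl {fromℤ z})) (≅-refl {fromℤ U})) (≅-trans (pointwise λ k → second k) e)))
      where
      first : ι (D ℤ.* z ℤ.+ U) ≡ ι D * ι z + ι U
      first = trans (ι-+ (D ℤ.* z) U) (cong (_+ ι U) (ι-* D z))
      lemma : ∀ U z q → ι (+ 2) * q * z + U ≡ U + ι (+ 2) * z * q + 0ℚ * (q * q)
      lemma = solve 3 (λ U z q → con (ι (+ 2)) :* q :* z :+ U := U :+ con (ι (+ 2)) :* z :* q :+ con 0ℚ :* (q :* q)) refl
      second : ∀ k → ι (+ 2) * seq d k * ι z + ι U ≡ ι U + ι (+ 2 ℤ.* z) * seq d k + 0ℚ * (seq d k * seq d k)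
      second k = trans (lemma (ι U) (ι z) (seq d k)) (cong (λ y → ι U + y * seq d k + 0ℚ * (seq d k * seq d k)) (sym (ι-* (+ 2) z)))

    halve : ∀ {k} → fromℕ 2 *ᴿ d ≅ fromℤ (+ 2 ℤ.* k) → d ≅ fromℤ k
    halve {k} e = ≅-trans (pointwise λ j → solve 1 (λ q → q := con ½ :* (con (ι (+ 2)) :* q)) refl (seq d j))
      (≅-trans (*-cong (≅-refl {fromℚ ½}) e) (pointwise λ _ → trans (cong (½ *_) (ι-* (+ 2) k))
        (solve 1 (λ q → con ½ :* (con (ι (+ 2)) :* q) := q) refl (ι k))))

    -- `part` will be `re` or `im`. `sum` takes off the first term and `Σ` the last, hence the
    -- shifted coefficients and `Σ-head`.
    sum-quad : ∀ (part : ℂ → ℝ) → (∀ z w → part (z +ᶜ w) ≡ part z +ᴿ part w) → part 0ᶜ ≡ fromℤ 0ℤ →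
      ∀ n (t : Fin n → ℂ) u v w → (∀ j → part (t j) ≅ quad (u (+ toℕ j)) (v (+ toℕ j)) (w (+ toℕ j))) →
      part (sum t) ≅ quad (Σ n u) (Σ n v) (Σ n w)
    sum-quad part part-+ part-0 zero    t u v w e = subst (_≅ quad 0ℤ 0ℤ 0ℤ) (sym part-0) (≅-sym quad-0)
    sum-quad part part-+ part-0 (suc n) t u v w e = subst (_≅ quad (Σ (suc n) u) (Σ (suc n) v) (Σ (suc n) w)) (sym (part-+ (t zero) (sum (λ j → t (suc j)))))
      (≅-trans (+-cong (e zero) (sum-quad part part-+ part-0 n (λ j → t (suc j)) (shift u) (shift v) (shift w)
          (λ j → subst (λ x → part (t (suc j)) ≅ quad (u x) (v x) (w x)) (ℤ.+-comm 1ℤ (+ toℕ j)) (e (suc j)))))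
        (≅-trans (quad-+ (u 0ℤ) (v 0ℤ) (w 0ℤ) (Σ n (shift u)) (Σ n (shift v)) (Σ n (shift w)))
          (≅-reflexive (trans (cong₂ (λ y z → quad y z (w 0ℤ ℤ.+ Σ n (shift w))) (sym (Σ-head n u)) (sym (Σ-head n v)))
            (cong (quad (Σ (suc n) u) (Σ (suc n) v)) (sym (Σ-head n w)))))))
      where
      shift : (ℤ → ℤ) → ℤ → ℤ
      shift f x = f (x ℤ.+ 1ℤ)

  module Rows (d : ℝ) (m : ℕ) (c : Fin (suc m) → ℂ) (hermitian : IsHermitian (circ c))
    (c-0 : ∀ j → toℕ j ≡ 0 → c j ≈ fromℝ d)
    (c-units : ∀ j → toℕ j ≢ 0 → c j ≈ 1ᶜ ⊎ c j ≈ -ᶜ 1ᶜ ⊎ c j ≈ Defs.i ⊎ c j ≈ -ᶜ Defs.i) where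

    open Quadratic d

    private
      n = suc m

    IsFourthRoot : ℂ → Set
    IsFourthRoot z = z ≈ 1ᶜ ⊎ z ≈ -ᶜ 1ᶜ ⊎ z ≈ Defs.i ⊎ z ≈ -ᶜ Defs.i

    -- Equality of Cauchy reals cannot be decided, so the integers are read from the disjunct that
    -- the hypothesis supplies and not from z.
    decode : ∀ z → IsFourthRoot z → ℤ × ℤ
    decode z (inj₁ _)               = 1ℤ , 0ℤ
    decode z (inj₂ (inj₁ _))        = -1ℤ , 0ℤ
    decode z (inj₂ (inj₂ (inj₁ _))) = 0ℤ , 1ℤ
    decode z (inj₂ (inj₂ (inj₂ _))) = 0ℤ , -1ℤ

    UnitParts : ℤ × ℤ → Set
    UnitParts (a , b) = (IsUnit a × b ≡ 0ℤ) ⊎ (a ≡ 0ℤ × IsUnit b)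

    decode-units : ∀ z (u : IsFourthRoot z) → UnitParts (decode z u)
    decode-units z (inj₁ _)               = inj₁ (inj₁ refl , refl)
    decode-units z (inj₂ (inj₁ _))        = inj₁ (inj₂ refl , refl)
    decode-units z (inj₂ (inj₂ (inj₁ _))) = inj₂ (refl , inj₁ refl)
    decode-units z (inj₂ (inj₂ (inj₂ _))) = inj₂ (refl , inj₂ refl)

    decode-≅ : ∀ z (u : IsFourthRoot z) → re z ≅ lin (proj₁ (decode z u)) 0ℤ × im z ≅ fromℤ (proj₂ (decode z u))
    decode-≅ z = go
      where
      target : ∀ {x} a → x ≅ fromℤ a → x ≅ lin a 0ℤ
      target a e = ≅-trans e (pointwise λ k → solve 2 (λ a q → a := a :+ con 0ℚ :* q) refl (ι a) (seq d k))
      go : (u : IsFourthRoot z) → re z ≅ lin (proj₁ (decode z u)) 0ℤ × im z ≅ fromℤ (proj₂ (decode z u))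
      go (inj₁ (x , y))               = target 1ℤ (near x) , near y
      go (inj₂ (inj₁ (x , y)))        = target -1ℤ (≅-trans (near {y = -ᴿ fromℕ 1} x) (pointwise λ _ → refl)) , ≅-trans (near {y = -ᴿ fromℕ 0} y) (pointwise λ _ → refl)
      go (inj₂ (inj₂ (inj₁ (x , y)))) = target 0ℤ (near x) , near y
      go (inj₂ (inj₂ (inj₂ (x , y)))) = target 0ℤ (≅-trans (near {y = -ᴿ fromℕ 0} x) (pointwise λ _ → refl)) , ≅-trans (near {y = -ᴿ fromℕ 1} y) (pointwise λ _ → refl)

    -- At 0 both parts are 0: the diagonal d enters through the coefficient `δ n x` in `C-parts`.
    parts : Fin n → ℤ × ℤ
    parts zero    = 0ℤ , 0ℤ
    parts (suc j) = decode (c (suc j)) (c-units (suc j) (λ ()))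

    parts-0 : ∀ j → toℕ j ≡ 0 → parts j ≡ (0ℤ , 0ℤ)
    parts-0 zero _ = refl

    parts-units : ∀ j → toℕ j ≢ 0 → UnitParts (parts j)
    parts-units zero    j≢0 = ⊥-elim (j≢0 refl)
    parts-units (suc j) _   = decode-units (c (suc j)) (c-units (suc j) (λ ()))

    a b : ℤ → ℤ
    a x = proj₁ (parts (index n x))
    b x = proj₂ (parts (index n x))

    C : ℤ → ℂ
    C x = c (index n x)

    C-parts : ∀ x → re (C x) ≅ lin (a x) (δ n x) × im (C x) ≅ fromℤ (b x)
    C-parts x = go (+ n ∣? x)
      where
      at-0 : ∀ j → toℕ j ≡ 0 → re (c j) ≅ lin (proj₁ (parts j)) 1ℤ × im (c j) ≅ fromℤ (proj₂ (parts j))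
      at-0 zero e = ≅-trans (near {y = d} (proj₁ (c-0 zero e))) (pointwise λ k → solve 1 (λ q → q := con 0ℚ :+ con 1ℚ :* q) refl (seq d k)) , near (proj₂ (c-0 zero e))
      off-0 : ∀ j → toℕ j ≢ 0 → re (c j) ≅ lin (proj₁ (parts j)) 0ℤ × im (c j) ≅ fromℤ (proj₂ (parts j))
      off-0 zero    j≢0 = ⊥-elim (j≢0 refl)
      off-0 (suc j) _   = decode-≅ (c (suc j)) (c-units (suc j) (λ ()))
      go : Dec (+ n ∣ x) → re (C x) ≅ lin (a x) (δ n x) × im (C x) ≅ fromℤ (b x)
      go (yes p) = subst (λ v → re (C x) ≅ lin (a x) v × im (C x) ≅ fromℤ (b x)) (sym (δ-∣ p)) (at-0 (index n x) (index-∣ n p))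
      go (no p)  = subst (λ v → re (C x) ≅ lin (a x) v × im (C x) ≅ fromℤ (b x)) (sym (δ-∤ p)) (off-0 (index n x) (index-∤ n p))

    C-cong : ∀ {x y} → + n ∣ x ℤ.- y → C x ≡ C y
    C-cong {x} {y} p = cong c (index-cong n {x} {y} p)

    conjugate : ∀ x → re (C (ℤ.- x)) ≅ re (C x) × -ᴿ im (C (ℤ.- x)) ≅ im (C x)
    conjugate x = subst₂ (λ z w → re z ≅ re w × -ᴿ im z ≅ im w)
      (C-cong {+ 0 ℤ.- + toℕ s} {ℤ.- x} (∣-respʳ (lemma₁ x (+ toℕ s)) (index-difference n x)))
      (C-cong {+ toℕ s ℤ.- + 0} {x} (∣-respʳ (lemma₂ x (+ toℕ s)) (∣m⇒∣-m (index-difference n x))))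
      (near (proj₁ (hermitian zero s)) , near (proj₂ (hermitian zero s)))
      where
      s = index n x
      lemma₁ : ∀ x s → x ℤ.- s ≡ (+ 0 ℤ.- s) ℤ.- (ℤ.- x)
      lemma₁ = solve-∀
      lemma₂ : ∀ x s → ℤ.- (x ℤ.- s) ≡ (s ℤ.- + 0) ℤ.- x
      lemma₂ = solve-∀

    a-even : ∀ x → a (ℤ.- x) ≡ a x
    a-even x = lin-injective (δ n x) (≅-trans (≅-reflexive (cong (lin (a (ℤ.- x))) (sym (δ-cong ∣-neg⁻ ∣m⇒∣-m))))
      (≅-trans (≅-sym (proj₁ (C-parts (ℤ.- x)))) (≅-trans (proj₁ (conjugate x)) (proj₁ (C-parts x)))))

    b-odd : ∀ x → b (ℤ.- x) ≡ ℤ.- b x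
    b-odd x = trans (sym (ℤ.neg-involutive (b (ℤ.- x)))) (cong ℤ.-_ (fromℤ-injective (≅-trans (pointwise λ _ → ι-neg (b (ℤ.- x)))
      (≅-trans (-‿cong (≅-sym (proj₂ (C-parts (ℤ.- x))))) (≅-trans (proj₂ (conjugate x)) (proj₂ (C-parts x)))))))

    module _ {N : ℝ} (orthogonal : circ c ⊗ circ c ⋆ ≋ fromℝ N · I) where

      term : ℤ → Fin n → ℂ
      term s k = C (+ toℕ k ℤ.- + 0) *ᶜ conj (C (+ toℕ k ℤ.- s))

      module _ (s : ℤ) (k : Fin n) where

        private
          x = + toℕ k
          C-k : re (C (x ℤ.- + 0)) ≅ lin (a x) (δ n x) × im (C (x ℤ.- + 0)) ≅ fromℤ (b x)
          C-k = subst (λ y → re (C y) ≅ lin (a x) (δ n x) × im (C y) ≅ fromℤ (b x)) (sym (ℤ.+-identityʳ x)) (C-parts x)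
          -- The Hermitian symmetry turns the conjugate of C (x - s) into C (s - x), so that row 0
          -- against row s becomes a cyclic convolution.
          C-s-k : re (C (x ℤ.- s)) ≅ lin (a (s ℤ.- x)) (δ n (s ℤ.- x)) × -ᴿ im (C (x ℤ.- s)) ≅ fromℤ (b (s ℤ.- x))
          C-s-k = subst (λ y → re (C y) ≅ lin (a (s ℤ.- x)) (δ n (s ℤ.- x)) × -ᴿ im (C y) ≅ fromℤ (b (s ℤ.- x))) (lemma s x)
            (≅-trans (proj₁ (conjugate (s ℤ.- x))) (proj₁ (C-parts (s ℤ.- x))) , ≅-trans (proj₂ (conjugate (s ℤ.- x))) (proj₂ (C-parts (s ℤ.- x))))
            where
            lemma : ∀ s x → ℤ.- (s ℤ.- x) ≡ x ℤ.- s
            lemma = solve-∀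

        re-term : re (term s k) ≅ quad (a x ℤ.* a (s ℤ.- x) ℤ.- b x ℤ.* b (s ℤ.- x)) (a x ℤ.* δ n (s ℤ.- x) ℤ.+ δ n x ℤ.* a (s ℤ.- x)) (δ n x ℤ.* δ n (s ℤ.- x))
        re-term = ≅-trans (+-cong (*-cong (proj₁ C-k) (proj₁ C-s-k)) (-‿cong (*-cong (proj₂ C-k) (proj₂ C-s-k))))
          (re-product (a x) (δ n x) (b x) (a (s ℤ.- x)) (δ n (s ℤ.- x)) (b (s ℤ.- x)))

        im-term : im (term s k) ≅ quad (a x ℤ.* b (s ℤ.- x) ℤ.+ b x ℤ.* a (s ℤ.- x)) (δ n x ℤ.* b (s ℤ.- x) ℤ.+ b x ℤ.* δ n (s ℤ.- x)) 0ℤ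
        im-term = ≅-trans (+-cong (*-cong (proj₁ C-k) (proj₂ C-s-k)) (*-cong (proj₂ C-k) (proj₁ C-s-k)))
          (im-product (a x) (δ n x) (b x) (a (s ℤ.- x)) (δ n (s ℤ.- x)) (b (s ℤ.- x)))

      a-periodic : Periodic n a
      a-periodic x = cong (λ j → proj₁ (parts j)) (index-periodic n x)

      b-periodic : Periodic n b
      b-periodic x = cong (λ j → proj₂ (parts j)) (index-periodic n x)

      δ-convˡ : ∀ {f} → Periodic n f → ∀ x → conv n (δ n) f x ≡ f x
      δ-convˡ per x = trans (conv-comm n (δ-periodic n) per x) (conv-δ n per x)

      double : ∀ z → z ℤ.+ z ≡ + 2 ℤ.* z
      double = solve-∀

      -- The coefficient of d is a * δ + δ * a = 2a in the real part and 2b in the imaginary part;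
      -- that of d² is δ * δ = δ in the real part, which vanishes at k.
      row : ∀ k → 0 ℕ.< k → k ℕ.< n →
        quad (conv n a a (+ k) ℤ.- conv n b b (+ k)) (+ 2 ℤ.* a (+ k)) 0ℤ ≅ fromℤ 0ℤ ×
        quad (+ 2 ℤ.* conv n a b (+ k)) (+ 2 ℤ.* b (+ k)) 0ℤ ≅ fromℤ 0ℤ
      row (suc k) _ (s≤s k<m) =
        subst (λ x → quad (conv n a a x ℤ.- conv n b b x) (+ 2 ℤ.* a x) 0ℤ ≅ fromℤ 0ℤ × quad (+ 2 ℤ.* conv n a b x) (+ 2 ℤ.* b x) 0ℤ ≅ fromℤ 0ℤ)
          (cong (λ j → + suc j) (toℕ-fromℕ< k<m)) (re-row , im-row)
        where
        -- A visible successor, so that the entry of the identity matrix at (0, s) reduces to 0.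
        s = suc (fromℕ< k<m)
        y = + toℕ s
        n∤y : ¬ + n ∣ y
        n∤y = <⇒∤ (s≤s z≤n) (toℕ<n s)
        re-row : quad (conv n a a y ℤ.- conv n b b y) (+ 2 ℤ.* a y) 0ℤ ≅ fromℤ 0ℤ
        re-row = ≅-trans (≅-sym (≅-trans (sum-quad re (λ _ _ → refl) refl n (term y) _ _ _ (re-term y))
            (≅-reflexive (trans (cong₂ (λ u v → quad u v (conv n (δ n) (δ n) y))
                (trans (Σ-+ n (λ x → a x ℤ.* a (y ℤ.- x)) (λ x → ℤ.- (b x ℤ.* b (y ℤ.- x)))) (cong (ℤ._+_ (conv n a a y))
                  (trans (Σ-cong n (λ x → sym (ℤ.-1*i≡-i (b x ℤ.* b (y ℤ.- x))))) (trans (Σ-*ˡ n -1ℤ (λ x → b x ℤ.* b (y ℤ.- x))) (ℤ.-1*i≡-i (conv n b b y))))))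
                (trans (Σ-+ n (λ x → a x ℤ.* δ n (y ℤ.- x)) (λ x → δ n x ℤ.* a (y ℤ.- x)))
                  (trans (cong₂ ℤ._+_ (conv-δ n a-periodic y) (δ-convˡ a-periodic y)) (double (a y)))))
              (cong (quad (conv n a a y ℤ.- conv n b b y) (+ 2 ℤ.* a y)) (trans (δ-convˡ (δ-periodic n) y) (δ-∤ n∤y)))))))
          (≅-trans (near {y = re (fromℝ N *ᶜ 0ᶜ)} (proj₁ (orthogonal zero s))) (pointwise λ k → solve 1 (λ q → q :* con 0ℚ :- con 0ℚ :* con 0ℚ := con 0ℚ) refl (seq N k)))
        im-row : quad (+ 2 ℤ.* conv n a b y) (+ 2 ℤ.* b y) 0ℤ ≅ fromℤ 0ℤ
        im-row = ≅-trans (≅-sym (≅-trans (sum-quad im (λ _ _ → refl) refl n (term y) _ _ (λ _ → 0ℤ) (im-term y))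
            (≅-reflexive (trans (cong₂ (λ u v → quad u v (Σ n (λ _ → 0ℤ)))
                (trans (Σ-+ n (λ x → a x ℤ.* b (y ℤ.- x)) (λ x → b x ℤ.* a (y ℤ.- x)))
                  (trans (cong (ℤ._+_ (conv n a b y)) (conv-comm n b-periodic a-periodic y)) (double (conv n a b y))))
                (trans (Σ-+ n (λ x → δ n x ℤ.* b (y ℤ.- x)) (λ x → b x ℤ.* δ n (y ℤ.- x)))
                  (trans (cong₂ ℤ._+_ (δ-convˡ b-periodic y) (conv-δ n b-periodic y)) (double (b y)))))
              (cong (quad (+ 2 ℤ.* conv n a b y) (+ 2 ℤ.* b y)) (Σ-0 n))))))
          (≅-trans (near {y = im (fromℝ N *ᶜ 0ᶜ)} (proj₂ (orthogonal zero s))) (pointwise λ k → solve 1 (λ q → q :* con 0ℚ :+ con 0ℚ :* con 0ℚ := con 0ℚ) refl (seq N k)))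

      -- At position 1 either a or b is a sign; the real or the imaginary equation accordingly has d
      -- with coefficient ±2.
      twice-diagonal : 1 ℕ.< n → ∃[ D ] fromℕ 2 *ᴿ d ≅ fromℤ D
      twice-diagonal 1<n = [ (λ (u , _) → ℤ.- (a 1ℤ ℤ.* (conv n a a 1ℤ ℤ.- conv n b b 1ℤ)) , double≅ (conv n a a 1ℤ ℤ.- conv n b b 1ℤ) (a 1ℤ) u (proj₁ (row 1 (s≤s z≤n) 1<n))) ,
                             (λ (_ , u) → ℤ.- (b 1ℤ ℤ.* (+ 2 ℤ.* conv n a b 1ℤ)) , double≅ (+ 2 ℤ.* conv n a b 1ℤ) (b 1ℤ) u (proj₂ (row 1 (s≤s z≤n) 1<n))) ]′ (parts-units (index n 1ℤ) (index-∤ n (<⇒∤ (s≤s z≤n) 1<n)))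

      solution : ∀ {D} → fromℕ 2 *ᴿ d ≅ fromℕ D → Solution n D a b
      solution {D} 2d = record
        { a-periodic = a-periodic
        ; b-periodic = b-periodic
        ; a-even = a-even
        ; b-odd = b-odd
        ; diagonal = λ x p → cong proj₁ (parts-0 (index n x) (index-∣ n p)) , cong proj₂ (parts-0 (index n x) (index-∣ n p))
        ; units = λ x p → parts-units (index n x) (index-∤ n p)
        ; real-part = from-representatives n {λ x → + D ℤ.* a x ℤ.+ (conv n a a x ℤ.- conv n b b x)}
            (λ x → cong₂ ℤ._+_ (cong (+ D ℤ.*_) (a-periodic x)) (cong₂ ℤ._-_ (conv-periodic n a a-periodic x) (conv-periodic n b b-periodic x)))
            (_≡ 0ℤ) (λ k 0<k k<n → integer-equation {+ D} 2d (conv n a a (+ k) ℤ.- conv n b b (+ k)) (a (+ k)) (proj₁ (row k 0<k k<n)))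
        ; imag-part = from-representatives n {λ x → + D ℤ.* b x ℤ.+ + 2 ℤ.* conv n a b x}
            (λ x → cong₂ ℤ._+_ (cong (+ D ℤ.*_) (b-periodic x)) (cong (+ 2 ℤ.*_) (conv-periodic n a b-periodic x)))
            (_≡ 0ℤ) (λ k 0<k k<n → integer-equation {+ D} 2d (+ 2 ℤ.* conv n a b (+ k)) (b (+ k)) (proj₂ (row k 0<k k<n)))
        }

-- The constant and the alternating generator.

module Forms where

  open PeriodicSums
  open RealCase using (sgn; sgn-+; sgn-∣; sgn-∤; sgn-unit; unit²; twist)
  open CauchyReals
  open Circulants
  open import Defs hiding (i; quotient)
  open import Data.Fin.Base using (Fin; zero; suc; toℕ)
  open import Data.Fin.Properties using (toℕ<n)
  open import Data.Integer.Base as ℤ using (ℤ; +_; 0ℤ; 1ℤ; -1ℤ)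
  open import Data.Integer.Divisibility.Signed using (_∣_; divides)
  open import Data.Integer.Tactic.RingSolver using (solve-∀)
  import Data.Integer.Properties as ℤ
  open import Data.Nat.Base as ℕ using (ℕ; zero; suc; s≤s; z≤n)
  import Data.Nat.Divisibility as ℕ
  open import Data.Product.Base using (_×_; _,_; proj₁; proj₂)
  open import Data.Rational.Base as ℚ using (0ℚ; 1ℚ; _+_; _-_; _*_; -_)
  open import Data.Rational.Solver using (module +-*-Solver)
  open import Data.Sum.Base using (_⊎_)
  open import Relation.Binary.PropositionalEquality hiding ([_])
  open import Relation.Nullary using (¬_)
  open +-*-Solver

  -- All sequences involved are constant, so they are compared term by term in ℚ.
  powers-of-−1 : ∀ k n → seq (re ((-ᶜ 1ᶜ) ^ k)) n ≡ ι (sgn (+ k)) × seq (im ((-ᶜ 1ᶜ) ^ k)) n ≡ 0ℚ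
  powers-of-−1 zero    n = sym (cong ι (sgn-∣ (∣0 (+ 2)))) , refl
  powers-of-−1 (suc k) n = let r , i = powers-of-−1 k n in
    trans (cong₂ (λ r i → - 1ℚ * r - (- 0ℚ) * i) r i) (trans (re-lemma (ι (sgn (+ k)))) (sym (trans (cong ι sgn-suc) (ι-neg (sgn (+ k)))))) ,
    trans (cong₂ (λ r i → - 1ℚ * i + (- 0ℚ) * r) r i) (im-lemma (ι (sgn (+ k))))
    where
    sgn-suc : sgn (+ suc k) ≡ ℤ.- sgn (+ k)
    sgn-suc = trans (sgn-+ 1ℤ (+ k)) (trans (cong (ℤ._* sgn (+ k)) (sgn-∤ {1ℤ} (<⇒∤ {1} {2} (s≤s z≤n) (s≤s (s≤s z≤n))))) (ℤ.-1*i≡-i (sgn (+ k))))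
    re-lemma : ∀ x → - 1ℚ * x - (- 0ℚ) * 0ℚ ≡ - x
    re-lemma = solve 1 (λ x → (:- con 1ℚ) :* x :- (:- con 0ℚ) :* con 0ℚ := :- x) refl
    im-lemma : ∀ x → - 1ℚ * 0ℚ + (- 0ℚ) * x ≡ 0ℚ
    im-lemma = solve 1 (λ x → (:- con 1ℚ) :* con 0ℚ :+ (:- con 0ℚ) :* x := con 0ℚ) refl

  module Matrices (d : ℝ) (m : ℕ) (c : Fin (2 ℕ.+ m) → ℂ) (hermitian : IsHermitian (circ c))
    (c-0 : ∀ j → toℕ j ≡ 0 → c j ≈ fromℝ d)
    (c-units : ∀ j → toℕ j ≢ 0 → c j ≈ 1ᶜ ⊎ c j ≈ -ᶜ 1ᶜ ⊎ c j ≈ Defs.i ⊎ c j ≈ -ᶜ Defs.i) where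

    open Rows d (suc m) c hermitian c-0 c-units
    open Quadratic d

    private
      n = 2 ℕ.+ m

    n∤ : ∀ (j : Fin (suc m)) → ¬ + n ∣ + toℕ (suc j)
    n∤ j = <⇒∤ (s≤s z≤n) (s≤s (toℕ<n j))

    entry : ∀ j → re (c (suc j)) ≅ fromℤ (a (+ toℕ (suc j))) × im (c (suc j)) ≅ fromℤ (b (+ toℕ (suc j)))
    entry j = ≅-trans (subst (λ k → re (c k) ≅ lin (a x) (δ n x)) (index-toℕ n (suc j)) (proj₁ (C-parts x)))
        (≅-trans (≅-reflexive (cong (lin (a x)) (δ-∤ (n∤ j)))) (pointwise λ k → solve 2 (λ u q → u :+ con 0ℚ :* q := u) refl (ι (a x)) (seq d k))) ,
      subst (λ k → im (c k) ≅ fromℤ (b x)) (index-toℕ n (suc j)) (proj₂ (C-parts x))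
      where
      x = + toℕ (suc j)

    generated : ∀ f → (∀ j → re (c (suc j)) ≅ re (f (suc (toℕ j))) × im (c (suc j)) ≅ im (f (suc (toℕ j)))) →
      circ c ≋ circ (generator (fromℝ d) f)
    generated f e r s = go (index n (+ toℕ s ℤ.- + toℕ r))
      where
      go : ∀ j → c j ≈ generator (fromℝ d) f j
      go zero    = c-0 zero refl
      go (suc j) = distance (proj₁ (e j)) , distance (proj₂ (e j))

    module _ (b-vanishes : ∀ x → b x ≡ 0ℤ) where

      real : ∀ r s → IsReal (circ c r s)
      real r s = let x = + toℕ s ℤ.- + toℕ r in distance (≅-trans (proj₂ (C-parts x)) (≅-reflexive (cong fromℤ (b-vanishes x))))

      constant : (∀ x → ¬ + n ∣ x → a x ≡ -1ℤ) → circ c ≋ circ (generator (fromℝ d) (λ _ → -ᶜ 1ᶜ))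
      constant a≡-1 = generated (λ _ → -ᶜ 1ᶜ) λ j →
        ≅-trans (proj₁ (entry j)) (pointwise λ _ → cong ι (a≡-1 (+ toℕ (suc j)) (n∤ j))) ,
        ≅-trans (proj₂ (entry j)) (pointwise λ _ → cong ι (b-vanishes (+ toℕ (suc j))))

      alternating : (∀ x → ¬ + n ∣ x → twist a x ≡ -1ℤ) → circ c ≋ circ (generator (fromℝ d) (λ j → (-ᶜ 1ᶜ) ^ suc j))
      alternating twist≡-1 = generated (λ j → (-ᶜ 1ᶜ) ^ suc j) λ j →
        -- The position is 1 + toℕ j, hence the exponent 2 + toℕ j.
        ≅-trans (proj₁ (entry j)) (pointwise λ k → trans (cong ι (a≡ (+ toℕ (suc j)) (n∤ j))) (sym (proj₁ (powers-of-−1 (2 ℕ.+ toℕ j) k)))) ,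
        ≅-trans (proj₂ (entry j)) (pointwise λ k → trans (cong ι (b-vanishes (+ toℕ (suc j)))) (sym (proj₂ (powers-of-−1 (2 ℕ.+ toℕ j) k))))
        where
        lemma : ∀ s u → s ℤ.* (s ℤ.* u) ≡ (s ℤ.* s) ℤ.* u
        lemma = solve-∀
        -- A sign is its own inverse, so sgn x · a x = -1 gives a x = -sgn x.
        a≡ : ∀ x → ¬ + n ∣ x → a x ≡ sgn (1ℤ ℤ.+ x)
        a≡ x n∤x = trans (sym (trans (lemma (sgn x) (a x)) (trans (cong (ℤ._* a x) (unit² (sgn-unit x))) (ℤ.*-identityˡ (a x)))))
          (trans (cong (sgn x ℤ.*_) (twist≡-1 x n∤x)) (trans (ℤ.*-comm (sgn x) -1ℤ)
            (sym (trans (sgn-+ 1ℤ x) (cong (ℤ._* sgn x) (sgn-∤ {1ℤ} (<⇒∤ {1} {2} (s≤s z≤n) (s≤s (s≤s z≤n)))))))))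

  module _ {d : ℝ} {D : ℕ} (2d : fromℕ 2 *ᴿ d ≅ fromℕ D) where

    open Quadratic d

    ¬odd⇒ : ¬ IsOddInteger d → ∀ j → D ≢ 2 ℕ.* suc (2 ℕ.* j)
    ¬odd⇒ not-odd j e = not-odd (+ j , distance (halve {+ 2 ℤ.* + j ℤ.+ + 1} (≅-trans 2d (≅-reflexive (cong fromℤ eq)))))
      where
      eq : + D ≡ + 2 ℤ.* (+ 2 ℤ.* + j ℤ.+ + 1)
      eq = trans (cong +_ e) (trans (ℤ.pos-* 2 (suc (2 ℕ.* j))) (cong (+ 2 ℤ.*_)
        (trans (ℤ.+-comm 1ℤ (+ (2 ℕ.* j))) (cong (ℤ._+ 1ℤ) (ℤ.pos-* 2 j)))))

    half⇒ : IsHalfInteger d → ¬ 2 ℕ.∣ D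
    half⇒ (k , e) (ℕ.divides q D≡) = <⇒∤ {1} {2} (s≤s z≤n) (s≤s (s≤s z≤n)) (divides (+ q ℤ.- k)
        (trans (lemma (+ 2 ℤ.* k)) (trans (cong (ℤ._- + 2 ℤ.* k) odd≡even) (lemma′ (+ q) k))))
      where
      lemma : ∀ z → 1ℤ ≡ (z ℤ.+ + 1) ℤ.- z
      lemma = solve-∀
      lemma′ : ∀ q k → q ℤ.* + 2 ℤ.- + 2 ℤ.* k ≡ (q ℤ.- k) ℤ.* + 2
      lemma′ = solve-∀
      odd≡even : + 2 ℤ.* k ℤ.+ + 1 ≡ + q ℤ.* + 2
      odd≡even = trans (sym (fromℤ-injective (≅-trans (≅-sym 2d) (near e)))) (trans (cong +_ D≡) (ℤ.pos-* q 2))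

    order : ∀ {n} → n ≡ 2 ℕ.+ D → fromℕ n ≃ fromℕ 2 *ᴿ d +ᴿ fromℕ 2
    order refl = distance {fromℕ (2 ℕ.+ D)} {fromℕ 2 *ᴿ d +ᴿ fromℕ 2} (≅-trans (pointwise {y = fromℕ D +ᴿ fromℕ 2} λ _ → trans (cong ι (ℤ.+-comm (+ 2) (+ D))) (ι-+ (+ D) (+ 2)))
      (+-cong (≅-sym 2d) (≅-refl {fromℕ 2})))

-- Transfer of the integer classification to C.

open import Defs
open import Data.Empty using (⊥-elim)
open import Data.Fin.Base using (Fin; toℕ)
open import Data.Integer.Base using (+_)
open import Data.Nat.Base as ℕ using (ℕ; suc; _≤_; s≤s; z≤n)
open import Data.Product.Base using (_×_; _,_; ∃-syntax; proj₁; proj₂)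
open import Data.Sum.Base as Sum using (_⊎_; [_,_]′)
open import Relation.Binary.PropositionalEquality using (_≡_; _≢_; subst)
open import Relation.Nullary using (¬_)
open ModFour using (Conclusion; classification)
open CauchyReals using (_≅_; double-nonneg)
open Circulants using (module Rows)
open Forms using (order; half⇒; ¬odd⇒)

theorem1 : (d : ℝ) → fromℕ 0 ≤ᴿ d → ¬ IsOddInteger d →
    (n : ℕ) → 2 ≤ n →
    (c : Fin n → ℂ) →
    IsHermitian (circ c) →
    (∀ j → toℕ j ≡ 0 → c j ≈ fromℝ d) →
    (∀ j → toℕ j ≢ 0 → c j ≈ 1ᶜ ⊎ c j ≈ -ᶜ 1ᶜ ⊎ c j ≈ i ⊎ c j ≈ -ᶜ i) →
    circ c ⊗ circ c ⋆ ≋ fromℝ (d *ᴿ d +ᴿ fromℕ n -ᴿ fromℕ 1) · I →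
    fromℕ n ≃ fromℕ 2 *ᴿ d +ᴿ fromℕ 2 ×
    (∀ r s → IsReal (circ c r s)) ×
    (IsEvenInteger d →
    circ c ≋ circ (generator (fromℝ d) (λ _ → -ᶜ 1ᶜ)) ⊎
    circ c ≋ circ (generator (fromℝ d) (λ j → (-ᶜ 1ᶜ) ^ suc j))) ×
    (IsHalfInteger d →
    circ c ≋ circ (generator (fromℝ d) (λ _ → -ᶜ 1ᶜ)))
theorem1 d d≥0 not-odd (suc (suc m)) (s≤s (s≤s z≤n)) c hermitian c-0 c-units orthogonal =
  order 2d (proj₁ conclusion) ,
  F.real b-vanishes ,
  (λ _ → Sum.map (F.constant b-vanishes) (λ (_ , a-alternates) → F.alternating b-vanishes a-alternates) form) ,
  -- The alternating form comes with 2 ∣ D, whereas D = 2d is odd for half-integral d.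
  (λ half → [ F.constant b-vanishes , (λ (2∣D , _) → ⊥-elim (half⇒ 2d half 2∣D)) ]′ form)
  where
  n = 2 ℕ.+ m
  N = d *ᴿ d +ᴿ fromℕ n -ᴿ fromℕ 1
  module R = Rows d (suc m) c hermitian c-0 c-units
  module F = Forms.Matrices d m c hermitian c-0 c-units
  twice : ∃[ k ] fromℕ 2 *ᴿ d ≅ fromℤ k
  twice = R.twice-diagonal {N} orthogonal (s≤s (s≤s z≤n))
  nonneg : ∃[ D ] proj₁ twice ≡ + D
  nonneg = double-nonneg (proj₁ twice) d≥0 (proj₂ twice)
  D = proj₁ nonneg
  2d : fromℕ 2 *ᴿ d ≅ fromℕ D
  2d = subst (λ k → fromℕ 2 *ᴿ d ≅ fromℤ k) (proj₂ nonneg) (proj₂ twice)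
  conclusion : Conclusion n D R.a R.b
  conclusion = classification (s≤s (s≤s z≤n)) (R.solution {N} orthogonal 2d) (¬odd⇒ 2d not-odd)
  b-vanishes = proj₁ (proj₂ conclusion)
  form = proj₂ (proj₂ conclusion)
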